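{- Let $\Gamma$ be a connected circulant graph with valency $5$. Then $\Gamma$ is closed distance magic if and only if $\Gamma$ is isomorphic to $\mathrm{Cay}(\mathbb{Z}_n;\{\pm 1,\pm c,n/2\})$ for some even integer $n$ and some integer $c$ with $1<c<n/2$ such that one of the following (i)--(iv) holds: (i) $c=n/2-1$; (ii) $n\equiv 2 \pmod 4$, $c$ is even, and $2(c^2-1)$ is an odd multiple of $n$; (iii) $n=3\cdot 2^t(6k+(-1)^t)$ and $c=2^{t-1}(6k+(-1)^t)-1$ for some integer $t\ge 2$ and some integer $k\ge 0$ such that $c\ge 2$; (iv) $n=3\cdot 2^t(6k-(-1)^t)$ and $c=2^{t-1}(6k-(-1)^t)+1$ for some integer $t\ge 2$ and some integer $k\ge 0$ such that $c\ge 2$.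
   Context: All graphs are finite, simple and undirected. For a finite group $G$ and an inverse-closed subset $S\subseteq G$ not containing the identity, the Cayley graph $\mathrm{Cay}(G;S)$ has vertex set $G$, with $g,h$ adjacent iff $h=gs$ for some $s\in S$; its valency is $|S|$. A circulant graph is a Cayley graph $\mathrm{Cay}(G;S)$ with $G$ a finite cyclic group, i.e. $\mathrm{Cay}(\mathbb{Z}_n;S)$ for some $n$ (written additively). For a vertex $u$, the closed neighborhood $N[u]$ consists of $u$ and all its neighbors. A closed distance magic labeling of a graph $\Gamma=(V,E)$ of order $n=|V|$ is a bijection $\ell:V\to\{1,2,\ldots,n\}$ for which there is a positive integer $r$ with $\sum_{x\in N[u]}\ell(x)=r$ for all $u\in V$. A graph is closed distance magic if it admits a closed distance magic labeling. -}

module Defs where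

open import Algebra.Core using (Op₁; Op₂)
open import Algebra.Structures using (IsGroup)
open import Data.Bool.Base using (if_then_else_)
open import Data.Fin.Base using (Fin; toℕ; fromℕ<)
open import Data.Fin.Permutation using (Permutation′; _⟨$⟩ʳ_)
open import Data.Fin.Properties using (any?; toℕ-injective; toℕ-fromℕ<; toℕ<n) renaming (_≟_ to _≟ᶠ_)
open import Data.Fin.Subset using (Subset; _∈_; _∉_; ⁅_⁆; _∪_; ∣_∣)
open import Data.Fin.Subset.Properties using (_∈?_; x∈⁅x⁆; x∈⁅y⁆⇒x≡y; x∈p∪q⁺; x∈p∪q⁻)
open import Data.Integer.Base as ℤ using (ℤ; +_; 0ℤ; 1ℤ; -1ℤ; _%ℕ_; _/ℕ_)
open import Data.Integer.DivMod using (n%ℕd<d; a≡a%ℕn+[a/ℕn]*n)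
import Data.Integer.Properties as ℤ
open import Data.Integer.Tactic.RingSolver using (solve-∀)
open import Data.Nat.Base using (ℕ; suc; _+_; _*_; _∸_; _^_; _/_; _%_; _≤_; _<_; z<s; z≤n; NonZero)
open import Data.Nat.Divisibility using (_∣_)
open import Data.Nat.DivMod using (m<n⇒m%n≡m; m/n*n≡m; m*[n/m]≡n; [m+kn]%n≡m%n)
open import Data.Nat.Properties using (+-0-commutativeMonoid; m<m+n; +-identityʳ; <-trans; <⇒≱)
open import Data.Product.Base using (Σ; ∃; ∃-syntax; _×_; _,_)
open import Data.Sum.Base using (_⊎_; inj₁; inj₂)
open import Function.Bundles using (_⇔_; _↔_; Inverse)
open import Level using (0ℓ)
open import Relation.Binary.Construct.Closure.ReflexiveTransitive using (Star)
open import Relation.Binary.Core using (Rel)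
open import Relation.Binary.Definitions using (Decidable; Symmetric; Irreflexive)
open import Relation.Binary.PropositionalEquality hiding ([_])
open import Relation.Nullary using (¬_; does; contradiction)
open import Relation.Nullary.Decidable using (_⊎-dec_; _×-dec_)

open import Algebra.Properties.CommutativeMonoid.Sum +-0-commutativeMonoid using (sum-syntax)

record Graph (n : ℕ) : Set₁ where
  field
    Adj       : Rel (Fin n) 0ℓ
    Adj?      : Decidable Adj
    symmetric : Symmetric Adj
    loopless  : Irreflexive _≡_ Adj

  N[_] : Fin n → Fin n → Set
  N[ u ] x = x ≡ u ⊎ Adj u x

  N[_]? : Decidable N[_]
  N[ u ]? x = (x ≟ᶠ u) ⊎-dec Adj? u x

  Connected : Set
  Connected = ∀ u v → Star Adj u v

open Graph public using (Connected)

infix 4 _≅_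

record _≅_ {m n} (Γ : Graph m) (Δ : Graph n) : Set where
  field
    vertices : Fin m ↔ Fin n
    edges    : ∀ u v → Graph.Adj Γ u v ⇔
                       Graph.Adj Δ (Inverse.to vertices u) (Inverse.to vertices v)

-- A bijection onto {1, …, n} is given by a permutation of
-- Fin n = {0, …, n - 1}, shifted by one.

label : ∀ {n} → Permutation′ n → Fin n → ℕ
label ℓ x = suc (toℕ (ℓ ⟨$⟩ʳ x))

ClosedDistanceMagic : ∀ {n} → Graph n → Set
ClosedDistanceMagic {n} Γ =
  Σ (Permutation′ n) λ ℓ → ∃[ r ] 0 < r ×
    (∀ u → (∑[ x < n ] (if does (N[ u ]? x) then label ℓ x else 0)) ≡ r)
  where open Graph Γ

module _ {n} {_∙_ : Op₂ (Fin n)} {ε : Fin n} {_⁻¹ : Op₁ (Fin n)} where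

  record ConnectionSet (G : IsGroup _≡_ _∙_ ε _⁻¹) : Set where
    field
      set           : Subset n
      inverseClosed : ∀ {s} → s ∈ set → (s ⁻¹) ∈ set
      ε∉set         : ε ∉ set

  Cay : (G : IsGroup _≡_ _∙_ ε _⁻¹) → ConnectionSet G → Graph n
  Cay G S = record
    { Adj       = λ g h → ∃[ s ] s ∈ set × h ≡ g ∙ s
    ; Adj?      = λ g h → any? λ s → (s ∈? set) ×-dec (h ≟ᶠ (g ∙ s))
    ; symmetric = λ {g} {h} (s , s∈S , h≡gs) → s ⁻¹ , inverseClosed s∈S , (begin
        g                ≡⟨ identityʳ g ⟨
        g ∙ ε            ≡⟨ cong (g ∙_) (inverseʳ s) ⟨
        g ∙ (s ∙ (s ⁻¹)) ≡⟨ assoc g s (s ⁻¹) ⟨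
        (g ∙ s) ∙ (s ⁻¹) ≡⟨ cong (_∙ (s ⁻¹)) h≡gs ⟨
        h ∙ (s ⁻¹)       ∎)
    ; loopless  = λ { {g} refl (s , s∈S , g≡gs) → ε∉set (subst (_∈ set) (begin
        s                ≡⟨ identityˡ s ⟨
        ε ∙ s            ≡⟨ cong (_∙ s) (inverseˡ g) ⟨
        ((g ⁻¹) ∙ g) ∙ s ≡⟨ assoc (g ⁻¹) g s ⟩
        (g ⁻¹) ∙ (g ∙ s) ≡⟨ cong ((g ⁻¹) ∙_) g≡gs ⟨
        (g ⁻¹) ∙ g       ≡⟨ inverseˡ g ⟩
        ε                ∎) s∈S) }
    }
    where
    open IsGroup G
    open ConnectionSet S
    open ≡-Reasoning

module _ {n : ℕ} .{{_ : NonZero n}} where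

  [_] : ℤ → Fin n
  [ a ] = fromℕ< (n%ℕd<d a n)

  infixl 6 _⊕_

  _⊕_ : Op₂ (Fin n)
  x ⊕ y = [ + toℕ x ℤ.+ + toℕ y ]

  ⊖_ : Op₁ (Fin n)
  ⊖ x = [ ℤ.- + toℕ x ]

  private
    %-unique : ∀ {r s} q → r < n → s < n → + r ≡ + s ℤ.+ q ℤ.* + n → r ≡ s
    %-unique {r} {s} (+ q) r<n s<n eq = begin
      r                 ≡⟨ m<n⇒m%n≡m r<n ⟨
      r % n             ≡⟨ cong (_% n) (ℤ.+-injective (trans eq (cong (λ z → + s ℤ.+ z) (sym (ℤ.pos-* q n))))) ⟩
      (s + q * n) % n   ≡⟨ [m+kn]%n≡m%n s q n ⟩
      s % n             ≡⟨ m<n⇒m%n≡m s<n ⟩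
      s                 ∎
      where open ≡-Reasoning
    %-unique {r} {s} q@(ℤ.-[1+ _ ]) r<n s<n eq = sym (%-unique (ℤ.- q) s<n r<n (begin
      + s                                           ≡⟨ lemma (+ s) q (+ n) ⟩
      (+ s ℤ.+ q ℤ.* + n) ℤ.+ ℤ.- q ℤ.* + n         ≡⟨ cong (ℤ._+ ℤ.- q ℤ.* + n) eq ⟨
      + r ℤ.+ ℤ.- q ℤ.* + n                         ∎))
      where
      open ≡-Reasoning
      lemma : ∀ s q n → s ≡ (s ℤ.+ q ℤ.* n) ℤ.+ ℤ.- q ℤ.* n
      lemma = solve-∀

  toℕ-[] : ∀ a → + toℕ [ a ] ≡ a ℤ.- (a /ℕ n) ℤ.* + n
  toℕ-[] a = begin
    + toℕ [ a ]                                      ≡⟨ cong +_ (toℕ-fromℕ< (n%ℕd<d a n)) ⟩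
    + (a %ℕ n)                                       ≡⟨ lemma (+ (a %ℕ n)) ((a /ℕ n) ℤ.* + n) ⟩
    (+ (a %ℕ n) ℤ.+ (a /ℕ n) ℤ.* + n) ℤ.- (a /ℕ n) ℤ.* + n ≡⟨ cong (ℤ._- (a /ℕ n) ℤ.* + n) (a≡a%ℕn+[a/ℕn]*n a n) ⟨
    a ℤ.- (a /ℕ n) ℤ.* + n                           ∎
    where
    open ≡-Reasoning
    lemma : ∀ r m → r ≡ (r ℤ.+ m) ℤ.- m
    lemma = solve-∀

  []-cong : ∀ a b q → a ≡ b ℤ.+ q ℤ.* + n → [ a ] ≡ [ b ]
  []-cong a b q eq = toℕ-injective (%-unique (q ℤ.+ b /ℕ n ℤ.- a /ℕ n) (toℕ<n [ a ]) (toℕ<n [ b ]) (begin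
    + toℕ [ a ]                                     ≡⟨ toℕ-[] a ⟩
    a ℤ.- (a /ℕ n) ℤ.* + n                          ≡⟨ cong (ℤ._- (a /ℕ n) ℤ.* + n) eq ⟩
    (b ℤ.+ q ℤ.* + n) ℤ.- (a /ℕ n) ℤ.* + n          ≡⟨ lemma b q (+ n) (a /ℕ n) (b /ℕ n) ⟩
    (b ℤ.- (b /ℕ n) ℤ.* + n) ℤ.+ (q ℤ.+ b /ℕ n ℤ.- a /ℕ n) ℤ.* + n
                                                    ≡⟨ cong (ℤ._+ (q ℤ.+ b /ℕ n ℤ.- a /ℕ n) ℤ.* + n) (toℕ-[] b) ⟨
    + toℕ [ b ] ℤ.+ (q ℤ.+ b /ℕ n ℤ.- a /ℕ n) ℤ.* + n ∎))
    where
    open ≡-Reasoning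
    lemma : ∀ b q n u v → (b ℤ.+ q ℤ.* n) ℤ.- u ℤ.* n ≡ (b ℤ.- v ℤ.* n) ℤ.+ (q ℤ.+ v ℤ.- u) ℤ.* n
    lemma = solve-∀

  [toℕ] : ∀ x → [ + toℕ x ] ≡ x
  [toℕ] x = toℕ-injective (trans (toℕ-fromℕ< (n%ℕd<d (+ toℕ x) n)) (m<n⇒m%n≡m (toℕ<n x)))

  []-⊕ : ∀ a b → [ a ] ⊕ [ b ] ≡ [ a ℤ.+ b ]
  []-⊕ a b = []-cong _ (a ℤ.+ b) (ℤ.- (a /ℕ n ℤ.+ b /ℕ n))
    (trans (cong₂ ℤ._+_ (toℕ-[] a) (toℕ-[] b)) (lemma a b (a /ℕ n) (b /ℕ n) (+ n)))
    where
    lemma : ∀ a b u v n → (a ℤ.- u ℤ.* n) ℤ.+ (b ℤ.- v ℤ.* n) ≡ (a ℤ.+ b) ℤ.+ ℤ.- (u ℤ.+ v) ℤ.* n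
    lemma = solve-∀

  []-⊖ : ∀ a → ⊖ [ a ] ≡ [ ℤ.- a ]
  []-⊖ a = []-cong _ (ℤ.- a) (a /ℕ n) (trans (cong ℤ.-_ (toℕ-[] a)) (lemma a (a /ℕ n) (+ n)))
    where
    lemma : ∀ a u n → ℤ.- (a ℤ.- u ℤ.* n) ≡ ℤ.- a ℤ.+ u ℤ.* n
    lemma = solve-∀

  ⊕-assoc : ∀ x y z → (x ⊕ y) ⊕ z ≡ x ⊕ (y ⊕ z)
  ⊕-assoc x y z = begin
    (x ⊕ y) ⊕ z              ≡⟨ cong (x ⊕ y ⊕_) ([toℕ] z) ⟨
    [ a ℤ.+ b ] ⊕ [ c ]      ≡⟨ []-⊕ (a ℤ.+ b) c ⟩
    [ (a ℤ.+ b) ℤ.+ c ]      ≡⟨ cong [_] (ℤ.+-assoc a b c) ⟩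
    [ a ℤ.+ (b ℤ.+ c) ]      ≡⟨ []-⊕ a (b ℤ.+ c) ⟨
    [ a ] ⊕ [ b ℤ.+ c ]      ≡⟨ cong (_⊕ (y ⊕ z)) ([toℕ] x) ⟩
    x ⊕ (y ⊕ z)              ∎
    where
    open ≡-Reasoning
    a = + toℕ x
    b = + toℕ y
    c = + toℕ z

  ⊕-comm : ∀ x y → x ⊕ y ≡ y ⊕ x
  ⊕-comm x y = cong [_] (ℤ.+-comm (+ toℕ x) (+ toℕ y))

  ⊕-identityˡ : ∀ x → [ 0ℤ ] ⊕ x ≡ x
  ⊕-identityˡ x = begin
    [ 0ℤ ] ⊕ x               ≡⟨ cong ([ 0ℤ ] ⊕_) ([toℕ] x) ⟨
    [ 0ℤ ] ⊕ [ + toℕ x ]     ≡⟨ []-⊕ 0ℤ (+ toℕ x) ⟩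
    [ + toℕ x ]              ≡⟨ [toℕ] x ⟩
    x                        ∎
    where open ≡-Reasoning

  ⊕-inverseʳ : ∀ x → x ⊕ (⊖ x) ≡ [ 0ℤ ]
  ⊕-inverseʳ x = begin
    x ⊕ (⊖ x)                          ≡⟨ cong (_⊕ (⊖ x)) ([toℕ] x) ⟨
    [ + toℕ x ] ⊕ [ ℤ.- (+ toℕ x) ]    ≡⟨ []-⊕ (+ toℕ x) (ℤ.- (+ toℕ x)) ⟩
    [ + toℕ x ℤ.- + toℕ x ]            ≡⟨ cong [_] (ℤ.+-inverseʳ (+ toℕ x)) ⟩
    [ 0ℤ ]                             ∎
    where open ≡-Reasoning

ℤ[_] : ∀ n .{{_ : NonZero n}} → IsGroup {A = Fin n} _≡_ _⊕_ [ 0ℤ ] ⊖_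
ℤ[ n ] = record
  { isMonoid = record
    { isSemigroup = record
      { isMagma = record { isEquivalence = isEquivalence ; ∙-cong = cong₂ _⊕_ }
      ; assoc   = ⊕-assoc
      }
    ; identity = ⊕-identityˡ , λ x → trans (⊕-comm x [ 0ℤ ]) (⊕-identityˡ x)
    }
  ; inverse = (λ x → trans (⊕-comm (⊖ x) x) (⊕-inverseʳ x)) , ⊕-inverseʳ
  ; ⁻¹-cong = cong ⊖_
  }

record IsCirculant {m} (Γ : Graph m) (valency : ℕ) : Set where
  field
    n             : ℕ
    {{n≢0}}       : NonZero n
    connectionSet : ConnectionSet ℤ[ n ]
    isomorphism   : Γ ≅ Cay ℤ[ n ] connectionSet
    ∣S∣≡valency   : ∣ ConnectionSet.set connectionSet ∣ ≡ valency

module _ (n c : ℕ) .{{_ : NonZero n}} where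

  ±1,±c,n/2-set : Subset n
  ±1,±c,n/2-set = ⁅ [ 1ℤ ] ⁆ ∪ ⁅ [ -1ℤ ] ⁆ ∪ ⁅ [ + c ] ⁆ ∪ ⁅ [ ℤ.- + c ] ⁆ ∪ ⁅ [ + (n / 2) ] ⁆

  private
    Listed : Fin n → Set
    Listed s = s ≡ [ 1ℤ ] ⊎ s ≡ [ -1ℤ ] ⊎ s ≡ [ + c ] ⊎ s ≡ [ ℤ.- + c ] ⊎ s ≡ [ + (n / 2) ]

    listed : ∀ {s} → s ∈ ±1,±c,n/2-set → Listed s
    listed s∈ with x∈p∪q⁻ _ _ s∈
    ... | inj₁ e = inj₁ (x∈⁅y⁆⇒x≡y _ e)
    ... | inj₂ s∈ with x∈p∪q⁻ _ _ s∈
    ... | inj₁ e = inj₂ (inj₁ (x∈⁅y⁆⇒x≡y _ e))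
    ... | inj₂ s∈ with x∈p∪q⁻ _ _ s∈
    ... | inj₁ e = inj₂ (inj₂ (inj₁ (x∈⁅y⁆⇒x≡y _ e)))
    ... | inj₂ s∈ with x∈p∪q⁻ _ _ s∈
    ... | inj₁ e = inj₂ (inj₂ (inj₂ (inj₁ (x∈⁅y⁆⇒x≡y _ e))))
    ... | inj₂ e = inj₂ (inj₂ (inj₂ (inj₂ (x∈⁅y⁆⇒x≡y _ e))))

    unlisted : ∀ {s} → Listed s → s ∈ ±1,±c,n/2-set
    unlisted (inj₁ refl)                      = x∈p∪q⁺ (inj₁ (x∈⁅x⁆ _))
    unlisted (inj₂ (inj₁ refl))               = x∈p∪q⁺ (inj₂ (x∈p∪q⁺ (inj₁ (x∈⁅x⁆ _))))
    unlisted (inj₂ (inj₂ (inj₁ refl)))        = x∈p∪q⁺ (inj₂ (x∈p∪q⁺ (inj₂ (x∈p∪q⁺ (inj₁ (x∈⁅x⁆ _))))))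
    unlisted (inj₂ (inj₂ (inj₂ (inj₁ refl)))) = x∈p∪q⁺ (inj₂ (x∈p∪q⁺ (inj₂ (x∈p∪q⁺ (inj₂ (x∈p∪q⁺ (inj₁ (x∈⁅x⁆ _))))))))
    unlisted (inj₂ (inj₂ (inj₂ (inj₂ refl)))) = x∈p∪q⁺ (inj₂ (x∈p∪q⁺ (inj₂ (x∈p∪q⁺ (inj₂ (x∈p∪q⁺ (inj₂ (x∈⁅x⁆ _))))))))

    [+]≢0 : ∀ {a} → 0 < a → a < n → [_] {n} 0ℤ ≢ [ + a ]
    [+]≢0 {a} 0<a a<n eq = contradiction (begin
      0                   ≡⟨ m<n⇒m%n≡m (<-trans 0<a a<n) ⟨
      0ℤ %ℕ n             ≡⟨ toℕ-fromℕ< (n%ℕd<d 0ℤ n) ⟨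
      toℕ ([_] {n} 0ℤ)    ≡⟨ cong toℕ eq ⟩
      toℕ ([_] {n} (+ a)) ≡⟨ toℕ-fromℕ< (n%ℕd<d (+ a) n) ⟩
      a % n               ≡⟨ m<n⇒m%n≡m a<n ⟩
      a                   ∎) λ { refl → <⇒≱ 0<a z≤n }
      where open ≡-Reasoning

    [-]≢0 : ∀ {a} → 0 < a → a < n → [_] {n} 0ℤ ≢ [ ℤ.- + a ]
    [-]≢0 {a} 0<a a<n eq = [+]≢0 0<a a<n (begin
      [ 0ℤ ]            ≡⟨ []-⊖ 0ℤ ⟨
      ⊖ [ 0ℤ ]          ≡⟨ cong ⊖_ eq ⟩
      ⊖ [ ℤ.- + a ]     ≡⟨ []-⊖ (ℤ.- + a) ⟩
      [ ℤ.- (ℤ.- + a) ] ≡⟨ cong [_] (ℤ.neg-involutive (+ a)) ⟩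
      [ + a ]           ∎)
      where open ≡-Reasoning

    ⊖n/2 : 2 ∣ n → ⊖ [ + (n / 2) ] ≡ [_] {n} (+ (n / 2))
    ⊖n/2 2∣n = trans ([]-⊖ (+ (n / 2))) ([]-cong _ h -1ℤ (begin
      ℤ.- h                        ≡⟨ lemma h ⟩
      h ℤ.+ -1ℤ ℤ.* (h ℤ.* + 2)    ≡⟨ cong (λ z → h ℤ.+ -1ℤ ℤ.* z) (ℤ.pos-* (n / 2) 2) ⟨
      h ℤ.+ -1ℤ ℤ.* + (n / 2 * 2)  ≡⟨ cong (λ z → h ℤ.+ -1ℤ ℤ.* + z) (m/n*n≡m 2∣n) ⟩
      h ℤ.+ -1ℤ ℤ.* + n            ∎))
      where
      open ≡-Reasoning
      h = + (n / 2)
      lemma : ∀ h → ℤ.- h ≡ h ℤ.+ -1ℤ ℤ.* (h ℤ.* + 2)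
      lemma = solve-∀

  ±1,±c,n/2 : 2 ∣ n → 1 < c → c < n / 2 → ConnectionSet ℤ[ n ]
  ±1,±c,n/2 2∣n 1<c c<n/2 = record
    { set           = ±1,±c,n/2-set
    ; inverseClosed = λ s∈ → unlisted (closed (listed s∈))
    ; ε∉set         = λ 0∈ → nonzero (listed 0∈)
    }
    where
    0<c : 0 < c
    0<c = <-trans z<s 1<c

    n/2<n : n / 2 < n
    n/2<n = subst (n / 2 <_) 2*[n/2]≡n (m<m+n (n / 2) (<-trans 0<c c<n/2))
      where
      open ≡-Reasoning
      2*[n/2]≡n : n / 2 + n / 2 ≡ n
      2*[n/2]≡n = begin
        n / 2 + n / 2  ≡⟨ cong (_+_ (n / 2)) (+-identityʳ (n / 2)) ⟨
        2 * (n / 2)    ≡⟨ m*[n/m]≡n 2∣n ⟩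
        n              ∎

    c<n : c < n
    c<n = <-trans c<n/2 n/2<n

    1<n : 1 < n
    1<n = <-trans 1<c c<n

    closed : ∀ {s} → Listed s → Listed (⊖ s)
    closed (inj₁ refl)                      = inj₂ (inj₁ ([]-⊖ 1ℤ))
    closed (inj₂ (inj₁ refl))               = inj₁ ([]-⊖ -1ℤ)
    closed (inj₂ (inj₂ (inj₁ refl)))        = inj₂ (inj₂ (inj₂ (inj₁ ([]-⊖ (+ c)))))
    closed (inj₂ (inj₂ (inj₂ (inj₁ refl)))) = inj₂ (inj₂ (inj₁ (trans ([]-⊖ (ℤ.- + c)) (cong [_] (ℤ.neg-involutive (+ c))))))
    closed (inj₂ (inj₂ (inj₂ (inj₂ refl)))) = inj₂ (inj₂ (inj₂ (inj₂ (⊖n/2 2∣n))))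

    nonzero : ¬ Listed [ 0ℤ ]
    nonzero (inj₁ e)                      = [+]≢0 z<s 1<n e
    nonzero (inj₂ (inj₁ e))               = [-]≢0 z<s 1<n e
    nonzero (inj₂ (inj₂ (inj₁ e)))        = [+]≢0 0<c c<n e
    nonzero (inj₂ (inj₂ (inj₂ (inj₁ e)))) = [-]≢0 0<c c<n e
    nonzero (inj₂ (inj₂ (inj₂ (inj₂ e)))) = [+]≢0 (<-trans 0<c c<n/2) n/2<n e

OddMultiple : ℕ → ℕ → Set
OddMultiple m n = ∃[ j ] m ≡ (1 + 2 * j) * n

CaseI CaseII CaseIII CaseIV : (n c : ℕ) → Set

CaseI n c = c ≡ n / 2 ∸ 1

CaseII n c = n % 4 ≡ 2 × 2 ∣ c × OddMultiple (2 * (c ^ 2 ∸ 1)) n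

-- In the last two cases the equations are over ℤ: for k = 0 the right-hand
-- sides may be negative.

CaseIII n c = ∃[ t ] ∃[ k ] 2 ≤ t ×
  (let a = + 6 ℤ.* + k ℤ.+ -1ℤ ℤ.^ t in
   + n ≡ + 3 ℤ.* (+ 2) ℤ.^ t ℤ.* a ×
   + c ≡ (+ 2) ℤ.^ (t ∸ 1) ℤ.* a ℤ.- 1ℤ) ×
  2 ≤ c

CaseIV n c = ∃[ t ] ∃[ k ] 2 ≤ t ×
  (let a = + 6 ℤ.* + k ℤ.- -1ℤ ℤ.^ t in
   + n ≡ + 3 ℤ.* (+ 2) ℤ.^ t ℤ.* a ×
   + c ≡ (+ 2) ℤ.^ (t ∸ 1) ℤ.* a ℤ.+ 1ℤ) ×
  2 ≤ c

{-# OPTIONS --safe #-}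
module Submission where

-- Let n = 2h and S = {±a, ±b, h}, read a labelling as an n-periodic sequence f on ℤ, write
-- T_k for translation by k, and put p = a + b + h and q = a − b + h. On d = f − T_h f the
-- magic condition becomes (T_p − 1)(T_q − 1) d = 0, and on g = f + T_h f it says that
-- 2 + T_(−a)(1 + T_p)(1 + T_q) maps g to a constant.
--
-- If p and q both have odd order modulo n, then pq is a period of d, and 1 + T_p and 1 + T_q
-- are invertible over ℤ on F = (T_pq − 1) g. Hence F is infinitely divisible by 2, so F = 0;
-- thus pq is a period of f, which is injective modulo n, and n ∣ pq. This is case (ii).
-- Otherwise one of p and q, say p, has odd order and is a period of d. On F = (T_p − 1) g the
-- inverse of 1 + T_p turns the condition into: an integral invertible operator sends F to the
-- average of two of its translates. The sum of squares cannot decrease for ever, so those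
-- translates agree, and then 3p is a period of F, hence of f, and n ∣ 3p. This gives case (i)
-- if n ∣ p, and (iii) or (iv) otherwise.
--
-- Conversely, in each case a labelling can be written down from the residues of x.

open import Defs

-- A character argument would speak of complex eigenvalues; here everything stays with integer
-- sequences, and eigenvalues are replaced by divisibility and by a decreasing natural number. Odd
-- order matters because `T_h` negates `d`: if a period of `d` had a multiple congruent to `h`, then
-- `d = −d`, and `f` would not be injective. So every period of `d` has odd order. If instead a
-- multiple of `q` is congruent to `h`, then `(T_p − 1) d` has period `q` and is also negated by
-- `T_h`; it vanishes, and this is why the other element `p` is a period of `d`. The number 3
-- appears once the two translates agree: on `F` this gives `T_a² = T_p` and `T_a = −(1 + T_p)`,
-- hence `1 + T_p + T_p² = 0`. Connectedness enters only as a relation `α a + β b + γ h = 1`. It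
-- makes 3 a period of `F`, which keeps `p`, `a` and `b` prime to 3 when `n ∤ p`, and it supplies
-- the inverse modulo `n` that scales the connection set to `±1, ±c, n/2`.

module Classification where

  open import Data.Bool.Base using (if_then_else_)
  open import Data.Fin.Base using (Fin; toℕ; fromℕ<; punchOut) renaming (zero to fzero; suc to fsuc)
  open import Data.Fin.Permutation using (Permutation′; permutation; ↔⇒≡; _⟨$⟩ʳ_)
  open import Data.Fin.Properties using (toℕ-injective; toℕ-fromℕ<; toℕ<n; any?; injective⇒≤; punchOut-injective) renaming (_≟_ to _≟ᶠ_; suc-injective to fsuc-injective)
  open import Data.Fin.Subset using (Subset; inside; outside) renaming (_∈_ to _∈ˢ_; ∣_∣ to card)
  open import Data.Fin.Subset.Properties using (x∈⁅x⁆; x∈⁅y⁆⇒x≡y; x∈p∪q⁺; x∈p∪q⁻)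
  open import Data.Integer.Base hiding (suc; pred; sign) renaming (∣_∣ to abs)
  open import Data.Integer.DivMod using (n%ℕd<d; a≡a%ℕn+[a/ℕn]*n)
  open import Data.Integer.Divisibility.Signed
  import Data.Integer.Properties as ℤ
  open import Data.Integer.Tactic.RingSolver using (solve-∀)
  open import Data.List.Base using (List; []; _∷_; _++_; map; length)
  import Data.List.Membership.DecPropositional as DecMembership
  open import Data.List.Membership.Propositional using (_∈_; find)
  open import Data.List.Membership.Propositional.Properties using (∈-∃++; ∈-map⁺; ∈-map⁻; ∈-++⁺ʳ)
  import Data.List.Properties as List
  open import Data.List.Relation.Binary.Permutation.Propositional using (_↭_; prep; ↭-refl; ↭-sym; ↭-trans; ↭⇒↭ₛ)
  open import Data.List.Relation.Binary.Permutation.Propositional.Properties using (∈-resp-↭; ↭-length; shift; ↭-reverse; ++⁺ˡ)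
  import Data.List.Relation.Binary.Permutation.Setoid.Properties as Permutationₛ
  open import Data.List.Relation.Unary.All as All using (All; []; _∷_)
  open import Data.List.Relation.Unary.All.Properties using (¬Any⇒All¬; All¬⇒¬Any)
  open import Data.List.Relation.Unary.AllPairs as AllPairs using (AllPairs; []; _∷_)
  open import Data.List.Relation.Unary.Any as Any using (Any; here; there)
  import Data.List.Relation.Unary.Any.Properties as Any
  open import Data.List.Relation.Unary.Linked using ([-]; _∷_)
  open import Data.List.Relation.Unary.Linked.Properties using (Linked⇒AllPairs)
  open import Data.List.Relation.Unary.Unique.Propositional using (Unique)
  import Data.List.Relation.Unary.Unique.Propositional.Properties as Unique
  open import Data.Nat.Base as ℕ using (ℕ; zero; suc)
  import Data.Nat.Coprimality as Coprime
  import Data.Nat.Divisibility as ℕ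
  import Data.Nat.DivMod as ℕ
  import Data.Nat.GCD as ℕ
  open import Data.Nat.Induction using (<-rec; <-wellFounded)
  open import Data.Nat.ListAction using (sum)
  import Data.Nat.Properties as ℕ
  import Data.Nat.Tactic.RingSolver as ℕSolver
  open import Data.Product.Base using (∃-syntax; Σ-syntax; _×_; _,_; proj₁; proj₂)
  open import Data.Sum.Base using (_⊎_; inj₁; inj₂)
  open import Data.Vec.Base using ([]; _∷_; here; there)
  open import Function.Base using (_∘_; id)
  open import Function.Bundles using (_⇔_; _↔_; Inverse; Equivalence; mk⇔; mk↔ₛ′)
  open import Induction.WellFounded using (Acc; acc)
  open import Relation.Binary.Construct.Closure.ReflexiveTransitive as Star using (Star; _◅_)
  open import Relation.Binary.PropositionalEquality hiding ([_])
  open import Relation.Nullary using (¬_; yes; no; does; contradiction)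
  open import Relation.Unary using (Pred; Decidable)
  open import Algebra.Properties.AbelianGroup ℤ.+-0-abelianGroup using (∙-cancelˡ; ∙-cancelʳ)
  open import Algebra.Properties.CommutativeMonoid.Sum ℕ.+-0-commutativeMonoid
    using (sum-syntax; ∑-distrib-+; sum-cong-≗; sum-replicate-zero)


  -- Turns a linear consequence of the hypothesis `A ≡ B` into an identity without side conditions,
  -- which the ring solver can then check.
  by-adding : ∀ {u v A B : ℤ} → A ≡ B → u + B ≡ v + A → u ≡ v
  by-adding {u} {v} {A} refl eq = ∙-cancelʳ A u v eq

  double-injective : ∀ {u v : ℤ} → u + u ≡ v + v → u ≡ v
  double-injective {u} {v} eq = ℤ.*-cancelˡ-≡ (+ 2) u v
    (trans (lemma u) (trans eq (sym (lemma v))))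
    where
    lemma : ∀ u → + 2 * u ≡ u + u
    lemma = solve-∀

  -- Periodic sequences

  Seq : Set
  Seq = ℤ → ℤ

  record Period (F : Seq) (k : ℤ) : Set where
    constructor periodic
    field at : ∀ x → F (x + k) ≡ F x

  open Period

  Δ : ℤ → Seq → Seq
  Δ y F x = F (x + y) - F x

  module _ {F : Seq} where

    period-+ : ∀ {k l} → Period F k → Period F l → Period F (k + l)
    period-+ {k} {l} pk pl = periodic λ x →
      trans (cong F (sym (ℤ.+-assoc x k l))) (trans (at pl (x + k)) (at pk x))

    period-neg : ∀ {k} → Period F k → Period F (- k)
    period-neg {k} pk = periodic λ x → trans (sym (at pk (x - k))) (cong F (lemma x k))
      where
      lemma : ∀ x k → x - k + k ≡ x
      lemma = solve-∀

    period-*ℕ : ∀ {k} → Period F k → ∀ m → Period F (+ m * k)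
    period-*ℕ {k} pk zero = periodic λ x → cong F (ℤ.+-identityʳ x)
    period-*ℕ {k} pk (suc m) = subst (Period F) (lemma (+ m) k) (period-+ pk (period-*ℕ pk m))
      where
      lemma : ∀ m k → k + m * k ≡ (1ℤ + m) * k
      lemma = solve-∀

    period-* : ∀ {k} → Period F k → ∀ j → Period F (j * k)
    period-* pk (+ m) = period-*ℕ pk m
    period-* {k} pk -[1+ m ] = subst (Period F) (ℤ.neg-distribˡ-* (+ suc m) k) (period-neg (period-*ℕ pk (suc m)))

    period-∣ : ∀ {k l} → Period F k → k ∣ l → Period F l
    period-∣ pk (divides q refl) = period-* pk q

    period-≈ : ∀ {k} → Period F k → ∀ x y → k ∣ x - y → F x ≡ F y
    period-≈ {k} pk x y k∣ = trans (cong F (lemma x y)) (at (period-∣ pk k∣) y)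
      where
      lemma : ∀ x y → x ≡ y + (x - y)
      lemma = solve-∀

  period-shift : ∀ {F k} → Period F k → ∀ l → Period (λ x → F (x + l)) k
  period-shift {F} {k} pk l = periodic λ x → trans (cong F (lemma x k l)) (at pk (x + l))
    where
    lemma : ∀ x k l → x + k + l ≡ x + l + k
    lemma = solve-∀

  Δ-period : ∀ {F k} y → Period F k → Period (Δ y F) k
  Δ-period y pk = periodic λ x → cong₂ _-_ (at (period-shift pk y) x) (at pk x)

  -- Both sides say `(T_k − 1)(T_l − 1) F = 0`, and the two factors commute.
  Δ-swap : ∀ {F k l} → Period (Δ k F) l → Period (Δ l F) k
  Δ-swap {F} {k} {l} p = periodic λ x → by-adding (at p x)
    (trans (cong (λ z → F z - F (x + k) + (F (x + k) - F x)) (lemma₁ x k l))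
           (lemma₂ (F (x + l + k)) (F (x + k)) (F x) (F (x + l))))
    where
    lemma₁ : ∀ x k l → x + k + l ≡ x + l + k
    lemma₁ = solve-∀
    lemma₂ : ∀ s t v w → s - t + (t - v) ≡ w - v + (s - w)
    lemma₂ = solve-∀

  telescope : ∀ F {y} → Period (Δ y F) y → ∀ k x → F (x + + k * y) ≡ F x + + k * Δ y F x
  telescope F {y} p zero x = trans (cong F (ℤ.+-identityʳ x)) (sym (ℤ.+-identityʳ (F x)))
  telescope F {y} p (suc k) x = begin
    F (x + (1ℤ + + k) * y) ≡⟨ cong F (lemma₁ x (+ k) y) ⟩
    F (x + y + + k * y) ≡⟨ telescope F p k (x + y) ⟩
    F (x + y) + + k * Δ y F (x + y) ≡⟨ cong (λ z → F (x + y) + + k * z) (at p x) ⟩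
    F (x + y) + + k * Δ y F x ≡⟨ lemma₂ (F (x + y)) (+ k) (F x) ⟩
    F x + (1ℤ + + k) * Δ y F x                 ∎
    where
    open ≡-Reasoning
    lemma₁ : ∀ x k y → x + (1ℤ + k) * y ≡ x + y + k * y
    lemma₁ = solve-∀
    lemma₂ : ∀ u k v → u + k * (u - v) ≡ v + (1ℤ + k) * (u - v)
    lemma₂ = solve-∀

  -- Along steps of `y` the sequence is an arithmetic progression that returns to its start after
  -- `w` steps, so `w` times its difference is zero. In operator form: `(T − 1)² F = 0` and
  -- `T^w F = F` force `T F = F`.
  period-from-Δ : ∀ {F y} w .{{_ : ℕ.NonZero w}} → Period F (+ w * y) → Period (Δ y F) y → Period F y
  period-from-Δ {F} {y} w@(suc _) pw p = periodic λ x → ℤ.i-j≡0⇒i≡j _ _ (ℤ.*-cancelˡ-≡ (+ w) _ 0ℤ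
    (trans (∙-cancelˡ (F x) _ 0ℤ (trans (sym (telescope F p w x)) (trans (at pw x) (sym (ℤ.+-identityʳ (F x))))))
           (sym (ℤ.*-zeroʳ (+ w)))))

  -- Since `p` and `q` divide `y`, the hypothesis `(T_p − 1)(T_q − 1) F = 0` yields
  -- `(T_y − 1)² F = 0`, and the period `n` removes the square.
  common-period : ∀ {F p q y} n .{{_ : ℕ.NonZero n}} → Period F (+ n) → Period (Δ q F) p →
                  p ∣ y → q ∣ y → Period F y
  common-period {F} {y = y} n pn pq p∣y q∣y =
    period-from-Δ n (period-∣ pn (∣m⇒∣m*n y ∣-refl))
      (period-∣ (Δ-swap {F} (period-∣ pq p∣y)) q∣y)

  -- Integer combinations of translations

  -- Sequences are compared pointwise, hence the field `V-cong`. Commuting with all translations is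
  -- what lets these operators be handled like polynomials in a translation.
  record Linear (V : Seq → Seq) : Set where
    field
      V-cong  : ∀ {F G} → (∀ x → F x ≡ G x) → ∀ x → V F x ≡ V G x
      V-add   : ∀ F G x → V (λ x → F x + G x) x ≡ V F x + V G x
      V-shift : ∀ F k x → V (λ x → F (x + k)) x ≡ V F (x + k)

    V-zero : ∀ x → V (λ _ → 0ℤ) x ≡ 0ℤ
    V-zero x = ∙-cancelˡ (V (λ _ → 0ℤ) x) _ 0ℤ (trans (sym (V-add (λ _ → 0ℤ) (λ _ → 0ℤ) x)) (sym (ℤ.+-identityʳ _)))

    V-period : ∀ {F k} → Period F k → Period (V F) k
    V-period {F} {k} pk = periodic λ x → trans (sym (V-shift F k x)) (V-cong (at pk) x)

  open Linear

  linear-∘ : ∀ {V W} → Linear V → Linear W → Linear (λ F → V (W F))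
  linear-∘ {V} {W} v w = record
    { V-cong  = λ eq → V-cong v (V-cong w eq)
    ; V-add   = λ F G x → trans (V-cong v (V-add w F G) x) (V-add v (W F) (W G) x)
    ; V-shift = λ F k x → trans (V-cong v (V-shift w F k) x) (V-shift v (W F) k x)
    }

  oddSum : ℕ → ℤ → Seq → Seq
  oddSum zero    y F x = 0ℤ
  oddSum (suc k) y F x = F (x + y) + oddSum k y F (x + (y + y))

  oddSum-linear : ∀ k y → Linear (oddSum k y)
  oddSum-linear zero y = record { V-cong = λ _ _ → refl ; V-add = λ _ _ _ → refl ; V-shift = λ _ _ _ → refl }
  oddSum-linear (suc k) y = record
    { V-cong  = λ eq x → cong₂ _+_ (eq (x + y)) (V-cong ih eq (x + (y + y)))
    ; V-add   = λ F G x → trans (cong (_+_ (F (x + y) + G (x + y))) (V-add ih F G (x + (y + y))))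
                                (interchange (F (x + y)) (G (x + y)) _ _)
    ; V-shift = λ F l x → cong₂ _+_ (cong F (swap x y l))
        (trans (V-shift ih F l (x + (y + y))) (cong (oddSum k y F) (swap x (y + y) l)))
    }
    where
    ih = oddSum-linear k y
    interchange : ∀ a b c d → a + b + (c + d) ≡ a + c + (b + d)
    interchange = solve-∀
    swap : ∀ a b c → a + b + c ≡ a + c + b
    swap = solve-∀

  -- If T is translation by y and T^(1+2k) fixes G, then 1 + T is invertible on ΔG,
  -- the inverse being −(T + T³ + ⋯ + T^(2k−1)).

  oddSum-sum : ∀ k y G x → oddSum k y (Δ y G) x + oddSum k y (Δ y G) (x + y) ≡
               G (x + (1ℤ + (+ k + + k)) * y) - G (x + y)
  oddSum-sum zero y G x = sym (trans (cong (λ z → G (x + z) - G (x + y)) (ℤ.*-identityˡ y)) (ℤ.+-inverseʳ (G (x + y))))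
  oddSum-sum (suc k) y G x = begin
    (G (x + y + y) - G (x + y)) + O (x + (y + y)) + ((G (x + y + y + y) - G (x + y + y)) + O (x + y + (y + y)))
      ≡⟨ cong₂ (λ u v → (G (x + y + y) - G (x + y)) + O (x + (y + y)) + ((G u - G (x + y + y)) + O v)) (lemma₁ x y) (lemma₂ x y) ⟩
    (G (x + y + y) - G (x + y)) + O z + ((G (z + y) - G (x + y + y)) + O (z + y))
      ≡⟨ lemma₃ (G (x + y + y)) (G (x + y)) (O z) (G (z + y)) (O (z + y)) ⟩
    (O z + O (z + y)) + (G (z + y) - G (x + y))
      ≡⟨ cong (λ u → u + (G (z + y) - G (x + y))) (oddSum-sum k y G z) ⟩
    G (z + (1ℤ + (+ k + + k)) * y) - G (z + y) + (G (z + y) - G (x + y))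
      ≡⟨ cong (λ u → G u - G (z + y) + (G (z + y) - G (x + y))) (lemma₄ x y (+ k)) ⟩
    G (x + (1ℤ + ((1ℤ + + k) + (1ℤ + + k))) * y) - G (z + y) + (G (z + y) - G (x + y))
      ≡⟨ lemma₅ (G (x + (1ℤ + ((1ℤ + + k) + (1ℤ + + k))) * y)) (G (z + y)) (G (x + y)) ⟩
    G (x + (1ℤ + ((1ℤ + + k) + (1ℤ + + k))) * y) - G (x + y) ∎
    where
    open ≡-Reasoning
    O = oddSum k y (Δ y G)
    z = x + (y + y)
    lemma₁ : ∀ x y → x + y + y + y ≡ x + (y + y) + y
    lemma₁ = solve-∀
    lemma₂ : ∀ x y → x + y + (y + y) ≡ x + (y + y) + y
    lemma₂ = solve-∀
    lemma₃ : ∀ a b c d e → (a - b) + c + ((d - a) + e) ≡ (c + e) + (d - b)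
    lemma₃ = solve-∀
    lemma₄ : ∀ x y k → x + (y + y) + (1ℤ + (k + k)) * y ≡ x + (1ℤ + ((1ℤ + k) + (1ℤ + k))) * y
    lemma₄ = solve-∀
    lemma₅ : ∀ a b c → a - b + (b - c) ≡ a - c
    lemma₅ = solve-∀

  -- On `F` the operator `−V` undoes `1 + T_y`. The sign is absorbed here so that `oddSum` itself
  -- can play the part of `V`.
  Inverts : (Seq → Seq) → ℤ → Seq → Set
  Inverts V y F = ∀ x → F x + (V F x + V F (x + y)) ≡ 0ℤ

  oddSum-inverts : ∀ k y G → Period G ((1ℤ + (+ k + + k)) * y) → Inverts (oddSum k y) y (Δ y G)
  oddSum-inverts k y G p x = trans (cong (_+_ (Δ y G x)) (trans (oddSum-sum k y G x) (cong (λ u → u - G (x + y)) (at p x))))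
    (lemma (G (x + y)) (G x))
    where
    lemma : ∀ a b → a - b + (b - a) ≡ 0ℤ
    lemma = solve-∀

  V-equation : ∀ {V} (v : Linear V) {F G H} → (∀ x → F x + (G x + H x) ≡ 0ℤ) →
               ∀ x → V F x + (V G x + V H x) ≡ 0ℤ
  V-equation {V} v {F} {G} {H} eq x = begin
    V F x + (V G x + V H x) ≡⟨ cong (_+_ (V F x)) (V-add v G H x) ⟨
    V F x + V (λ x → G x + H x) x ≡⟨ V-add v F (λ x → G x + H x) x ⟨
    V (λ x → F x + (G x + H x)) x ≡⟨ V-cong v eq x ⟩
    V (λ _ → 0ℤ) x ≡⟨ V-zero v x ⟩
    0ℤ                                   ∎
    where open ≡-Reasoning

  V-inverts : ∀ {V} W (v : Linear V) {y} F → (∀ x → V (W F) x ≡ W (V F) x) → Inverts W y F → Inverts W y (V F)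
  V-inverts {V} W v {y} F comm inv x = begin
    V F x + (W (V F) x + W (V F) (x + y)) ≡⟨ cong₂ (λ u v → V F x + (u + v)) (comm x) (comm (x + y)) ⟨
    V F x + (V (W F) x + V (W F) (x + y)) ≡⟨ cong (λ u → V F x + (V (W F) x + u)) (V-shift v (W F) y x) ⟨
    V F x + (V (W F) x + V (λ x → W F (x + y)) x) ≡⟨ V-equation v inv x ⟩
    0ℤ                                      ∎
    where open ≡-Reasoning

  -- Iterating F = −2 T_a W F shows that F is divisible by every power of two.

  module _ {W} (lin : Linear W) (a : ℤ) where

    private
      Halving : Seq → Set
      Halving F = ∀ x → F x + (W F (x + a) + W F (x + a)) ≡ 0ℤ

      halving-W : ∀ F → Halving F → Halving (W F)
      halving-W F eq x = trans
        (cong (λ u → W F x + (u + u)) (sym (V-shift lin (W F) a x)))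
        (V-equation lin eq x)

      2^∣ : ∀ k F → Halving F → ∀ x → ∃[ z ] F x ≡ + (2 ℕ.^ k) * z
      2^∣ zero F eq x = F x , sym (ℤ.*-identityˡ (F x))
      2^∣ (suc k) F eq x with 2^∣ k (W F) (halving-W F eq) (x + a)
      ... | z , WF≡ = - z , trans
        (by-adding (eq x) (lemma₁ (F x) (W F (x + a))))
        (trans (cong (λ u → - (u + u)) WF≡) (trans (lemma₂ (+ (2 ℕ.^ k)) z)
          (cong (_* (- z)) (sym (ℤ.pos-* 2 (2 ℕ.^ k))))))
        where
        lemma₁ : ∀ f w → f + 0ℤ ≡ - (w + w) + (f + (w + w))
        lemma₁ = solve-∀
        lemma₂ : ∀ p z → - (p * z + p * z) ≡ + 2 * p * (- z)
        lemma₂ = solve-∀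

      n<2^n : ∀ n → n ℕ.< 2 ℕ.^ n
      n<2^n zero    = ℕ.z<s
      n<2^n (suc n) = ℕ.≤-trans (ℕ.+-mono-≤ (ℕ.≤-trans (ℕ.s≤s ℕ.z≤n) (n<2^n n)) (n<2^n n))
        (ℕ.≤-reflexive (cong (2 ℕ.^ n ℕ.+_) (sym (ℕ.+-identityʳ (2 ℕ.^ n)))))

    halving⇒zero : ∀ F → (∀ x → F x + (W F (x + a) + W F (x + a)) ≡ 0ℤ) → ∀ x → F x ≡ 0ℤ
    -- The exponent `abs (F x)` is large enough: a nonzero multiple of `2 ^ m` has absolute value at
    -- least `2 ^ m`, which exceeds `m`.
    halving⇒zero F eq x with 2^∣ (abs (F x)) F eq x
    ... | z , Fx≡ with z ℤ.≟ 0ℤ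
    ...   | yes refl = trans Fx≡ (ℤ.*-zeroʳ (+ (2 ℕ.^ abs (F x))))
    ...   | no  z≢0  = contradiction
      (ℕ.≤-trans (ℕ.m≤m*n (2 ℕ.^ abs (F x)) (abs z) {{ℕ.≢-nonZero (z≢0 ∘ ℤ.∣i∣≡0⇒i≡0)}})
        (ℕ.≤-reflexive (sym (trans (cong abs Fx≡) (ℤ.abs-* (+ (2 ℕ.^ abs (F x))) z)))))
      (ℕ.<⇒≱ (n<2^n (abs (F x))))

  -- Sums of squares over a period

  sumBelow : ℕ → (ℤ → ℕ) → ℕ
  sumBelow zero    φ = 0
  sumBelow (suc n) φ = sumBelow n φ ℕ.+ φ (+ n)

  sumBelow-cong : ∀ n {φ ψ} → (∀ x → φ x ≡ ψ x) → sumBelow n φ ≡ sumBelow n ψ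
  sumBelow-cong zero    eq = refl
  sumBelow-cong (suc n) eq = cong₂ ℕ._+_ (sumBelow-cong n eq) (eq (+ n))

  sumBelow-+ : ∀ n φ ψ → sumBelow n (λ x → φ x ℕ.+ ψ x) ≡ sumBelow n φ ℕ.+ sumBelow n ψ
  sumBelow-+ zero    φ ψ = refl
  sumBelow-+ (suc n) φ ψ = trans (cong (ℕ._+ (φ (+ n) ℕ.+ ψ (+ n))) (sumBelow-+ n φ ψ))
    (lemma (sumBelow n φ) (sumBelow n ψ) (φ (+ n)) (ψ (+ n)))
    where
    lemma : ∀ a b c d → a ℕ.+ b ℕ.+ (c ℕ.+ d) ≡ a ℕ.+ c ℕ.+ (b ℕ.+ d)
    lemma = ℕSolver.solve-∀

  sumBelow-* : ∀ n c φ → sumBelow n (λ x → c ℕ.* φ x) ≡ c ℕ.* sumBelow n φ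
  sumBelow-* zero    c φ = sym (ℕ.*-zeroʳ c)
  sumBelow-* (suc n) c φ = trans (cong (ℕ._+ c ℕ.* φ (+ n)) (sumBelow-* n c φ))
    (sym (ℕ.*-distribˡ-+ c (sumBelow n φ) (φ (+ n))))

  sumBelow≡0 : ∀ n {φ} → sumBelow n φ ≡ 0 → ∀ {i} → i ℕ.< n → φ (+ i) ≡ 0
  sumBelow≡0 (suc n) {φ} eq {i} (ℕ.s≤s i≤n) with ℕ.m≤n⇒m<n∨m≡n i≤n
  ... | inj₁ i<n  = sumBelow≡0 n (ℕ.m+n≡0⇒m≡0 (sumBelow n φ) eq) i<n
  ... | inj₂ refl = ℕ.m+n≡0⇒n≡0 (sumBelow n φ) eq

  sumBelow-suc : ∀ n φ → sumBelow n (λ x → φ (x + 1ℤ)) ℕ.+ φ 0ℤ ≡ sumBelow n φ ℕ.+ φ (+ n)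
  sumBelow-suc zero    φ = refl
  sumBelow-suc (suc n) φ = begin
    S ℕ.+ φ (+ n + 1ℤ) ℕ.+ φ 0ℤ ≡⟨ lemma S (φ (+ n + 1ℤ)) (φ 0ℤ) ⟩
    S ℕ.+ φ 0ℤ ℕ.+ φ (+ n + 1ℤ) ≡⟨ cong₂ ℕ._+_ (sumBelow-suc n φ) (cong (φ ∘ +_) (ℕ.+-comm n 1)) ⟩
    sumBelow n φ ℕ.+ φ (+ n) ℕ.+ φ (+ suc n)    ∎
    where
    open ≡-Reasoning
    S = sumBelow n (λ x → φ (x + 1ℤ))
    lemma : ∀ a b c → a ℕ.+ b ℕ.+ c ≡ a ℕ.+ c ℕ.+ b
    lemma = ℕSolver.solve-∀

  module _ (n : ℕ) where

    sumBelow-shiftℕ : ∀ k φ → (∀ x → φ (x + + n) ≡ φ x) → sumBelow n (λ x → φ (x + + k)) ≡ sumBelow n φ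
    sumBelow-shiftℕ zero    φ p = sumBelow-cong n λ x → cong φ (ℤ.+-identityʳ x)
    sumBelow-shiftℕ (suc k) φ p = begin
      sumBelow n (λ x → φ (x + + suc k)) ≡⟨ sumBelow-cong n (λ x → cong φ (lemma₁ x (+ k))) ⟩
      sumBelow n (λ x → φ (x + + k + 1ℤ)) ≡⟨ sumBelow-shiftℕ k (λ x → φ (x + 1ℤ)) (λ x → trans (cong φ (lemma₂ x (+ n))) (p (x + 1ℤ))) ⟩
      sumBelow n (λ x → φ (x + 1ℤ)) ≡⟨ ℕ.+-cancelʳ-≡ (φ 0ℤ) _ _ (trans (sumBelow-suc n φ)
                                                  (cong (sumBelow n φ ℕ.+_) (trans (cong φ (sym (ℤ.+-identityˡ (+ n)))) (p 0ℤ)))) ⟩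
      sumBelow n φ                           ∎
      where
      open ≡-Reasoning
      lemma₁ : ∀ x k → x + (1ℤ + k) ≡ x + k + 1ℤ
      lemma₁ = solve-∀
      lemma₂ : ∀ x n → x + n + 1ℤ ≡ x + 1ℤ + n
      lemma₂ = solve-∀

    sumBelow-shift : ∀ k φ → (∀ x → φ (x + + n) ≡ φ x) → sumBelow n (λ x → φ (x + k)) ≡ sumBelow n φ
    sumBelow-shift (+ k) φ p = sumBelow-shiftℕ k φ p
    sumBelow-shift -[1+ k ] φ p = begin
      sumBelow n (λ x → φ (x - + suc k)) ≡⟨ sumBelow-shiftℕ (suc k) _ (λ x → trans (cong φ (lemma₁ x (+ n) (+ suc k))) (p (x - + suc k))) ⟨
      sumBelow n (λ x → φ (x + + suc k - + suc k)) ≡⟨ sumBelow-cong n (λ x → cong φ (lemma₂ x (+ suc k))) ⟩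
      sumBelow n φ                                    ∎
      where
      open ≡-Reasoning
      lemma₁ : ∀ x n k → x + n - k ≡ x - k + n
      lemma₁ = solve-∀
      lemma₂ : ∀ x k → x + k - k ≡ x
      lemma₂ = solve-∀

  ‖_‖² : ℤ → ℕ
  ‖ z ‖² = abs z ℕ.* abs z

  pos-‖‖² : ∀ z → + ‖ z ‖² ≡ z * z
  pos-‖‖² (+ m)    = ℤ.pos-* m m
  pos-‖‖² -[1+ m ] = refl

  -- The parallelogram law with `u + v = 2 w`. What is lost in passing to the mean `w` is measured
  -- exactly by `(u − v)²`.
  parallelogram : ∀ u v w → u + v ≡ w + w → 4 ℕ.* ‖ w ‖² ℕ.+ ‖ u - v ‖² ≡ 2 ℕ.* (‖ u ‖² ℕ.+ ‖ v ‖²)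
  parallelogram u v w eq = ℤ.+-injective (begin
    + (4 ℕ.* ‖ w ‖²) + + ‖ u - v ‖² ≡⟨ cong₂ _+_ (ℤ.pos-* 4 ‖ w ‖²) (pos-‖‖² (u - v)) ⟩
    + 4 * + ‖ w ‖² + (u - v) * (u - v) ≡⟨ cong (λ z → + 4 * z + (u - v) * (u - v)) (pos-‖‖² w) ⟩
    + 4 * (w * w) + (u - v) * (u - v) ≡⟨ cong (λ z → z + (u - v) * (u - v)) (lemma₁ w) ⟩
    (w + w) * (w + w) + (u - v) * (u - v) ≡⟨ cong (λ z → z * z + (u - v) * (u - v)) eq ⟨
    (u + v) * (u + v) + (u - v) * (u - v) ≡⟨ lemma₂ u v ⟩
    + 2 * (u * u + v * v) ≡⟨ cong₂ (λ a b → + 2 * (a + b)) (pos-‖‖² u) (pos-‖‖² v) ⟨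
    + 2 * (+ ‖ u ‖² + + ‖ v ‖²) ≡⟨ ℤ.pos-* 2 (‖ u ‖² ℕ.+ ‖ v ‖²) ⟨
    + (2 ℕ.* (‖ u ‖² ℕ.+ ‖ v ‖²))            ∎)
    where
    open ≡-Reasoning
    lemma₁ : ∀ w → + 4 * (w * w) ≡ (w + w) * (w + w)
    lemma₁ = solve-∀
    lemma₂ : ∀ u v → (u + v) * (u + v) + (u - v) * (u - v) ≡ + 2 * (u * u + v * v)
    lemma₂ = solve-∀

  -- Passing from F to W F replaces F by the average of two of its translates, which does not
  -- increase the sum of squares over a period, and preserves it only if the translates agree.
  -- Integrality makes the descent stop.

  module _ (n : ℕ) .{{_ : ℕ.NonZero n}} {W} (lin : Linear W) (y a : ℤ) where

    private
      energy : Seq → ℕ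
      energy F = sumBelow n (λ x → ‖ F x ‖²)

      Averages : Seq → Set
      Averages F = ∀ x → F (x + (a - y)) + F (x - a) ≡ W F x + W F x

      averages-W : ∀ F → Averages F → Averages (W F)
      averages-W F eq x = begin
        W F (x + (a - y)) + W F (x - a) ≡⟨ cong₂ _+_ (V-shift lin F (a - y) x) (V-shift lin F (- a) x) ⟨
        W (λ x → F (x + (a - y))) x + W (λ x → F (x - a)) x ≡⟨ V-add lin (λ x → F (x + (a - y))) (λ x → F (x - a)) x ⟨
        W (λ x → F (x + (a - y)) + F (x - a)) x ≡⟨ V-cong lin eq x ⟩
        W (λ x → W F x + W F x) x ≡⟨ V-add lin (W F) (W F) x ⟩
        W (W F) x + W (W F) x                                ∎
        where open ≡-Reasoning

      defect : Seq → ℤ → ℕ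
      defect F x = ‖ F (x + (a - y)) - F (x - a) ‖²

      -- The parallelogram law summed over a period; each of the two translates contributes the full
      -- energy of `F`.
      energy-drop : ∀ F → Period F (+ n) → Averages F →
                    4 ℕ.* energy (W F) ℕ.+ sumBelow n (defect F) ≡ 4 ℕ.* energy F
      energy-drop F p eq = begin
        4 ℕ.* energy (W F) ℕ.+ sumBelow n (defect F)
          ≡⟨ cong (ℕ._+ sumBelow n (defect F)) (sumBelow-* n 4 (λ x → ‖ W F x ‖²)) ⟨
        sumBelow n (λ x → 4 ℕ.* ‖ W F x ‖²) ℕ.+ sumBelow n (defect F)
          ≡⟨ sumBelow-+ n (λ x → 4 ℕ.* ‖ W F x ‖²) (defect F) ⟨
        sumBelow n (λ x → 4 ℕ.* ‖ W F x ‖² ℕ.+ defect F x)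
          ≡⟨ sumBelow-cong n (λ x → parallelogram (F (x + (a - y))) (F (x - a)) (W F x) (eq x)) ⟩
        sumBelow n (λ x → 2 ℕ.* (s (x + (a - y)) ℕ.+ s (x - a)))
          ≡⟨ sumBelow-* n 2 _ ⟩
        2 ℕ.* sumBelow n (λ x → s (x + (a - y)) ℕ.+ s (x - a))
          ≡⟨ cong (2 ℕ.*_) (sumBelow-+ n (λ x → s (x + (a - y))) (λ x → s (x - a))) ⟩
        2 ℕ.* (sumBelow n (λ x → s (x + (a - y))) ℕ.+ sumBelow n (λ x → s (x - a)))
          ≡⟨ cong (2 ℕ.*_) (cong₂ ℕ._+_ (sumBelow-shift n (a - y) s s-period) (sumBelow-shift n (- a) s s-period)) ⟩
        2 ℕ.* (energy F ℕ.+ energy F)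
          ≡⟨ lemma (energy F) ⟩
        4 ℕ.* energy F ∎
        where
        open ≡-Reasoning
        s : ℤ → ℕ
        s x = ‖ F x ‖²
        s-period : ∀ x → s (x + + n) ≡ s x
        s-period x = cong ‖_‖² (at p x)
        lemma : ∀ e → 2 ℕ.* (e ℕ.+ e) ≡ 4 ℕ.* e
        lemma = ℕSolver.solve-∀

      no-defect : ∀ F → Period F (+ n) → sumBelow n (defect F) ≡ 0 → Period F (a + a - y)
      no-defect F p eq = periodic λ x → begin
        F (x + (a + a - y)) ≡⟨ cong F (lemma₁ x a y) ⟩
        F (x + a + (a - y)) ≡⟨ ℤ.i-j≡0⇒i≡j _ _ (agree (x + a)) ⟩
        F (x + a - a) ≡⟨ cong F (lemma₂ x a) ⟩
        F x                         ∎
        where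
        open ≡-Reasoning
        lemma₁ : ∀ x a y → x + (a + a - y) ≡ x + a + (a - y)
        lemma₁ = solve-∀
        lemma₂ : ∀ x a → x + a - a ≡ x
        lemma₂ = solve-∀
        lemma₃ : ∀ r q → r + q - r ≡ q
        lemma₃ = solve-∀
        G : Seq
        G x = F (x + (a - y)) - F (x - a)
        G-period : Period G (+ n)
        G-period = periodic λ x → cong₂ _-_ (at (period-shift p (a - y)) x) (at (period-shift p (- a)) x)
        agree : ∀ x → G x ≡ 0ℤ
        -- The vanishing sum speaks only of the residues `0, …, n − 1`; periodicity carries it to
        -- every integer.
        agree x = trans
          (period-≈ G-period x r (divides (x /ℕ n) (trans (cong (_- r) (a≡a%ℕn+[a/ℕn]*n x n)) (lemma₃ r (x /ℕ n * + n)))))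
          (ℤ.∣i∣≡0⇒i≡0 (square≡0 (abs (G r)) (sumBelow≡0 n {defect F} eq (n%ℕd<d x n))))
          where
          r = + (x %ℕ n)
          square≡0 : ∀ m → m ℕ.* m ≡ 0 → m ≡ 0
          square≡0 zero _ = refl

      -- A nonzero defect makes the energy of `W F` strictly smaller, so the recursion gives the
      -- period for `W F`. It passes back to `F` because `F = −(1 + T_y) W F`.
      descend : ∀ F → Acc ℕ._<_ (energy F) → Period F (+ n) → Inverts W y F → Averages F → Period F (a + a - y)
      descend F (acc rec) p inv avg with sumBelow n (defect F) ℕ.≟ 0
      ... | yes ≡0 = no-defect F p ≡0
      ... | no  ≢0 = periodic λ x → trans (solved (x + (a + a - y)))
          (trans (cong₂ (λ u v → - (u + v)) (at WF-period x) (at (period-shift WF-period y) x)) (sym (solved x)))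
        where
        WF-period : Period (W F) (a + a - y)
        WF-period = descend (W F) (rec (ℕ.*-cancelˡ-< 4 (energy (W F)) (energy F)
          (subst (4 ℕ.* energy (W F) ℕ.<_) (energy-drop F p avg) (ℕ.m<m+n _ (ℕ.n≢0⇒n>0 ≢0)))))
          (V-period lin p) (V-inverts W lin F (λ _ → refl) inv) (averages-W F avg)
        solved : ∀ x → F x ≡ - (W F x + W F (x + y))
        solved x = by-adding (inv x) (lemma (F x) (W F x + W F (x + y)))
          where
          lemma : ∀ f w → f + 0ℤ ≡ - w + (f + w)
          lemma = solve-∀

    averaging⇒period : ∀ {F} → Period F (+ n) → Inverts W y F →
                       (∀ x → F (x + (a - y)) + F (x - a) ≡ W F x + W F x) → Period F (a + a - y)
    averaging⇒period {F} = descend F (<-wellFounded (energy F))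

  -- The labels as a periodic sequence

  -- For `z ≥ 0` the geometric sum `G = g + T_p g + ⋯ + T_p^(z−1) g` works. Negative `z` reduces to
  -- this by `T_(−y) − 1 = −(T_y − 1) T_(−y)`.
  antidifference : ∀ g p z → ∃[ G ] (∀ x → Δ (z * p) g x ≡ Δ p G x) × (∀ {k} → Period g k → Period G k)
  antidifference g p z = from-sign z
    where
    sums : ℕ → Seq
    sums zero    x = 0ℤ
    sums (suc m) x = sums m x + g (x + + m * p)

    Δ-sums : ∀ m x → Δ (+ m * p) g x ≡ Δ p (sums m) x
    Δ-sums zero x = trans (cong (λ u → g u - g x) (ℤ.+-identityʳ x)) (ℤ.+-inverseʳ (g x))
    Δ-sums (suc m) x = begin
      g (x + (1ℤ + + m) * p) - g x ≡⟨ cong (λ u → g u - g x) (lemma₁ x p (+ m)) ⟩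
      g (x + p + + m * p) - g x ≡⟨ lemma₂ (g (x + p + + m * p)) (g x) (g (x + + m * p)) ⟩
      Δ (+ m * p) g x + (g (x + p + + m * p) - g (x + + m * p)) ≡⟨ cong (_+ (g (x + p + + m * p) - g (x + + m * p))) (Δ-sums m x) ⟩
      Δ p (sums m) x + (g (x + p + + m * p) - g (x + + m * p)) ≡⟨ lemma₃ (sums m (x + p)) (sums m x) (g (x + p + + m * p)) (g (x + + m * p)) ⟩
      Δ p (sums (suc m)) x                                     ∎
      where
      open ≡-Reasoning
      lemma₁ : ∀ x p m → x + (1ℤ + m) * p ≡ x + p + m * p
      lemma₁ = solve-∀
      lemma₂ : ∀ u v w → u - v ≡ w - v + (u - w)
      lemma₂ = solve-∀
      lemma₃ : ∀ s t u v → s - t + (u - v) ≡ s + u - (t + v)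
      lemma₃ = solve-∀

    sums-period : ∀ m {k} → Period g k → Period (sums m) k
    sums-period zero    pk = periodic λ _ → refl
    sums-period (suc m) pk = periodic λ x → cong₂ _+_ (at (sums-period m pk) x) (at (period-shift pk (+ m * p)) x)

    from-sign : ∀ z → ∃[ G ] (∀ x → Δ (z * p) g x ≡ Δ p G x) × (∀ {k} → Period g k → Period G k)
    from-sign (+ m) = sums m , Δ-sums m , sums-period m
    from-sign -[1+ m ] = (λ x → - sums (suc m) (x - y)) , eq ,
      λ pk → periodic λ x → cong -_ (at (period-shift (sums-period (suc m) pk) (- y)) x)
      where
      y = + suc m * p
      lemma₁ : ∀ x m p → x + - m * p ≡ x - m * p
      lemma₁ = solve-∀
      lemma₂ : ∀ x y → x - y + y ≡ x
      lemma₂ = solve-∀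
      lemma₃ : ∀ x y p → x - y + p ≡ x + p - y
      lemma₃ = solve-∀
      lemma₄ : ∀ u v w z → v - u + (u - v) ≡ - w - - z + (w - z)
      lemma₄ = solve-∀
      S = sums (suc m)
      eq : ∀ x → Δ (-[1+ m ] * p) g x ≡ - S (x + p - y) - - S (x - y)
      eq x = begin
        g (x + - + suc m * p) - g x ≡⟨ cong (λ u → g u - g x) (lemma₁ x (+ suc m) p) ⟩
        g (x - y) - g x ≡⟨ by-adding (sym (Δ-sums (suc m) (x - y)))
                                                    (trans (cong (λ u → g (x - y) - g x + (g u - g (x - y))) (lemma₂ x y))
                                                           (lemma₄ (g x) (g (x - y)) (S (x - y + p)) (S (x - y)))) ⟩
        - S (x - y + p) - - S (x - y) ≡⟨ cong (λ u → - S u - - S (x - y)) (lemma₃ x y p) ⟩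
        - S (x + p - y) - - S (x - y)          ∎
        where
        open ≡-Reasoning

  -- Parity and the order of an element modulo 2h

  parity : ∀ z → ∃[ q ] (z ≡ q + q ⊎ z ≡ 1ℤ + (q + q))
  parity z = z /ℕ 2 , by-remainder (z %ℕ 2) (n%ℕd<d z 2) (a≡a%ℕn+[a/ℕn]*n z 2)
    where
    lemma₁ : ∀ q → 0ℤ + q * + 2 ≡ q + q
    lemma₁ = solve-∀
    lemma₂ : ∀ q → 1ℤ + q * + 2 ≡ 1ℤ + (q + q)
    lemma₂ = solve-∀
    by-remainder : ∀ r → r ℕ.< 2 → z ≡ + r + z /ℕ 2 * + 2 → z ≡ z /ℕ 2 + z /ℕ 2 ⊎ z ≡ 1ℤ + (z /ℕ 2 + z /ℕ 2)
    by-remainder 0 _ eq = inj₁ (trans eq (lemma₁ (z /ℕ 2)))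
    by-remainder 1 _ eq = inj₂ (trans eq (lemma₂ (z /ℕ 2)))
    by-remainder (suc (suc r)) (ℕ.s≤s (ℕ.s≤s ())) _

  parityℕ : ∀ m → ∃[ k ] (m ≡ k ℕ.+ k ⊎ m ≡ suc (k ℕ.+ k))
  parityℕ zero = 0 , inj₁ refl
  parityℕ (suc m) with parityℕ m
  ... | k , inj₁ refl = k , inj₂ refl
  ... | k , inj₂ refl = suc k , inj₁ (cong suc (sym (ℕ.+-suc k k)))

  OddOrder : ℤ → ℤ → Set
  OddOrder n y = ∃[ k ] n ∣ (1ℤ + (+ k + + k)) * y

  ∣-double : ∀ {m k} → m + m ∣ k + k → m ∣ k
  ∣-double {m} {k} (divides q eq) = divides q (double-injective (trans eq (lemma q m)))
    where
    lemma : ∀ q m → q * (m + m) ≡ q * m + q * m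
    lemma = solve-∀

  -- Start from the multiplier `m = n` of `y` and halve while it is even. If `n ∣ 2 k y` then
  -- `k y = z h`: for odd `z` this multiple is congruent to `h`, and for even `z` the smaller
  -- multiplier `k` still works. Otherwise an odd multiplier is reached.
  odd-order : ∀ h .{{_ : ℕ.NonZero h}} y → OddOrder (+ h + + h) y ⊎ ∃[ z ] + h + + h ∣ z * y - + h
  odd-order h@(suc _) y = <-rec _ search (h ℕ.+ h) (λ ()) (∣m⇒∣m*n y ∣-refl)
    where
    n = + h + + h
    lemma₁ : ∀ k y → (k + k) * y ≡ k * y + k * y
    lemma₁ = solve-∀
    lemma₂ : ∀ q h → (q + q) * h ≡ q * (h + h)
    lemma₂ = solve-∀
    lemma₃ : ∀ q h → (1ℤ + (q + q)) * h - h ≡ q * (h + h)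
    lemma₃ = solve-∀
    search : ∀ m → (∀ {k} → k ℕ.< m → k ≢ 0 → n ∣ + k * y → OddOrder n y ⊎ ∃[ z ] n ∣ z * y - + h) →
             m ≢ 0 → n ∣ + m * y → OddOrder n y ⊎ ∃[ z ] n ∣ z * y - + h
    search m rec m≢0 n∣ with parityℕ m
    ... | k , inj₂ refl = inj₁ (k , n∣)
    ... | zero , inj₁ refl = contradiction refl m≢0
    ... | k@(suc k′) , inj₁ refl with ∣-double (subst (n ∣_) (lemma₁ (+ k) y) n∣)
    ...   | divides z eq with parity z
    ...     | q , inj₁ refl = rec (ℕ.m<m+n k ℕ.z<s) (λ ()) (divides q (trans eq (lemma₂ q (+ h))))
    ...     | q , inj₂ refl = inj₂ (+ k , divides q (trans (cong (_- + h) eq) (lemma₃ q (+ h))))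

  -- A difference over a multiple of `y` is also a `y`-difference, of a sequence that keeps all
  -- periods of `g`; this is the shape that `oddSum-inverts` accepts.
  multiple-inverts : ∀ {n g y Y} → Period g n → ((k , _) : OddOrder n y) → y ∣ Y → Inverts (oddSum k y) y (Δ Y g)
  multiple-inverts {g = g} {y} pg (k , n∣) (divides z refl) x with antidifference g y z
  ... | G , eq , period = trans
    (cong₂ _+_ (eq x) (cong₂ _+_ (V-cong O eq x) (V-cong O eq (x + y))))
    (oddSum-inverts k y G (period-∣ (period pg) n∣) x)
    where O = oddSum-linear k y

  -- Necessity: equations satisfied by the labels

  module Necessity
    (h : ℕ) .{{_ : ℕ.NonZero h}} (f : Seq) (r : ℤ)
    (f-period : Period f (+ h + + h))
    (f-injective : ∀ x y → f x ≡ f y → + h + + h ∣ x - y)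
    where

    private n = + h + + h

    n≢0 : ℕ.NonZero (h ℕ.+ h)
    n≢0 = ℕ.>-nonZero (ℕ.≤-trans (ℕ.>-nonZero⁻¹ h) (ℕ.m≤m+n h h))

    d g : Seq
    d x = f x - f (x + + h)
    g x = f x + f (x + + h)

    h+h : ∀ x → f (x + + h + + h) ≡ f x
    h+h x = trans (cong f (ℤ.+-assoc x (+ h) (+ h))) (at f-period x)

    d-period : Period d n
    d-period = periodic λ x → cong₂ _-_ (at f-period x) (at (period-shift f-period (+ h)) x)

    d-antiperiod : ∀ x → d (x + + h) ≡ - d x
    d-antiperiod x = trans (cong (_-_ (f (x + + h))) (h+h x)) (lemma (f (x + + h)) (f x))
      where
      lemma : ∀ u v → u - v ≡ - (v - u)
      lemma = solve-∀

    g-period : Period g (+ h)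
    g-period = periodic λ x → trans (cong (_+_ (f (x + + h))) (h+h x)) (ℤ.+-comm (f (x + + h)) (f x))

    g-periodₙ : Period g n
    g-periodₙ = period-+ g-period g-period

    -- Translation by `z y` fixes `d` and translation by `h` negates it. If the two agreed modulo
    -- `n`, then `d 0 = 0`, that is, `f` would take the same value at `0` and `h`, although
    -- `0 < h < n`.
    no-h-period : ∀ {y} → Period d y → ¬ (∃[ z ] n ∣ z * y - + h)
    no-h-period {y} p (z , n∣) = contradiction
      (ℕ.∣⇒≤ (∣⇒∣ᵤ (subst (n ∣_) (lemma₂ (+ h)) (f-injective (0ℤ + + h) 0ℤ (sym (ℤ.i-j≡0⇒i≡j _ _ d0≡0))))))
      (ℕ.<⇒≱ (ℕ.m<m+n h (ℕ.>-nonZero⁻¹ h)))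
      where
      lemma₁ : ∀ a h → 0ℤ + a - (0ℤ + h) ≡ a - h
      lemma₁ = solve-∀
      lemma₂ : ∀ h → 0ℤ + h - 0ℤ ≡ h
      lemma₂ = solve-∀
      d0≡0 : d 0ℤ ≡ 0ℤ
      d0≡0 = double-injective (trans (cong (_+ d 0ℤ) (trans (sym (at (period-* p z) 0ℤ))
        (trans (period-≈ d-period (0ℤ + z * y) (0ℤ + + h) (subst (n ∣_) (sym (lemma₁ (z * y) (+ h))) n∣))
               (d-antiperiod 0ℤ)))) (ℤ.+-inverseˡ (d 0ℤ)))

    -- Because `2 f = d + g`, a common period makes `f` agree at `0` and `y`.
    d+g⇒∣ : ∀ {y} → Period d y → Period g y → n ∣ y
    d+g⇒∣ {y} pd pg = subst (n ∣_) (lemma₂ y) (f-injective (0ℤ + y) 0ℤ (double-injective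
      (trans (lemma₁ (f (0ℤ + y)) (f (0ℤ + y + + h))) (trans (cong₂ _+_ (at pd 0ℤ) (at pg 0ℤ)) (sym (lemma₁ (f 0ℤ) (f (0ℤ + + h))))))))
      where
      lemma₁ : ∀ u v → u + u ≡ (u - v) + (u + v)
      lemma₁ = solve-∀
      lemma₂ : ∀ y → 0ℤ + y - 0ℤ ≡ y
      lemma₂ = solve-∀

    odd-order-not-even : ∀ {y} → Period d y → OddOrder n y
    odd-order-not-even {y} pd with odd-order h y
    ... | inj₁ odd  = odd
    ... | inj₂ even = contradiction even (no-h-period pd)

    module Magic
      (a b : ℤ)
      (magic : ∀ x → f x + (f (x + a) + f (x - a)) + (f (x + b) + f (x - b)) + f (x + + h) ≡ r)
      where

      star : Seq → Seq
      star F x = (F (x + a) + F (x - a)) + (F (x + b) + F (x - b))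

      magic-h : ∀ x → f (x + + h) + (f (x + a + + h) + f (x - a + + h)) + (f (x + b + + h) + f (x - b + + h)) + f x ≡ r
      magic-h x = trans (cong₂ _+_ (cong₂ _+_ (cong (_+_ (f (x + + h)))
        (cong₂ _+_ (cong f (swap x a (+ h))) (cong f (swap x (- a) (+ h)))))
        (cong₂ _+_ (cong f (swap x b (+ h))) (cong f (swap x (- b) (+ h))))) (sym (h+h x))) (magic (x + + h))
        where
        swap : ∀ x a h → x + a + h ≡ x + h + a
        swap = solve-∀

      -- The magic equations at `x` and at `x + h` share the part `f x + f (x + h)`, so it cancels
      -- in their difference. Their sum gives `g-star`.
      d-star : ∀ x → star d x ≡ 0ℤ
      d-star x = by-adding (trans (magic x) (sym (magic-h x)))
        (lemma (f x) (f (x + + h)) (f (x + a)) (f (x + a + + h)) (f (x - a)) (f (x - a + + h)) (f (x + b)) (f (x + b + + h)) (f (x - b)) (f (x - b + + h)))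
        where
        lemma : ∀ f₀ fₕ a a′ a₋ a₋′ b b′ b₋ b₋′ →
          ((a - a′) + (a₋ - a₋′)) + ((b - b′) + (b₋ - b₋′)) + (fₕ + (a′ + a₋′) + (b′ + b₋′) + f₀) ≡ 0ℤ + (f₀ + (a + a₋) + (b + b₋) + fₕ)
        lemma = solve-∀

      g-star : ∀ x → g x + g x + star g x ≡ r + r
      g-star x = trans (lemma (f x) (f (x + + h)) (f (x + a)) (f (x + a + + h)) (f (x - a)) (f (x - a + + h)) (f (x + b)) (f (x + b + + h)) (f (x - b)) (f (x - b + + h)))
        (cong₂ _+_ (magic x) (magic-h x))
        where
        lemma : ∀ f₀ fₕ a a′ a₋ a₋′ b b′ b₋ b₋′ →
          (f₀ + fₕ) + (f₀ + fₕ) + (((a + a′) + (a₋ + a₋′)) + ((b + b′) + (b₋ + b₋′))) ≡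
          (f₀ + (a + a₋) + (b + b₋) + fₕ) + (fₕ + (a′ + a₋′) + (b′ + b₋′) + f₀)
        lemma = solve-∀

      Δg-star : ∀ y x → Δ y g x + (Δ y g x + star (Δ y g) x) ≡ 0ℤ
      Δg-star y x = by-adding (trans (g-star (x + y)) (sym (g-star x))) (begin
        Δ y g x + (Δ y g x + star (Δ y g) x) + (g x + g x + star g x)
          ≡⟨ lemma (g (x + y)) (g x) (g (x + a + y)) (g (x + a)) (g (x - a + y)) (g (x - a)) (g (x + b + y)) (g (x + b)) (g (x - b + y)) (g (x - b)) ⟩
        0ℤ + (g (x + y) + g (x + y) + ((g (x + a + y) + g (x - a + y)) + (g (x + b + y) + g (x - b + y))))
          ≡⟨ cong (λ u → 0ℤ + (g (x + y) + g (x + y) + u)) (cong₂ _+_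
               (cong₂ _+_ (cong g (swap x a y)) (cong g (swap x (- a) y)))
               (cong₂ _+_ (cong g (swap x b y)) (cong g (swap x (- b) y)))) ⟩
        0ℤ + (g (x + y) + g (x + y) + star g (x + y)) ∎)
        where
        open ≡-Reasoning
        swap : ∀ x a h → x + a + h ≡ x + h + a
        swap = solve-∀
        lemma : ∀ f₀ fₕ a a′ a₋ a₋′ b b′ b₋ b₋′ →
          (f₀ - fₕ) + ((f₀ - fₕ) + (((a - a′) + (a₋ - a₋′)) + ((b - b′) + (b₋ - b₋′)))) + (fₕ + fₕ + ((a′ + a₋′) + (b′ + b₋′))) ≡
          0ℤ + (f₀ + f₀ + ((a + a₋) + (b + b₋)))
        lemma = solve-∀

      p q : ℤ
      p = a + b + + h
      q = a - b + + h

      -- T_a + T_−a + T_b + T_−b = T_−a (1 + T_(a+b)) (1 + T_(a−b)), and T_h = −1 on d.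
      d-factorisation : Period (Δ q d) p
      d-factorisation = periodic λ x → by-adding (d-star (x + a)) (begin
        d (x + p + q) - d (x + p) + 0ℤ
          ≡⟨ cong₂ (λ u v → u - v + 0ℤ) (period-≈ d-period (x + p + q) (x + a + a) (divides 1ℤ (lemma₁ x a b (+ h)))) (at-p x b) ⟩
        d (x + a + a) - - d (x + a + b) + 0ℤ
          ≡⟨ lemma₂ (d (x + a + a)) (d (x + a + b)) (d (x + a - b)) (d x) ⟩
        - d (x + a - b) - d x + ((d (x + a + a) + d x) + (d (x + a + b) + d (x + a - b)))
          ≡⟨ cong₂ (λ u v → u - d x + ((d (x + a + a) + v) + (d (x + a + b) + d (x + a - b)))) (sym (at-p x (- b))) (cong d (lemma₃ x a)) ⟩
        d (x + q) - d x + star d (x + a) ∎)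
        where
        open ≡-Reasoning
        lemma₀ : ∀ x a b h → x + (a + b + h) ≡ x + a + b + h
        lemma₀ = solve-∀
        at-p : ∀ x b → d (x + (a + b + + h)) ≡ - d (x + a + b)
        at-p x b = trans (cong d (lemma₀ x a b (+ h))) (d-antiperiod (x + a + b))
        lemma₁ : ∀ x a b h → x + (a + b + h) + (a - b + h) - (x + a + a) ≡ 1ℤ * (h + h)
        lemma₁ = solve-∀
        lemma₂ : ∀ s t u v → s - - t + 0ℤ ≡ - u - v + ((s + v) + (t + u))
        lemma₂ = solve-∀
        lemma₃ : ∀ x a → x ≡ x + a - a
        lemma₃ = solve-∀

      V-star : ∀ {V} → Linear V → ∀ F x → V (star F) x ≡ star (V F) x
      V-star {V} v F x = begin
        V (star F) x
          ≡⟨ V-add v (λ x → F (x + a) + F (x - a)) (λ x → F (x + b) + F (x - b)) x ⟩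
        V (λ x → F (x + a) + F (x - a)) x + V (λ x → F (x + b) + F (x - b)) x
          ≡⟨ cong₂ _+_ (V-add v (λ x → F (x + a)) (λ x → F (x - a)) x) (V-add v (λ x → F (x + b)) (λ x → F (x - b)) x) ⟩
        (V (λ x → F (x + a)) x + V (λ x → F (x - a)) x) + (V (λ x → F (x + b)) x + V (λ x → F (x - b)) x)
          ≡⟨ cong₂ _+_ (cong₂ _+_ (V-shift v F a x) (V-shift v F (- a) x)) (cong₂ _+_ (V-shift v F b x) (V-shift v F (- b) x)) ⟩
        star (V F) x ∎
        where open ≡-Reasoning

      -- With `H` obtained from `F` by both odd sums, `F = (1 + T_p)(1 + T_q) H`. Since `H` has
      -- period `h`, the right side is `T_a (star H)`, and the magic condition for `H` makes it
      -- `−2 T_a H`. Halving then kills `F`, so `p q` is a period of `g`; `common-period` makes it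
      -- one of `d`.
      both-odd : OddOrder n p → OddOrder n q → n ∣ p * q
      both-odd op@(k , _) oq@(l , _) = d+g⇒∣
        (common-period (h ℕ.+ h) {{n≢0}} d-period d-factorisation p∣ q∣)
        (periodic λ x → ℤ.i-j≡0⇒i≡j _ _ (halving⇒zero W a F halving x))
        where
        y = p * q
        p∣ : p ∣ y
        p∣ = ∣m⇒∣m*n q ∣-refl
        q∣ : q ∣ y
        q∣ = ∣n⇒∣m*n p ∣-refl
        F = Δ y g
        P = oddSum-linear k p
        W = linear-∘ P (oddSum-linear l q)
        PF = oddSum k p F
        H = oddSum k p (oddSum l q F)
        H-period : Period H (+ h)
        H-period = V-period W (Δ-period y g-period)
        eqᵖ : ∀ x → F x + (PF x + PF (x + p)) ≡ 0ℤ
        eqᵖ = multiple-inverts g-periodₙ op p∣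
        eq^q : ∀ x → PF x + (H x + H (x + q)) ≡ 0ℤ
        eq^q x = trans (cong (λ u → PF x + (H x + u)) (sym (V-shift P (oddSum l q F) q x)))
          (V-equation P (multiple-inverts g-periodₙ oq q∣) x)
        eq* : ∀ x → H x + (H x + star H x) ≡ 0ℤ
        eq* x = trans (cong (λ u → H x + (H x + u)) (sym (V-star W F x))) (V-equation W (Δg-star y) x)
        halving : ∀ x → F x + (H (x + a) + H (x + a)) ≡ 0ℤ
        halving x = by-adding
          (trans (cong₂ _+_ (eqᵖ x) (eq* (x + a))) (sym (cong₂ _+_ (eq^q x) (eq^q (x + p)))))
          (begin
          F x + (H (x + a) + H (x + a)) + (PF x + (H x + H (x + q)) + (PF (x + p) + (H (x + p) + H (x + p + q))))
            ≡⟨ cong (_+_ (F x + (H (x + a) + H (x + a)))) (cong₂ _+_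
                 (cong (_+_ (PF x)) (cong₂ _+_ (cong H (lemma₁ x a))
                   (period-≈ H-period (x + q) (x + a - b) (divides 1ℤ (lemma₂ x a b (+ h))))))
                 (cong (_+_ (PF (x + p))) (cong₂ _+_
                   (period-≈ H-period (x + p) (x + a + b) (divides 1ℤ (lemma₃ x a b (+ h))))
                   (period-≈ H-period (x + p + q) (x + a + a) (divides (+ 2) (lemma₄ x a b (+ h))))))) ⟩
          F x + (H (x + a) + H (x + a)) + (PF x + (H (x + a - a) + H (x + a - b)) + (PF (x + p) + (H (x + a + b) + H (x + a + a))))
            ≡⟨ lemma₅ (F x) (H (x + a)) (PF x) (H (x + a - a)) (H (x + a - b)) (PF (x + p)) (H (x + a + b)) (H (x + a + a)) ⟩
          0ℤ + (F x + (PF x + PF (x + p)) + (H (x + a) + (H (x + a) + star H (x + a)))) ∎)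
          where
          open ≡-Reasoning
          lemma₁ : ∀ x a → x ≡ x + a - a
          lemma₁ = solve-∀
          lemma₂ : ∀ x a b h → x + (a - b + h) - (x + a - b) ≡ 1ℤ * h
          lemma₂ = solve-∀
          lemma₃ : ∀ x a b h → x + (a + b + h) - (x + a + b) ≡ 1ℤ * h
          lemma₃ = solve-∀
          lemma₄ : ∀ x a b h → x + (a + b + h) + (a - b + h) - (x + a + a) ≡ + 2 * h
          lemma₄ = solve-∀
          lemma₅ : ∀ f ha pf h₀ hq pf′ hp hpq →
            f + (ha + ha) + (pf + (h₀ + hq) + (pf′ + (hp + hpq))) ≡ 0ℤ + (f + (pf + pf′) + (ha + (ha + ((hpq + h₀) + (hp + hq)))))
          lemma₅ = solve-∀

      -- `E = Δ q d` has period `p`, hence is fixed by a translation congruent to `h`; but `T_h`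
      -- negates `E` just as it negates `d`.
      h-multiple⇒period : ∃[ z ] n ∣ z * p - + h → Period d q
      h-multiple⇒period (z , n∣) = periodic λ x → ℤ.i-j≡0⇒i≡j _ _ (E≡0 x)
        where
        E = Δ q d
        lemma₁ : ∀ x a h → x + a - (x + h) ≡ a - h
        lemma₁ = solve-∀
        lemma₂ : ∀ x q h → x + h + q ≡ x + q + h
        lemma₂ = solve-∀
        lemma₃ : ∀ u v → - u - - v ≡ - (u - v)
        lemma₃ = solve-∀
        E-antiperiod : ∀ x → E (x + + h) ≡ - E x
        E-antiperiod x = trans (cong₂ _-_ (trans (cong d (lemma₂ x q (+ h))) (d-antiperiod (x + q))) (d-antiperiod x))
          (lemma₃ (d (x + q)) (d x))
        E≡0 : ∀ x → E x ≡ 0ℤ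
        E≡0 x = double-injective (trans (cong (λ u → u + E x) (trans (sym (at (period-* d-factorisation z) x))
          (trans (period-≈ (Δ-period q d-period) (x + z * p) (x + + h) (subst (n ∣_) (sym (lemma₁ x (z * p) (+ h))) n∣))
                 (E-antiperiod x)))) (ℤ.+-inverseˡ (E x)))

      -- All relations are derived on `F = Δ p g`, where `T_p` satisfies `1 + T_p + T_p² = 0` and
      -- both `T_a` and `T_b` equal `T_p⁻¹`. A further period `p` of `F` would force `F = 0` and
      -- `n ∣ p`; each of `3 ∣ p`, `3 ∣ a`, `3 ∣ b` would produce that period.
      one-odd : OddOrder n p → Period d p → ∀ α β γ → α * a + β * b + γ * + h ≡ 1ℤ →
                (n ∣ p) ⊎ ((n ∣ + 3 * p) × (¬ + 3 ∣ p) × (¬ + 3 ∣ a) × (¬ + 3 ∣ b))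
      one-odd odd@(k , _) pd α β γ bézout with n ∣? p
      ... | yes n∣p = inj₁ n∣p
      ... | no  n∤p = inj₂
        -- The period `3 p` of `F = Δ p g` says `(T_p − 1)(T_3p − 1) g = 0`, hence
        -- `(T_3p − 1)² g = 0`, and periodicity modulo `n` removes the square.
        ( d+g⇒∣ (period-* pd (+ 3)) (period-from-Δ (h ℕ.+ h) {{n≢0}} (period-∣ g-periodₙ (∣m⇒∣m*n (+ 3 * p) ∣-refl))
            (period-* (Δ-swap {g} F-3p) (+ 3)))
        , (λ 3∣p → F-p (period-∣ F-3 3∣p))
        , (λ 3∣a → F-p (subst (Period F) (lemma₉ a p) (period-+ F-a+p (period-neg (period-∣ F-3 3∣a)))))
        , (λ 3∣b → F-p (subst (Period F) (lemma₉ b p) (period-+ F-b+p (period-neg (period-∣ F-3 3∣b))))))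
        where
        open ≡-Reasoning
        F = Δ p g
        W = oddSum k p
        W-linear = oddSum-linear k p
        F-h : Period F (+ h)
        F-h = Δ-period p g-period
        inverse : Inverts W p F
        inverse = multiple-inverts g-periodₙ odd ∣-refl

        D : Seq → Seq
        D F x = F (x + (a - p)) + F (x - a)
        D-linear : Linear D
        D-linear = record
          { V-cong  = λ eq x → cong₂ _+_ (eq (x + (a - p))) (eq (x - a))
          ; V-add   = λ F G x → interchange (F (x + (a - p))) (G (x + (a - p))) (F (x - a)) (G (x - a))
          ; V-shift = λ F k x → cong₂ _+_ (cong F (swap x (a - p) k)) (cong F (swap x (- a) k))
          }
          where
          interchange : ∀ a b c d → a + b + (c + d) ≡ a + c + (b + d)
          interchange = solve-∀
          swap : ∀ a b c → a + b + c ≡ a + c + b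
          swap = solve-∀
        WD : ∀ x → D (W F) x ≡ W (D F) x
        WD x = sym (trans (V-add W-linear (λ x → F (x + (a - p))) (λ x → F (x - a)) x)
          (cong₂ _+_ (V-shift W-linear F (a - p) x) (V-shift W-linear F (- a) x)))

        -- `(1 + T_p) D = T_(a−p) + T_(−a) + T_a +
        -- T_(p−a)`. On sequences of period `h`, `T_(a−p)` is `T_(−b)` and `T_(p−a)` is `T_b`, so this is `star`.
        D-equation : ∀ x → (F x + F x) + (D F x + D F (x + p)) ≡ 0ℤ
        D-equation x = trans (cong (_+_ (F x + F x)) (cong₂ _+_
            (cong (λ u → u + F (x - a)) (period-≈ F-h (x + (a - p)) (x - b) (divides -1ℤ (lemma₁ x a b (+ h)))))
            (cong₂ _+_ (cong F (lemma₂ x a p)) (period-≈ F-h (x + p - a) (x + b) (divides 1ℤ (lemma₃ x a b (+ h)))))))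
          (trans (lemma₄ (F x) (F (x - b)) (F (x - a)) (F (x + a)) (F (x + b))) (Δg-star p x))
          where
          lemma₁ : ∀ x a b h → x + (a - (a + b + h)) - (x - b) ≡ -1ℤ * h
          lemma₁ = solve-∀
          lemma₂ : ∀ x a p → x + p + (a - p) ≡ x + a
          lemma₂ = solve-∀
          lemma₃ : ∀ x a b h → x + (a + b + h) - a - (x + b) ≡ 1ℤ * h
          lemma₃ = solve-∀
          lemma₄ : ∀ f b₋ a₋ a b → f + f + ((b₋ + a₋) + (a + b)) ≡ f + (f + ((a + a₋) + (b + b₋)))
          lemma₄ = solve-∀

        -- Applying `W`, the inverse of `1 + T_p` up to sign, to `D-equation`.
        average : ∀ x → D F x ≡ W F x + W F x
        average x = by-adding
          (trans (V-inverts W D-linear F WD inverse x) (sym (V-equation W-linear D-equation x)))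
          (trans (cong (λ u → D F x + (u + (W (D F) x + W (λ x → D F (x + p)) x))) (V-add W-linear F F x))
          (trans (cong (λ u → D F x + (W F x + W F x + (W (D F) x + u))) (V-shift W-linear (D F) p x))
                 (lemma (D F x) (W F x) (W (D F) x) (W (D F) (x + p)))))
          where
          lemma : ∀ d w u v → d + (w + w + (u + v)) ≡ w + w + (d + (u + v))
          lemma = solve-∀

        F-2a-p : Period F (a + a - p)
        F-2a-p = averaging⇒period (h ℕ.+ h) {{n≢0}} W-linear p a (Δ-period p g-periodₙ) inverse average

        -- By the period `2 a − p` the two terms of `D F` coincide, so `average` becomes
        -- `T_(−a) F = W F`. Substituted into `inverse`, this says `T_a = −(1 + T_p)` on `F`.
        eqᵃ : ∀ x → F x + (F (x - a) + F (x - a + p)) ≡ 0ℤ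
        eqᵃ x = trans (cong (_+_ (F x)) (cong₂ _+_ (WF x) (trans (cong F (swap x a p)) (WF (x + p))))) (inverse x)
          where
          swap : ∀ x a p → x - a + p ≡ x + p - a
          swap = solve-∀
          lemma₁ : ∀ x a p → x - a - (x + (a - p)) ≡ -1ℤ * (a + a - p)
          lemma₁ = solve-∀
          WF : ∀ x → F (x - a) ≡ W F x
          WF x = double-injective (trans
            (cong (λ u → u + F (x - a)) (period-≈ F-2a-p (x - a) (x + (a - p)) (divides -1ℤ (lemma₁ x a p))))
            (average x))

        -- `T_a = −(1 + T_p)` is used twice, and `T_2a = T_p`; together they give
        -- `T_p = (1 + T_p)²`.
        three-terms : ∀ x → F (x - p) + (F x + F (x + p)) ≡ 0ℤ
        three-terms x = by-adding (trans (cong₂ _+_ (eqᵃ (x - a)) (eqᵃ (x - a + p))) (sym (eqᵃ x)))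
          (trans (lemma (F (x - p)) (F x) (F (x + p)) (F (x - a)) (F (x - a + p)))
                 (cong (_+_ 0ℤ) (cong₂ _+_
                   (cong (_+_ (F (x - a))) (cong₂ _+_ (period-≈ F-2a-p (x - p) (x - a - a) (divides 1ℤ (lemma₁ x a p)))
                                                      (period-≈ F-2a-p x (x - a - a + p) (divides 1ℤ (lemma₂ x a p)))))
                   (cong (_+_ (F (x - a + p))) (cong₂ _+_ (period-≈ F-2a-p x (x - a + p - a) (divides 1ℤ (lemma₃ x a p)))
                                                          (period-≈ F-2a-p (x + p) (x - a + p - a + p) (divides 1ℤ (lemma₄ x a p))))))))
          where
          lemma₁ : ∀ x a p → x - p - (x - a - a) ≡ 1ℤ * (a + a - p)
          lemma₁ = solve-∀
          lemma₂ : ∀ x a p → x - (x - a - a + p) ≡ 1ℤ * (a + a - p)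
          lemma₂ = solve-∀
          lemma₃ : ∀ x a p → x - (x - a + p - a) ≡ 1ℤ * (a + a - p)
          lemma₃ = solve-∀
          lemma₄ : ∀ x a p → x + p - (x - a + p - a + p) ≡ 1ℤ * (a + a - p)
          lemma₄ = solve-∀
          lemma : ∀ f₋ f f₊ u v → f₋ + (f + f₊) + (f + (u + v)) ≡ 0ℤ + ((u + (f₋ + f)) + (v + (f + f₊)))
          lemma = solve-∀

        F-3p : Period F (+ 3 * p)
        F-3p = periodic λ x → by-adding (trans (three-terms (x + p + p)) (sym (three-terms (x + p))))
          (trans (cong (_+_ (F (x + + 3 * p))) (cong (λ u → F u + (F (x + p) + F (x + p + p))) (lemma₁ x p)))
          (trans (lemma (F (x + + 3 * p)) (F x) (F (x + p)) (F (x + p + p)))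
          (cong (_+_ (F x)) (cong₂ (λ u v → F u + (F (x + p + p) + F v)) (lemma₂ x p) (lemma₃ x p)))))
          where
          lemma₁ : ∀ x p → x + p - p ≡ x
          lemma₁ = solve-∀
          lemma₂ : ∀ x p → x + p ≡ x + p + p - p
          lemma₂ = solve-∀
          lemma₃ : ∀ x p → x + + 3 * p ≡ x + p + p + p
          lemma₃ = solve-∀
          lemma : ∀ f₃ f f₁ f₂ → f₃ + (f + (f₁ + f₂)) ≡ f + (f₁ + (f₂ + f₃))
          lemma = solve-∀

        -- On `F`, `T_a = −(1 + T_p)`, which by `three-terms` is `T_p² = T_(−p)`.
        F-a+p : Period F (a + p)
        F-a+p = periodic λ x → by-adding (trans (eqᵃ (x + (a + p))) (sym (three-terms (x + p))))
          (trans (cong (λ u → F (x + (a + p)) + (F u + (F (x + p) + F (x + p + p)))) (lemma₁ x p))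
          (trans (lemma (F (x + (a + p))) (F x) (F (x + p)) (F (x + p + p)))
          (cong (_+_ (F x)) (cong₂ (λ u v → F (x + (a + p)) + (F u + F v)) (lemma₂ x a p) (lemma₃ x a p)))))
          where
          lemma₁ : ∀ x p → x + p - p ≡ x
          lemma₁ = solve-∀
          lemma₂ : ∀ x a p → x + p ≡ x + (a + p) - a
          lemma₂ = solve-∀
          lemma₃ : ∀ x a p → x + p + p ≡ x + (a + p) - a + p
          lemma₃ = solve-∀
          lemma : ∀ u f f₁ f₂ → u + (f + (f₁ + f₂)) ≡ f + (u + (f₁ + f₂))
          lemma = solve-∀

        F-b+p : Period F (b + p)
        F-b+p = subst (Period F) (lemma a b (+ h)) (period-+ (period-+ F-3p (period-neg F-a+p)) (period-neg F-h))
          where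
          lemma : ∀ a b h → + 3 * (a + b + h) + - (a + (a + b + h)) + - h ≡ b + (a + b + h)
          lemma = solve-∀

        -- Three times the Bézout combination is assembled from the periods `a + p`, `b + p` and
        -- `h`; the surplus `3 (α + β) p` is removed by the period `3 p`.
        F-3 : Period F (+ 3)
        F-3 = subst (Period F) (trans (lemma a b p (+ h) α β γ) (cong (_*_ (+ 3)) bézout))
          (period-+ (period-* (period-+ (period-+ (period-* F-a+p α) (period-* F-b+p β)) (period-* F-h γ)) (+ 3))
                    (period-neg (period-* F-3p (α + β))))
          where
          lemma : ∀ a b p h α β γ → + 3 * (α * (a + p) + β * (b + p) + γ * h) + - ((α + β) * (+ 3 * p)) ≡
                                    + 3 * (α * a + β * b + γ * h)
          lemma = solve-∀

        -- With `p` as a period, `three-terms` reads `3 F = 0`. Then `g` has period `p` as `d` does,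
        -- against `n ∤ p`.
        F-p : ¬ Period F p
        F-p pF = n∤p (d+g⇒∣ pd (periodic λ x → ℤ.i-j≡0⇒i≡j _ _ (ℤ.*-cancelˡ-≡ (+ 3) (F x) 0ℤ (trans (lemma (F x)) (trans
          (sym (cong₂ (λ u v → u + (F x + v)) (at (period-neg pF) x) (at pF x))) (three-terms x))))))
          where
          lemma : ∀ f → + 3 * f ≡ f + (f + f)
          lemma = solve-∀

        lemma₉ : ∀ a p → a + p + - a ≡ p
        lemma₉ = solve-∀

  -- Normal forms of the connection set

  ∣-combine₂ : ∀ {m x y} → m ∣ x → m ∣ y → ∀ c d {z} → c * x + d * y ≡ z → m ∣ z
  ∣-combine₂ m∣x m∣y c d refl = ∣m∣n⇒∣m+n (∣n⇒∣m*n c m∣x) (∣n⇒∣m*n d m∣y)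

  ∣-combine₃ : ∀ {m x y w} → m ∣ x → m ∣ y → m ∣ w → ∀ c d e {z} → c * x + d * y + e * w ≡ z → m ∣ z
  ∣-combine₃ m∣x m∣y m∣w c d e refl = ∣m∣n⇒∣m+n (∣-combine₂ m∣x m∣y c d refl) (∣n⇒∣m*n e m∣w)

  ∣-combine₄ : ∀ {m x y w v} → m ∣ x → m ∣ y → m ∣ w → m ∣ v →
               ∀ c d e f {z} → c * x + d * y + e * w + f * v ≡ z → m ∣ z
  ∣-combine₄ m∣x m∣y m∣w m∣v c d e f refl = ∣m∣n⇒∣m+n (∣-combine₃ m∣x m∣y m∣w c d e refl) (∣n⇒∣m*n f m∣v)

  2∤1 : ¬ + 2 ∣ 1ℤ
  2∤1 2∣1 = contradiction (ℕ.∣1⇒≡1 (∣⇒∣ᵤ 2∣1)) λ ()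

  3∤1 : ¬ + 3 ∣ 1ℤ
  3∤1 3∣1 = contradiction (ℕ.∣1⇒≡1 (∣⇒∣ᵤ 3∣1)) λ ()

  mod-2 : ∀ z → + 2 ∣ z ⊎ + 2 ∣ z - 1ℤ
  mod-2 z with parity z
  ... | q , inj₁ refl = inj₁ (divides q (lemma q))
    where
    lemma : ∀ q → q + q ≡ q * + 2
    lemma = solve-∀
  ... | q , inj₂ refl = inj₂ (divides q (lemma q))
    where
    lemma : ∀ q → 1ℤ + (q + q) - 1ℤ ≡ q * + 2
    lemma = solve-∀

  mod-3 : ∀ z → + 3 ∣ z ⊎ + 3 ∣ z - 1ℤ ⊎ + 3 ∣ z + 1ℤ
  mod-3 z = by-remainder (z %ℕ 3) (n%ℕd<d z 3) (a≡a%ℕn+[a/ℕn]*n z 3)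
    where
    q = z /ℕ 3
    lemma₀ : ∀ q → 0ℤ + q * + 3 ≡ q * + 3
    lemma₀ = solve-∀
    lemma₁ : ∀ q → 1ℤ + q * + 3 - 1ℤ ≡ q * + 3
    lemma₁ = solve-∀
    lemma₂ : ∀ q → + 2 + q * + 3 + 1ℤ ≡ (q + 1ℤ) * + 3
    lemma₂ = solve-∀
    by-remainder : ∀ r → r ℕ.< 3 → z ≡ + r + q * + 3 → + 3 ∣ z ⊎ + 3 ∣ z - 1ℤ ⊎ + 3 ∣ z + 1ℤ
    by-remainder 0 _ eq = inj₁ (divides q (trans eq (lemma₀ q)))
    by-remainder 1 _ eq = inj₂ (inj₁ (divides q (trans (cong (_- 1ℤ) eq) (lemma₁ q))))
    by-remainder 2 _ eq = inj₂ (inj₂ (divides (q + 1ℤ) (trans (cong (λ u → u + 1ℤ) eq) (lemma₂ q))))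
    by-remainder (suc (suc (suc r))) (ℕ.s≤s (ℕ.s≤s (ℕ.s≤s ()))) _

  -- Invertibility of `a` modulo `m`, with explicit coefficients so that units modulo the factors of
  -- `n` can be multiplied together.
  Bézout : ℤ → ℤ → Set
  Bézout a m = ∃[ s ] ∃[ t ] s * a + t * m ≡ 1ℤ

  bézout-* : ∀ {a m m′} → Bézout a m → Bézout a m′ → Bézout a (m * m′)
  bézout-* {a} {m} {m′} (s , t , eq) (s′ , t′ , eq′) =
    s * s′ * a + s * t′ * m′ + t * s′ * m , t * t′ ,
    trans (lemma a m m′ s t s′ t′) (cong₂ _*_ eq eq′)
    where
    lemma : ∀ a m m′ s t s′ t′ → (s * s′ * a + s * t′ * m′ + t * s′ * m) * a + t * t′ * (m * m′) ≡ (s * a + t * m) * (s′ * a + t′ * m′)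
    lemma = solve-∀

  bézout-2 : ∀ {a} → + 2 ∣ a - 1ℤ → Bézout a (+ 2)
  bézout-2 {a} (divides q eq) = 1ℤ , - q , by-adding eq (lemma a q)
    where
    lemma : ∀ a q → 1ℤ * a + - q * + 2 + q * + 2 ≡ 1ℤ + (a - 1ℤ)
    lemma = solve-∀

  bézout-3 : ∀ {a} → ¬ + 3 ∣ a → Bézout a (+ 3)
  bézout-3 {a} 3∤a with mod-3 a
  ... | inj₁ 3∣a = contradiction 3∣a 3∤a
  ... | inj₂ (inj₁ (divides q eq)) = 1ℤ , - q , by-adding eq (lemma a q)
    where
    lemma : ∀ a q → 1ℤ * a + - q * + 3 + q * + 3 ≡ 1ℤ + (a - 1ℤ)
    lemma = solve-∀
  ... | inj₂ (inj₂ (divides q eq)) = -1ℤ , q , by-adding (sym eq) (lemma a q)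
    where
    lemma : ∀ a q → -1ℤ * a + q * + 3 + (a + 1ℤ) ≡ 1ℤ + q * + 3
    lemma = solve-∀

  odd-order⇒even : ∀ h {y} → OddOrder (h + h) y → + 2 ∣ y
  odd-order⇒even h {y} (k , divides q eq) = divides (q * h - + k * y) (by-adding eq (lemma (+ k) y q h))
    where
    lemma : ∀ k y q h → y + q * (h + h) ≡ (q * h - k * y) * + 2 + (1ℤ + (k + k)) * y
    lemma = solve-∀

  odd⇒¬even : ∀ {z} → + 2 ∣ z - 1ℤ → ¬ + 2 ∣ z
  odd⇒¬even {z} odd even = 2∤1 (∣-combine₂ even odd 1ℤ -1ℤ (lemma z))
    where
    lemma : ∀ z → 1ℤ * z + -1ℤ * (z - 1ℤ) ≡ 1ℤ
    lemma = solve-∀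

  twice-odd-%4 : ∀ h → + 2 ∣ + h - 1ℤ → (h ℕ.+ h) ℕ.% 4 ≡ 2
  twice-odd-%4 h odd with parityℕ h
  ... | j , inj₁ refl = contradiction (divides (+ j) (lemma (+ j))) (odd⇒¬even odd)
    where
    lemma : ∀ j → j + j ≡ j * + 2
    lemma = solve-∀
  ... | j , inj₂ refl = trans (cong (ℕ._% 4) (lemma j)) (ℕ.[m+kn]%n≡m%n 2 j 4)
    where
    lemma : ∀ j → suc (j ℕ.+ j) ℕ.+ suc (j ℕ.+ j) ≡ 2 ℕ.+ j ℕ.* 4
    lemma = ℕSolver.solve-∀

  square∸1 : ∀ c → 1 ℕ.< c → + (c ℕ.^ 2 ℕ.∸ 1) ≡ + c * + c - 1ℤ
  square∸1 c@(suc c′) _ = trans (lemma₁ (+ (c ℕ.^ 2 ℕ.∸ 1))) (cong (_- 1ℤ) (trans (cong +_ (lemma₂ c′)) (ℤ.pos-* c c)))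
    where
    lemma₁ : ∀ c → c ≡ 1ℤ + c - 1ℤ
    lemma₁ = solve-∀
    lemma₂ : ∀ c → suc c ℕ.* (suc c ℕ.* 1) ≡ suc c ℕ.* suc c
    lemma₂ = ℕSolver.solve-∀

  fold : ∀ h .{{_ : ℕ.NonZero h}} z → ∃[ c ] c ℕ.≤ h × (+ h + + h ∣ z - + c ⊎ + h + + h ∣ z + + c)
  fold h@(suc _) z = by-size (ℕ.≤-total r h)
    where
    r = z %ℕ (h ℕ.+ h)
    q = z /ℕ (h ℕ.+ h)
    n = + h + + h
    r<n = n%ℕd<d z (h ℕ.+ h)
    lemma₁ : ∀ r m → r + m - r ≡ m
    lemma₁ = solve-∀
    lemma₂ : ∀ r q n → r + q * n + (n - r) ≡ (q + 1ℤ) * n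
    lemma₂ = solve-∀
    by-size : r ℕ.≤ h ⊎ h ℕ.≤ r → ∃[ c ] c ℕ.≤ h × (n ∣ z - + c ⊎ n ∣ z + + c)
    by-size (inj₁ r≤h) = r , r≤h , inj₁ (divides q (trans (cong (_- + r) (a≡a%ℕn+[a/ℕn]*n z (h ℕ.+ h))) (lemma₁ (+ r) (q * n))))
    by-size (inj₂ h≤r) = (h ℕ.+ h) ℕ.∸ r ,
      ℕ.≤-trans (ℕ.∸-monoʳ-≤ (h ℕ.+ h) h≤r) (ℕ.≤-reflexive (ℕ.m+n∸n≡m h h)) ,
      inj₂ (divides (q + 1ℤ) (trans (cong₂ _+_ (a≡a%ℕn+[a/ℕn]*n z (h ℕ.+ h))
        (trans (sym (ℤ.⊖-≥ (ℕ.<⇒≤ r<n))) (sym (ℤ.[+m]-[+n]≡m⊖n (h ℕ.+ h) r)))) (lemma₂ (+ r) q n)))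

  2-power : ∀ σ .{{_ : ℕ.NonZero σ}} → ∃[ e ] ∃[ s ] (σ ≡ 2 ℕ.^ e ℕ.* s) × (+ 2 ∣ + s - 1ℤ)
  2-power σ = <-rec _ search σ (ℕ.≢-nonZero⁻¹ σ)
    where
    lemma₁ : ∀ k → 1ℤ + (k + k) - 1ℤ ≡ k * + 2
    lemma₁ = solve-∀
    lemma₂ : ∀ p s → p ℕ.* s ℕ.+ p ℕ.* s ≡ 2 ℕ.* p ℕ.* s
    lemma₂ = ℕSolver.solve-∀
    search : ∀ σ → (∀ {k} → k ℕ.< σ → k ≢ 0 → ∃[ e ] ∃[ s ] (k ≡ 2 ℕ.^ e ℕ.* s) × (+ 2 ∣ + s - 1ℤ)) →
             σ ≢ 0 → ∃[ e ] ∃[ s ] (σ ≡ 2 ℕ.^ e ℕ.* s) × (+ 2 ∣ + s - 1ℤ)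
    search σ rec σ≢0 with parityℕ σ
    ... | k , inj₂ refl = 0 , σ , sym (ℕ.+-identityʳ σ) , divides (+ k) (lemma₁ (+ k))
    ... | zero , inj₁ refl = contradiction refl σ≢0
    ... | k@(suc _) , inj₁ refl with rec (ℕ.m<m+n k ℕ.z<s) (λ ())
    ...   | e , s , eq , odd = suc e , s , trans (cong₂ ℕ._+_ eq eq) (lemma₂ (2 ℕ.^ e) s) , odd

  pos-^ : ∀ m e → + (m ℕ.^ e) ≡ (+ m) ^ e
  pos-^ m zero    = refl
  pos-^ m (suc e) = trans (ℤ.pos-* m (m ℕ.^ e)) (cong (_*_ (+ m)) (pos-^ m e))

  -1^ : ∀ t → -1ℤ ^ t ≡ 1ℤ ⊎ -1ℤ ^ t ≡ -1ℤ
  -1^ zero = inj₁ refl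
  -1^ (suc t) with -1^ t
  ... | inj₁ eq = inj₂ (cong (_*_ -1ℤ) eq)
  ... | inj₂ eq = inj₁ (cong (_*_ -1ℤ) eq)

  2^-mod-3 : ∀ t → + 3 ∣ (+ 2) ^ t - -1ℤ ^ t
  2^-mod-3 zero = divides 0ℤ refl
  2^-mod-3 (suc t) = ∣-combine₂ (2^-mod-3 t) (∣-refl {+ 3}) (+ 2) (-1ℤ ^ t) (lemma ((+ 2) ^ t) (-1ℤ ^ t))
    where
    lemma : ∀ x y → + 2 * (x - y) + y * + 3 ≡ + 2 * x - -1ℤ * y
    lemma = solve-∀

  odd-mod-6 : ∀ s → + 2 ∣ + s - 1ℤ → ∀ {ε} → ε ≡ 1ℤ ⊎ ε ≡ -1ℤ → + 3 ∣ + s - ε → ∃[ k ] + s ≡ + 6 * + k + ε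
  odd-mod-6 s odd {ε} sign 3∣ = from-quotients (2∣ sign) 3∣
    where
    2∣ : ε ≡ 1ℤ ⊎ ε ≡ -1ℤ → + 2 ∣ + s - ε
    2∣ (inj₁ refl) = odd
    2∣ (inj₂ refl) = ∣-combine₂ odd (∣-refl {+ 2}) 1ℤ 1ℤ (lemma (+ s))
      where
      lemma : ∀ s → 1ℤ * (s - 1ℤ) + 1ℤ * + 2 ≡ s - -1ℤ
      lemma = solve-∀
    nonnegative : ε ≡ 1ℤ ⊎ ε ≡ -1ℤ → ∀ k → + s ≡ + 6 * k + ε → ∃[ k ] + s ≡ + 6 * + k + ε
    nonnegative _ (+ k) eq = k , eq
    -- A negative quotient means `s = −(5 + 6 m)`, or `−(7 + 6 m)` for the other sign; adding this
    -- amount back gives a sum of naturals that is zero although one summand is positive.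
    nonnegative (inj₁ refl) -[1+ m ] eq = contradiction (ℤ.+-injective (trans (cong (λ u → u + + (5 ℕ.+ 6 ℕ.* m)) eq)
      (trans (cong (λ u → + 6 * - (1ℤ + + m) + 1ℤ + (+ 5 + u)) (ℤ.pos-* 6 m)) (lemma (+ m))))) λ eq → ℕ.1+n≢0 (ℕ.m+n≡0⇒n≡0 s eq)
      where
      lemma : ∀ m → + 6 * - (1ℤ + m) + 1ℤ + (+ 5 + + 6 * m) ≡ 0ℤ
      lemma = solve-∀
    nonnegative (inj₂ refl) -[1+ m ] eq = contradiction (ℤ.+-injective (trans (cong (λ u → u + + (7 ℕ.+ 6 ℕ.* m)) eq)
      (trans (cong (λ u → + 6 * - (1ℤ + + m) + -1ℤ + (+ 7 + u)) (ℤ.pos-* 6 m)) (lemma (+ m))))) λ eq → ℕ.1+n≢0 (ℕ.m+n≡0⇒n≡0 s eq)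
      where
      lemma : ∀ m → + 6 * - (1ℤ + m) + -1ℤ + (+ 7 + + 6 * m) ≡ 0ℤ
      lemma = solve-∀
    from-quotients : + 2 ∣ + s - ε → + 3 ∣ + s - ε → ∃[ k ] + s ≡ + 6 * + k + ε
    -- `s − ε` is three times itself minus twice itself: `3 (2 x) − 2 (3 y) = 6 (x − y)`.
    from-quotients (divides x eq₂) (divides y eq₃) = nonnegative sign (x - y)
      (by-adding (cong₂ (λ u v → + 3 * u - + 2 * v) eq₂ eq₃) (lemma (+ s) ε x y))
      where
      lemma : ∀ s ε x y → s + (+ 3 * (x * + 2) - + 2 * (y * + 3)) ≡ + 6 * (x - y) + ε + (+ 3 * (s - ε) - + 2 * (s - ε))
      lemma = solve-∀

  module NormalForm (h : ℕ) .{{h≢0 : ℕ.NonZero h}} where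

    private n = + h + + h

    Cases : ℕ → Set
    Cases c = CaseI (h ℕ.+ h) c ⊎ CaseII (h ℕ.+ h) c ⊎ CaseIII (h ℕ.+ h) c ⊎ CaseIV (h ℕ.+ h) c

    record Distinct (a b : ℤ) : Set where
      field
        a≢0  : ¬ n ∣ a
        b≢0  : ¬ n ∣ b
        a≢b  : ¬ n ∣ a - b
        a≢-b : ¬ n ∣ a + b

    -- Multiplication by `u` carries `±a, ±b, h` to `±1, ±c, h` modulo `n`. It fixes `h` because a
    -- unit modulo the even number `n = 2 h` is odd.
    Normal : ℤ → ℤ → Set
    Normal a b = ∃[ u ] ∃[ c ] (n ∣ u * a - 1ℤ) × (n ∣ u * b - + c ⊎ n ∣ u * b + + c) ×
                 1 ℕ.< c × c ℕ.< h × Cases c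

    1<multiplier : ∀ {a b} u c → Distinct a b → n ∣ u * a - 1ℤ → n ∣ u * b - + c ⊎ n ∣ u * b + + c → 1 ℕ.< c
    1<multiplier {a} {b} u 0 dis ua (inj₁ ub) = contradiction (∣-combine₂ ua ub (- b) a (lemma a b u)) (Distinct.b≢0 dis)
      where
      lemma : ∀ a b u → - b * (u * a - 1ℤ) + a * (u * b - 0ℤ) ≡ b
      lemma = solve-∀
    1<multiplier {a} {b} u 0 dis ua (inj₂ ub) = contradiction (∣-combine₂ ua ub (- b) a (lemma a b u)) (Distinct.b≢0 dis)
      where
      lemma : ∀ a b u → - b * (u * a - 1ℤ) + a * (u * b + 0ℤ) ≡ b
      lemma = solve-∀
    1<multiplier {a} {b} u 1 dis ua (inj₁ ub) = contradiction (∣-combine₂ ua ub b (- a) (lemma a b u)) (Distinct.a≢b dis)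
      where
      lemma : ∀ a b u → b * (u * a - 1ℤ) + - a * (u * b - 1ℤ) ≡ a - b
      lemma = solve-∀
    1<multiplier {a} {b} u 1 dis ua (inj₂ ub) = contradiction (∣-combine₂ ua ub (- b) a (lemma a b u)) (Distinct.a≢-b dis)
      where
      lemma : ∀ a b u → - b * (u * a - 1ℤ) + a * (u * b + 1ℤ) ≡ a + b
      lemma = solve-∀
    1<multiplier _ (suc (suc c)) _ _ _ = ℕ.s≤s (ℕ.s≤s ℕ.z≤n)

    n/2≡h : (h ℕ.+ h) ℕ./ 2 ≡ h
    n/2≡h = trans (cong (ℕ._/ 2) (lemma h)) (ℕ.m*n/n≡m h 2)
      where
      lemma : ∀ h → h ℕ.+ h ≡ h ℕ.* 2
      lemma = ℕSolver.solve-∀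

    2*h : + h * + 2 ≡ n
    2*h = lemma (+ h)
      where
      lemma : ∀ h → h * + 2 ≡ h + h
      lemma = solve-∀

    2∣n : + 2 ∣ n
    2∣n = divides (+ h) (sym 2*h)

    inverse-odd : ∀ {u a} → n ∣ u * a - 1ℤ → + 2 ∣ u - 1ℤ
    inverse-odd {u} {a} n∣ with mod-2 u
    ... | inj₂ odd  = odd
    ... | inj₁ even = contradiction (∣-combine₂ even (∣-trans 2∣n n∣) a -1ℤ (lemma u a)) 2∤1
      where
      lemma : ∀ u a → a * u + -1ℤ * (u * a - 1ℤ) ≡ 1ℤ
      lemma = solve-∀

    bézout⇒inverse : ∀ {a} → Bézout a n → ∃[ u ] n ∣ u * a - 1ℤ
    bézout⇒inverse {a} (u , t , eq) = u , divides (- t) (by-adding eq (lemma u a t n))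
      where
      lemma : ∀ u a t n → u * a - 1ℤ + 1ℤ ≡ - t * n + (u * a + t * n)
      lemma = solve-∀

    module _ {a b} (dis : Distinct a b) where

      private p = a + b + + h

      h∣n : + h ∣ n
      h∣n = divides (+ 2) (trans (sym 2*h) (ℤ.*-comm (+ h) (+ 2)))

      -- Modulo `h` one has `b = −a`, so the generating relation makes `a` a unit modulo `h`; being
      -- odd, `a` is a unit modulo `2 h`. As `u` is odd, `u b = u p − u a − u h` is congruent to
      -- `h − 1`.
      caseI : n ∣ p → (∃[ α ] ∃[ β ] ∃[ γ ] α * a + β * b + γ * + h ≡ 1ℤ) → + 2 ∣ a - 1ℤ → Normal a b
      caseI n∣p (α , β , γ , bézout) odd = from-inverse (bézout⇒inverse (subst (Bézout a) 2*h (bézout-* (a-h h∣) (bézout-2 odd))))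
        where
        h∣ : + h ∣ a + b
        h∣ = ∣-combine₂ (∣-trans h∣n n∣p) (∣-refl {+ h}) 1ℤ -1ℤ (lemma a b (+ h))
          where
          lemma : ∀ a b h → 1ℤ * (a + b + h) + -1ℤ * h ≡ a + b
          lemma = solve-∀
        a-h : + h ∣ a + b → Bézout a (+ h)
        a-h (divides q eq) = α - β , β * q + γ , trans (by-adding (cong (_*_ β) (sym eq)) (lemma a b (+ h) α β γ q)) bézout
          where
          lemma : ∀ a b h α β γ q → (α - β) * a + (β * q + γ) * h + β * (a + b) ≡ α * a + β * b + γ * h + β * (q * h)
          lemma = solve-∀
        c = h ℕ.∸ 1
        +c : + c ≡ + h - 1ℤ
        +c = trans (lemma (+ c)) (cong (λ u → u - 1ℤ) (cong +_ (ℕ.suc-pred h)))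
          where
          lemma : ∀ c → c ≡ 1ℤ + c - 1ℤ
          lemma = solve-∀
        from-inverse : ∃[ u ] n ∣ u * a - 1ℤ → Normal a b
        from-inverse (u , ua) = u , c , ua , inj₁ (ub (inverse-odd {u} {a} ua)) , 1<multiplier u c dis ua (inj₁ (ub (inverse-odd {u} {a} ua))) ,
            ℕ.≤-reflexive (ℕ.suc-pred h) , inj₁ (cong (ℕ._∸ 1) (sym n/2≡h))
          where
          ub : + 2 ∣ u - 1ℤ → n ∣ u * b - + c
          ub (divides x eq) = ∣-combine₃ ua n∣p (∣-refl {n}) -1ℤ u (- x - 1ℤ)
            (trans (by-adding (cong (_* + h) eq) (lemma a b u (+ h) x)) (cong (λ v → u * b - v) (sym +c)))
            where
            lemma : ∀ a b u h x → -1ℤ * (u * a - 1ℤ) + u * (a + b + h) + (- x - 1ℤ) * (h + h) + x * + 2 * h ≡ u * b - (h - 1ℤ) + (u - 1ℤ) * h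
            lemma = solve-∀

      -- `p q = (a + h)² − b²`, so `a² = b²` modulo `h`, and scaling by `u` turns this into `c² = 1`
      -- modulo `h`. The parity of `c` then decides that the multiple is odd.
      caseII : (∃[ α ] ∃[ β ] ∃[ γ ] α * a + β * b + γ * + h ≡ 1ℤ) → + 2 ∣ + h - 1ℤ → n ∣ p * (a - b + + h) →
               + 2 ∣ a - 1ℤ → + 2 ∣ b → Normal a b
      caseII (α , β , γ , bézout) h-odd n∣pq a-odd b-even = from-inverse (bézout⇒inverse (subst (Bézout a) 2*h (bézout-* (a-h n∣pq) (bézout-2 a-odd))))
        where
        a-h : n ∣ p * (a - b + + h) → Bézout a (+ h)
        -- Square the generating relation and replace `b²` by `a²` modulo `h`; what remains is `a`
        -- times the first witness.
        a-h (divides z eq) = α * α * a + + 2 * α * β * b + β * β * a ,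
          - β * β * (z * + 2 - (+ 2 * a + + h)) + γ * (+ 2 * α * a + + 2 * β * b + γ * + h) ,
          trans (by-adding (cong (_*_ (β * β)) eq) (lemma a b (+ h) α β γ z)) (cong (λ u → u * u) bézout)
          where
          lemma : ∀ a b h α β γ z →
            (α * α * a + + 2 * α * β * b + β * β * a) * a + (- β * β * (z * + 2 - (+ 2 * a + h)) + γ * (+ 2 * α * a + + 2 * β * b + γ * h)) * h
              + β * β * (z * (h + h))
            ≡ (α * a + β * b + γ * h) * (α * a + β * b + γ * h) + β * β * ((a + b + h) * (a - b + h))
          lemma = solve-∀
        from-inverse : ∃[ u ] n ∣ u * a - 1ℤ → Normal a b
        from-inverse (u , ua) = from-fold (fold h (u * b))
         where
         from-fold : ∃[ c ] c ℕ.≤ h × (n ∣ u * b - + c ⊎ n ∣ u * b + + c) → Normal a b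
         from-fold (c , c≤h , ub) = u , c , ua , ub , 1<c , ℕ.≤∧≢⇒< c≤h c≢h , inj₂ (inj₁ (twice-odd-%4 h h-odd , ∣⇒∣ᵤ c-even , odd-multiple (∣⇒∣ᵤ (subst (+ h ∣_) (sym (square∸1 c 1<c)) h∣c²-1))))
           where
           1<c : 1 ℕ.< c
           1<c = 1<multiplier u c dis ua ub
           c-even′ : n ∣ u * b - + c ⊎ n ∣ u * b + + c → + 2 ∣ + c
           c-even′ (inj₁ ub₁) = ∣-combine₂ b-even (∣-trans 2∣n ub₁) u -1ℤ (lemma u b (+ c))
             where
             lemma : ∀ u b c → u * b + -1ℤ * (u * b - c) ≡ c
             lemma = solve-∀
           c-even′ (inj₂ ub₂) = ∣-combine₂ b-even (∣-trans 2∣n ub₂) (- u) 1ℤ (lemma u b (+ c))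
             where
             lemma : ∀ u b c → - u * b + 1ℤ * (u * b + c) ≡ c
             lemma = solve-∀
           c-even = c-even′ ub
           c≢h : c ≢ h
           c≢h c≡h = odd⇒¬even h-odd (subst (λ m → + 2 ∣ + m) c≡h c-even)
           ub² : n ∣ u * b - + c ⊎ n ∣ u * b + + c → n ∣ (u * b - + c) * (u * b + + c)
           ub² (inj₁ ub₁) = ∣m⇒∣m*n (u * b + + c) ub₁
           ub² (inj₂ ub₂) = ∣n⇒∣m*n (u * b - + c) ub₂
           h∣c²-1 : + h ∣ + c * + c - 1ℤ
           h∣c²-1 = ∣-combine₄ (∣-trans h∣n (ub² ub)) (∣-trans h∣n n∣pq) (∣-trans h∣n ua) (∣-refl {+ h})
             -1ℤ (- u * u) (u * a + 1ℤ) (u * u * (+ 2 * a + + h)) (lemma a b u (+ h) (+ c))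
             where
             lemma : ∀ a b u h c → -1ℤ * ((u * b - c) * (u * b + c)) + - u * u * ((a + b + h) * (a - b + h)) + (u * a + 1ℤ) * (u * a - 1ℤ)
                       + u * u * (+ 2 * a + h) * h ≡ c * c - 1ℤ
             lemma = solve-∀
           odd-multiple : h ℕ.∣ c ℕ.^ 2 ℕ.∸ 1 → OddMultiple (2 ℕ.* (c ℕ.^ 2 ℕ.∸ 1)) (h ℕ.+ h)
           odd-multiple (ℕ.divides m eq) = by-parity (parityℕ m)
             where
             lemma₁ : ∀ j h → 2 ℕ.* (suc (j ℕ.+ j) ℕ.* h) ≡ (1 ℕ.+ 2 ℕ.* j) ℕ.* (h ℕ.+ h)
             lemma₁ = ℕSolver.solve-∀
             lemma₂ : ∀ j h → (j ℕ.+ j) ℕ.* h ≡ j ℕ.* h ℕ.* 2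
             lemma₂ = ℕSolver.solve-∀
             lemma₃ : ∀ c → c * c + -1ℤ * (c * c - 1ℤ) ≡ 1ℤ
             lemma₃ = solve-∀
             by-parity : ∃[ j ] (m ≡ j ℕ.+ j ⊎ m ≡ suc (j ℕ.+ j)) → OddMultiple (2 ℕ.* (c ℕ.^ 2 ℕ.∸ 1)) (h ℕ.+ h)
             by-parity (j , inj₂ m≡) = j , trans (cong (2 ℕ.*_) (trans eq (cong (ℕ._* h) m≡))) (lemma₁ j h)
             -- An even cofactor would make `c² − 1` even, while `c` is even.
             by-parity (j , inj₁ m≡) = contradiction
               (∣-combine₂ c-even (subst (+ 2 ∣_) (square∸1 c 1<c) (∣ᵤ⇒∣ {+ 2} {+ (c ℕ.^ 2 ℕ.∸ 1)} (ℕ.divides (j ℕ.* h) (trans eq (trans (cong (ℕ._* h) m≡) (lemma₂ j h))))))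
                 (+ c) -1ℤ (lemma₃ (+ c))) 2∤1

      -- Write `3 p = m n`. Since `n ∤ p`, `3 ∤ m`, hence `h = 3 σ`, `n = 6 σ` and `p = 2 m σ`. With
      -- `m ≡ μ` modulo 3 and an inverse `u ≡ η` of `a` modulo 6, both `±1`, this gives
      -- `u b ≡ δ σ − 1` for `δ = −μ η`, so `c` is `σ − 1` or `σ + 1`.
      caseIII-IV : (∃[ α ] ∃[ β ] ∃[ γ ] α * a + β * b + γ * + h ≡ 1ℤ) → + 2 ∣ + h → + 2 ∣ p → ¬ n ∣ p → n ∣ + 3 * p →
                   ¬ + 3 ∣ p → ¬ + 3 ∣ a → ¬ + 3 ∣ b → Normal a b
      caseIII-IV (α , β , γ , bézout) 2∣h 2∣p n∤p n∣3p 3∤p 3∤a 3∤b = from-quotients 2∣p n∣3p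
        where
        a-odd : + 2 ∣ a - 1ℤ
        a-odd = by-parity (mod-2 a)
          where
          lemma : ∀ a b h α β γ → (α - β) * a + (γ - β) * h + β * (a + b + h) ≡ α * a + β * b + γ * h
          lemma = solve-∀
          by-parity : + 2 ∣ a ⊎ + 2 ∣ a - 1ℤ → + 2 ∣ a - 1ℤ
          by-parity (inj₂ odd)  = odd
          by-parity (inj₁ even) = contradiction (∣-combine₃ even 2∣h 2∣p (α - β) (γ - β) β (trans (lemma a b (+ h) α β γ) bézout)) 2∤1

        module _ (σ : ℕ) (h≡ : + h ≡ + σ * + 3) (m : ℤ) (p≡ : p ≡ + 2 * m * + σ) (μ : ℤ) (μ-sign : μ ≡ 1ℤ ⊎ μ ≡ -1ℤ) (3∣m-μ : + 3 ∣ m - μ) where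

          n≡ : n ≡ + 6 * + σ
          n≡ = trans (cong₂ _+_ h≡ h≡) (lemma (+ σ))
            where
            lemma : ∀ σ → σ * + 3 + σ * + 3 ≡ + 6 * σ
            lemma = solve-∀

          -- `a + b = p − h = (2 m − 3) σ`, and `2 m − 3 ≡ −μ` modulo 6 when `m ≡ μ` modulo 3.
          a+b : n ∣ a + b + μ * + σ
          a+b = subst (_∣ a + b + μ * + σ) (sym n≡) (by-sign μ-sign 3∣m-μ)
            where
            a+b≡ : a + b ≡ + 2 * m * + σ - + σ * + 3
            a+b≡ = trans (lemma a b (+ h)) (cong₂ _-_ p≡ h≡)
              where
              lemma : ∀ a b h → a + b ≡ a + b + h - h
              lemma = solve-∀
            by-sign : μ ≡ 1ℤ ⊎ μ ≡ -1ℤ → + 3 ∣ m - μ → + 6 * + σ ∣ a + b + μ * + σ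
            by-sign (inj₁ refl) (divides l eq) = divides l (trans (cong (λ u → u + 1ℤ * + σ) a+b≡)
              (by-adding (cong (λ u → + 2 * u * + σ) eq) (lemma (+ σ) m l)))
              where
              lemma : ∀ σ m l → + 2 * m * σ - σ * + 3 + 1ℤ * σ + + 2 * (l * + 3) * σ ≡ l * (+ 6 * σ) + + 2 * (m - 1ℤ) * σ
              lemma = solve-∀
            by-sign (inj₂ refl) (divides l eq) = divides (l - 1ℤ) (trans (cong (λ u → u + -1ℤ * + σ) a+b≡)
              (by-adding (cong (λ u → + 2 * u * + σ) eq) (lemma (+ σ) m l)))
              where
              lemma : ∀ σ m l → + 2 * m * σ - σ * + 3 + -1ℤ * σ + + 2 * (l * + 3) * σ ≡ (l - 1ℤ) * (+ 6 * σ) + + 2 * (m - -1ℤ) * σ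
              lemma = solve-∀

          3∤σ : ¬ + 3 ∣ + σ
          3∤σ 3∣σ = 3∤p (subst (+ 3 ∣_) (sym p≡) (∣n⇒∣m*n (+ 2 * m) 3∣σ))

          2∣σ : + 2 ∣ + σ
          2∣σ = ∣-combine₂ 2∣h (∣-refl {+ 2}) 1ℤ (- + σ) (trans (cong (λ u → 1ℤ * u + - + σ * + 2) h≡) (lemma (+ σ)))
            where
            lemma : ∀ σ → 1ℤ * (σ * + 3) + - σ * + 2 ≡ σ
            lemma = solve-∀

          instance
            σ≢0 : ℕ.NonZero σ
            σ≢0 = ℕ.≢-nonZero λ σ≡0 → 3∤σ (subst (λ u → + 3 ∣ + u) (sym σ≡0) (divides 0ℤ refl))

          -- The factors `σ`, `2` and `3` of `n` are treated one at a time. Modulo `σ` both `a + b`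
          -- and `h` vanish, so the generating relation leaves a multiple of `a`.
          a-n : Bézout a n
          a-n = subst (Bézout a) (trans (lemma (+ σ)) (sym n≡)) (bézout-* (a-σ a+b) (bézout-* (bézout-2 a-odd) (bézout-3 3∤a)))
            where
            lemma : ∀ σ → σ * (+ 2 * + 3) ≡ + 6 * σ
            lemma = solve-∀
            lemma₂ : ∀ a b α β γ μ σ k → (α - β) * a + (β * (k * + 6 - μ) + γ * + 3) * σ + β * (a + b + μ * σ) ≡
                     α * a + β * b + γ * (σ * + 3) + β * (k * (+ 6 * σ))
            lemma₂ = solve-∀
            a-σ : n ∣ a + b + μ * + σ → Bézout a (+ σ)
            a-σ (divides k eq) = α - β , β * (k * + 6 - μ) + γ * + 3 ,
              trans (by-adding (cong (_*_ β) (sym (trans eq (cong (_*_ k) n≡)))) (lemma₂ a b α β γ μ (+ σ) k))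
                    (trans (cong (λ u → α * a + β * b + γ * u) (sym h≡)) bézout)

          module _ (u : ℤ) (ua : n ∣ u * a - 1ℤ) where

            3∣n : + 3 ∣ n
            3∣n = divides (+ 2 * + σ) (trans n≡ (lemma (+ σ)))
              where
              lemma : ∀ σ → + 6 * σ ≡ + 2 * σ * + 3
              lemma = solve-∀

            3∤ub : ¬ + 3 ∣ u * b
            3∤ub 3∣ub = 3∤b (∣-combine₂ 3∣ub (∣-trans 3∣n ua) a (- b) (lemma a b u))
              where
              lemma : ∀ a b u → a * (u * b) + - b * (u * a - 1ℤ) ≡ b
              lemma = solve-∀

            -- An inverse modulo `n = 6 σ` is prime to 6, hence `±1` modulo 6; multiplied by `σ`,
            -- this becomes a congruence modulo `n`.
            u-mod-6 : ∃[ η ] (η ≡ 1ℤ ⊎ η ≡ -1ℤ) × (n ∣ u * + σ - η * + σ)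
            u-mod-6 = by-remainder (mod-3 u)
              where
              lift : ∀ η → + 2 ∣ u - η → + 3 ∣ u - η → n ∣ u * + σ - η * + σ
              lift η (divides x eq₂) (divides y eq₃) = divides (x - y) (trans
                (by-adding (cong₂ (λ v w → + 3 * v * + σ - + 2 * w * + σ) eq₂ eq₃) (lemma u η (+ σ) x y))
                (cong (_*_ (x - y)) (sym n≡)))
                where
                lemma : ∀ u η σ x y → u * σ - η * σ + (+ 3 * (x * + 2) * σ - + 2 * (y * + 3) * σ) ≡
                                      (x - y) * (+ 6 * σ) + (+ 3 * (u - η) * σ - + 2 * (u - η) * σ)
                lemma = solve-∀
              lemma₁ : ∀ u a → a * u + -1ℤ * (u * a - 1ℤ) ≡ 1ℤ
              lemma₁ = solve-∀
              lemma₂ : ∀ u → 1ℤ * (u - 1ℤ) + 1ℤ * + 2 ≡ u - -1ℤ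
              lemma₂ = solve-∀
              by-remainder : + 3 ∣ u ⊎ + 3 ∣ u - 1ℤ ⊎ + 3 ∣ u + 1ℤ → ∃[ η ] (η ≡ 1ℤ ⊎ η ≡ -1ℤ) × (n ∣ u * + σ - η * + σ)
              by-remainder (inj₁ 3∣u) = contradiction (∣-combine₂ 3∣u (∣-trans 3∣n ua) a -1ℤ (lemma₁ u a)) 3∤1
              by-remainder (inj₂ (inj₁ 3∣)) = 1ℤ , inj₁ refl , lift 1ℤ (inverse-odd {u} {a} ua) 3∣
              by-remainder (inj₂ (inj₂ 3∣)) = -1ℤ , inj₂ refl ,
                lift -1ℤ (∣-combine₂ (inverse-odd {u} {a} ua) (∣-refl {+ 2}) 1ℤ 1ℤ (lemma₂ u)) 3∣

            Shape : ℤ → Set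
            Shape δ = ∃[ t ] ∃[ k ] 2 ℕ.≤ t × + σ ≡ (+ 2) ^ (t ℕ.∸ 1) * (+ 6 * + k + δ * -1ℤ ^ t) ×
                      n ≡ + 3 * (+ 2) ^ t * (+ 6 * + k + δ * -1ℤ ^ t)

            -- With ω = (−1)ᵗ and 2σ = 2ᵗs, the congruence σ ≡ −δ (mod 3) reads s ≡ δω.
            module _ (δ : ℤ) (δ-sign : δ ≡ 1ℤ ⊎ δ ≡ -1ℤ) (3∣σ+δ : + 3 ∣ + σ + δ) where

              shape : Shape δ
              shape = from-power (2-power σ)
                where
                from-power : ∃[ e ] ∃[ s ] (σ ≡ 2 ℕ.^ e ℕ.* s) × (+ 2 ∣ + s - 1ℤ) → Shape δ
                -- Evenness of `σ` excludes exponent `0`; this is the source of `t ≥ 2`.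
                from-power (zero , s , eq , odd) = contradiction
                  (subst (λ u → + 2 ∣ + u) (trans eq (ℕ.+-identityʳ s)) 2∣σ) (odd⇒¬even odd)
                from-power (e@(suc e′) , s , eq , odd) = finish (odd-mod-6 s odd (sign δ-sign (-1^ t)) 3∣s-δω)
                  where
                  t = suc e
                  ω = -1ℤ ^ t
                  σ≡ : + σ ≡ (+ 2) ^ e * + s
                  σ≡ = trans (cong +_ eq) (trans (ℤ.pos-* (2 ℕ.^ e) s) (cong (_* + s) (pos-^ 2 e)))
                  sign : δ ≡ 1ℤ ⊎ δ ≡ -1ℤ → ω ≡ 1ℤ ⊎ ω ≡ -1ℤ → δ * ω ≡ 1ℤ ⊎ δ * ω ≡ -1ℤ
                  sign (inj₁ d) (inj₁ w) = inj₁ (cong₂ _*_ d w)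
                  sign (inj₁ d) (inj₂ w) = inj₂ (cong₂ _*_ d w)
                  sign (inj₂ d) (inj₁ w) = inj₂ (cong₂ _*_ d w)
                  sign (inj₂ d) (inj₂ w) = inj₁ (cong₂ _*_ d w)
                  ω² : ω ≡ 1ℤ ⊎ ω ≡ -1ℤ → ω * ω ≡ 1ℤ
                  ω² (inj₁ w) = cong₂ _*_ w w
                  ω² (inj₂ w) = cong₂ _*_ w w
                  3∣s-δω : + 3 ∣ + s - δ * ω
                  3∣s-δω = ∣-combine₃ 3∣σ+δ (2^-mod-3 t) (∣-refl {+ 3}) (ω * + 2) (- ω * + s) (- δ * ω)
                    (trans (cong (λ u → ω * + 2 * (u + δ) + - ω * + s * (+ 2 * (+ 2) ^ e - ω) + - δ * ω * + 3) σ≡)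
                    (trans (lemma ω ((+ 2) ^ e) (+ s) δ) (trans (cong (λ u → u * + s - δ * ω) (ω² (-1^ t)))
                    (cong (_- δ * ω) (ℤ.*-identityˡ (+ s))))))
                    where
                    lemma : ∀ ω x s δ → ω * + 2 * (x * s + δ) + - ω * s * (+ 2 * x - ω) + - δ * ω * + 3 ≡ ω * ω * s - δ * ω
                    lemma = solve-∀
                  finish : ∃[ k ] + s ≡ + 6 * + k + δ * ω → Shape δ
                  finish (k , s≡) = t , k , ℕ.s≤s (ℕ.s≤s ℕ.z≤n) , trans σ≡ (cong (_*_ ((+ 2) ^ e)) s≡) ,
                    trans n≡ (trans (cong (_*_ (+ 6)) σ≡) (trans (lemma ((+ 2) ^ e) (+ s)) (cong (_*_ (+ 3 * (+ 2 * (+ 2) ^ e))) s≡)))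
                    where
                    lemma : ∀ x s → + 6 * (x * s) ≡ + 3 * (+ 2 * x) * s
                    lemma = solve-∀

            σ+1<h : suc σ ℕ.< h
            σ+1<h = subst (suc σ ℕ.<_) (sym (ℤ.+-injective (trans h≡ (sym (ℤ.pos-* σ 3))))) (size σ)
              where
              size : ∀ σ .{{_ : ℕ.NonZero σ}} → suc σ ℕ.< σ ℕ.* 3
              size (suc m) = ℕ.s≤s (ℕ.s≤s (ℕ.s≤s (ℕ.m≤m*n m 3)))

            -- If `σ ≡ δ` modulo 3, then `u b ≡ δ σ − 1` would be divisible by 3; so only `σ ≡ −δ`
            -- remains, as `shape` demands. The sign `δ = 1` leads to case (iii), and `δ = −1` to
            -- case (iv).
            conclude : ∀ δ → δ ≡ 1ℤ ⊎ δ ≡ -1ℤ → n ∣ u * b - δ * + σ + 1ℤ → Normal a b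
            conclude δ (inj₁ refl) ub = finish (shape 1ℤ (inj₁ refl) (by-remainder (mod-3 (+ σ))))
              where
              c = σ ℕ.∸ 1
              +c : + c ≡ + σ - 1ℤ
              +c = trans (lemma (+ c)) (cong (λ u → u - 1ℤ) (cong +_ (ℕ.suc-pred σ)))
                where
                lemma : ∀ c → c ≡ 1ℤ + c - 1ℤ
                lemma = solve-∀
              ub′ : n ∣ u * b - + c
              ub′ = subst (n ∣_) (trans (lemma (u * b) (+ σ)) (cong (λ v → u * b - v) (sym +c))) ub
                where
                lemma : ∀ x σ → x - 1ℤ * σ + 1ℤ ≡ x - (σ - 1ℤ)
                lemma = solve-∀
              1<c = 1<multiplier u c dis ua (inj₁ ub′)
              lemma₁ : ∀ x σ → 1ℤ * (σ - 1ℤ) + 1ℤ * (x - 1ℤ * σ + 1ℤ) ≡ x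
              lemma₁ = solve-∀
              by-remainder : + 3 ∣ + σ ⊎ + 3 ∣ + σ - 1ℤ ⊎ + 3 ∣ + σ + 1ℤ → + 3 ∣ + σ + 1ℤ
              by-remainder (inj₁ 3∣) = contradiction 3∣ 3∤σ
              by-remainder (inj₂ (inj₁ 3∣)) = contradiction (∣-combine₂ 3∣ (∣-trans 3∣n ub) 1ℤ 1ℤ (lemma₁ (u * b) (+ σ))) 3∤ub
              by-remainder (inj₂ (inj₂ 3∣)) = 3∣
              finish : Shape 1ℤ → Normal a b
              finish (t , k , 2≤t , σ≡ , n≡) = u , c , ua , inj₁ ub′ , 1<c ,
                ℕ.<-trans (ℕ.s≤s (ℕ.m∸n≤m σ 1)) σ+1<h , inj₂ (inj₂ (inj₁ (t , k , 2≤t ,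
                (trans n≡ (cong (λ v → + 3 * (+ 2) ^ t * (+ 6 * + k + v)) (ℤ.*-identityˡ (-1ℤ ^ t))) ,
                 trans +c (cong (_- 1ℤ) (trans σ≡ (cong (λ v → (+ 2) ^ (t ℕ.∸ 1) * (+ 6 * + k + v)) (ℤ.*-identityˡ (-1ℤ ^ t)))))) , 1<c)))
            conclude δ (inj₂ refl) ub = finish (shape -1ℤ (inj₂ refl) (by-remainder (mod-3 (+ σ))))
              where
              c = suc σ
              ub′ : n ∣ u * b + + c
              ub′ = subst (n ∣_) (lemma (u * b) (+ σ)) ub
                where
                lemma : ∀ x σ → x - -1ℤ * σ + 1ℤ ≡ x + (1ℤ + σ)
                lemma = solve-∀
              1<c = 1<multiplier u c dis ua (inj₂ ub′)
              lemma₁ : ∀ x σ → -1ℤ * (σ + 1ℤ) + 1ℤ * (x - -1ℤ * σ + 1ℤ) ≡ x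
              lemma₁ = solve-∀
              by-remainder : + 3 ∣ + σ ⊎ + 3 ∣ + σ - 1ℤ ⊎ + 3 ∣ + σ + 1ℤ → + 3 ∣ + σ + -1ℤ
              by-remainder (inj₁ 3∣) = contradiction 3∣ 3∤σ
              by-remainder (inj₂ (inj₁ 3∣)) = 3∣
              by-remainder (inj₂ (inj₂ 3∣)) = contradiction (∣-combine₂ 3∣ (∣-trans 3∣n ub) -1ℤ 1ℤ (lemma₁ (u * b) (+ σ))) 3∤ub
              finish : Shape -1ℤ → Normal a b
              finish (t , k , 2≤t , σ≡ , n≡) = u , c , ua , inj₂ ub′ , 1<c , σ+1<h , inj₂ (inj₂ (inj₂ (t , k , 2≤t ,
                (trans n≡ (cong (λ v → + 3 * (+ 2) ^ t * (+ 6 * + k + v)) (ℤ.-1*i≡-i (-1ℤ ^ t))) ,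
                 trans (ℤ.+-comm 1ℤ (+ σ)) (cong (λ v → v + 1ℤ) (trans σ≡ (cong (λ v → (+ 2) ^ (t ℕ.∸ 1) * (+ 6 * + k + v)) (ℤ.-1*i≡-i (-1ℤ ^ t)))))) , 1<c)))

          from-inverse : ∃[ u ] n ∣ u * a - 1ℤ → Normal a b
          from-inverse (u , ua) = from-sign (u-mod-6 u ua)
            where
            lemma : ∀ a b u μ σ η → u * (a + b + μ * σ) + -1ℤ * (u * a - 1ℤ) + - μ * (u * σ - η * σ) ≡ u * b - - (μ * η) * σ + 1ℤ
            lemma = solve-∀
            sign : ∀ {η} → μ ≡ 1ℤ ⊎ μ ≡ -1ℤ → η ≡ 1ℤ ⊎ η ≡ -1ℤ → - (μ * η) ≡ 1ℤ ⊎ - (μ * η) ≡ -1ℤ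
            sign (inj₁ refl) (inj₁ refl) = inj₂ refl
            sign (inj₁ refl) (inj₂ refl) = inj₁ refl
            sign (inj₂ refl) (inj₁ refl) = inj₁ refl
            sign (inj₂ refl) (inj₂ refl) = inj₂ refl
            from-sign : ∃[ η ] (η ≡ 1ℤ ⊎ η ≡ -1ℤ) × (n ∣ u * + σ - η * + σ) → Normal a b
            from-sign (η , η-sign , uσ) = conclude u ua (- (μ * η)) (sign μ-sign η-sign)
              (∣-combine₃ a+b ua uσ u -1ℤ (- μ) (lemma a b u μ (+ σ) η))

          normal : Normal a b
          normal = from-inverse (bézout⇒inverse a-n)

        from-quotients : + 2 ∣ p → n ∣ + 3 * p → Normal a b
        from-quotients (divides p′ p≡) (divides m 3p≡) = by-remainder (mod-3 m)
          where
          3p′≡ : p′ * + 3 ≡ m * + h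
          3p′≡ = double-injective (trans (by-adding (sym (cong (_*_ (+ 3)) p≡)) (lemma₁ p p′)) (trans 3p≡ (lemma₂ m (+ h))))
            where
            lemma₁ : ∀ p p′ → p′ * + 3 + p′ * + 3 + + 3 * p ≡ + 3 * p + + 3 * (p′ * + 2)
            lemma₁ = solve-∀
            lemma₂ : ∀ m h → m * (h + h) ≡ m * h + m * h
            lemma₂ = solve-∀
          from-σ : ∀ μ → μ ≡ 1ℤ ⊎ μ ≡ -1ℤ → + 3 ∣ m - μ → + 3 ∣ + h → Normal a b
          from-σ μ sign 3∣m-μ 3∣h = with-σ (∣⇒∣ᵤ 3∣h)
            where
            with-σ : 3 ℕ.∣ h → Normal a b
            with-σ (ℕ.divides σ h≡σ*3) = normal σ h≡ m
              (trans p≡ (trans (cong (_* + 2) p′≡) (lemma₂ m (+ σ)))) μ sign 3∣m-μ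
              where
              h≡ : + h ≡ + σ * + 3
              h≡ = trans (cong +_ h≡σ*3) (ℤ.pos-* σ 3)
              lemma₁ : ∀ m σ → m * (σ * + 3) ≡ m * σ * + 3
              lemma₁ = solve-∀
              lemma₂ : ∀ m σ → m * σ * + 2 ≡ + 2 * m * σ
              lemma₂ = solve-∀
              p′≡ : p′ ≡ m * + σ
              p′≡ = ℤ.*-cancelʳ-≡ p′ (m * + σ) (+ 3) (trans 3p′≡ (trans (cong (_*_ m) h≡) (lemma₁ m (+ σ))))
          by-remainder : + 3 ∣ m ⊎ + 3 ∣ m - 1ℤ ⊎ + 3 ∣ m + 1ℤ → Normal a b
          by-remainder (inj₁ (divides m′ m≡)) = contradiction
            (divides m′ (ℤ.*-cancelˡ-≡ (+ 3) p (m′ * n) (trans 3p≡ (trans (cong (_* n) m≡) (lemma m′ n))))) n∤p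
            where
            lemma : ∀ m n → m * + 3 * n ≡ + 3 * (m * n)
            lemma = solve-∀
          by-remainder (inj₂ (inj₁ 3∣)) = from-σ 1ℤ (inj₁ refl) 3∣ (∣-combine₂ (divides p′ (sym 3p′≡)) 3∣ 1ℤ (- + h) (lemma m (+ h)))
            where
            lemma : ∀ m h → 1ℤ * (m * h) + - h * (m - 1ℤ) ≡ h
            lemma = solve-∀
          by-remainder (inj₂ (inj₂ 3∣)) = from-σ -1ℤ (inj₂ refl) 3∣ (∣-combine₂ (divides p′ (sym 3p′≡)) 3∣ -1ℤ (+ h) (lemma m (+ h)))
            where
            lemma : ∀ m h → -1ℤ * (m * h) + h * (m + 1ℤ) ≡ h
            lemma = solve-∀

  -- Parity analysis: signs and order of the two generators

  Generate : ℤ → ℤ → ℤ → Set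
  Generate a b h = ∃[ α ] ∃[ β ] ∃[ γ ] α * a + β * b + γ * h ≡ 1ℤ

  generate-swap : ∀ {a b h} → Generate a b h → Generate b a h
  generate-swap {a} {b} {h} (α , β , γ , eq) = β , α , γ , trans (cong (λ u → u + γ * h) (ℤ.+-comm (β * b) (α * a))) eq

  generate-neg : ∀ {a b h} → Generate a b h → Generate a (- b) h
  generate-neg {a} {b} {h} (α , β , γ , eq) = α , - β , γ , trans (lemma a b h α β γ) eq
    where
    lemma : ∀ a b h α β γ → α * a + - β * - b + γ * h ≡ α * a + β * b + γ * h
    lemma = solve-∀

  module _ (h : ℕ) .{{_ : ℕ.NonZero h}} where

    private n = + h + + h

    open NormalForm h

    distinct-swap : ∀ {a b} → Distinct a b → Distinct b a
    distinct-swap {a} {b} dis = record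
      { a≢0  = b≢0
      ; b≢0  = a≢0
      ; a≢b  = λ n∣ → a≢b (subst (n ∣_) (lemma a b) (∣m⇒∣-m n∣))
      ; a≢-b = λ n∣ → a≢-b (subst (n ∣_) (ℤ.+-comm b a) n∣)
      }
      where
      open Distinct dis
      lemma : ∀ a b → - (b - a) ≡ a - b
      lemma = solve-∀

    distinct-neg : ∀ {a b} → Distinct a b → Distinct a (- b)
    distinct-neg {a} {b} dis = record
      { a≢0  = a≢0
      ; b≢0  = λ n∣ → b≢0 (subst (n ∣_) (ℤ.neg-involutive b) (∣m⇒∣-m n∣))
      ; a≢b  = λ n∣ → a≢-b (subst (λ u → n ∣ a + u) (ℤ.neg-involutive b) n∣)
      ; a≢-b = a≢b
      }
      where open Distinct dis

    Normalisable : ℤ → ℤ → Set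
    Normalisable a b = Normal a b ⊎ Normal b a

    normalisable-neg : ∀ {a b} → Normalisable a (- b) → Normalisable a b
    normalisable-neg {a} {b} (inj₁ (u , c , ua , ub , 1<c , c<h , cases)) =
      inj₁ (u , c , ua , flip ub , 1<c , c<h , cases)
      where
      lemma₁ : ∀ u b c → - (u * - b - c) ≡ u * b + c
      lemma₁ = solve-∀
      lemma₂ : ∀ u b c → - (u * - b + c) ≡ u * b - c
      lemma₂ = solve-∀
      flip : n ∣ u * - b - + c ⊎ n ∣ u * - b + + c → n ∣ u * b - + c ⊎ n ∣ u * b + + c
      flip (inj₁ n∣) = inj₂ (subst (n ∣_) (lemma₁ u b (+ c)) (∣m⇒∣-m n∣))
      flip (inj₂ n∣) = inj₁ (subst (n ∣_) (lemma₂ u b (+ c)) (∣m⇒∣-m n∣))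
    normalisable-neg {a} {b} (inj₂ (u , c , ub , ua , 1<c , c<h , cases)) =
      inj₂ (- u , c , subst (λ v → n ∣ v - 1ℤ) (lemma u b) ub , flip ua , 1<c , c<h , cases)
      where
      lemma : ∀ u b → u * - b ≡ - u * b
      lemma = solve-∀
      lemma₁ : ∀ u a c → - (u * a - c) ≡ - u * a + c
      lemma₁ = solve-∀
      lemma₂ : ∀ u a c → - (u * a + c) ≡ - u * a - c
      lemma₂ = solve-∀
      flip : n ∣ u * a - + c ⊎ n ∣ u * a + + c → n ∣ - u * a - + c ⊎ n ∣ - u * a + + c
      flip (inj₁ n∣) = inj₂ (subst (n ∣_) (lemma₁ u a (+ c)) (∣m⇒∣-m n∣))
      flip (inj₂ n∣) = inj₁ (subst (n ∣_) (lemma₂ u a (+ c)) (∣m⇒∣-m n∣))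

    -- `a + b + h` is even, being a multiple of `n`. If `a` and `b` were both even, `h` would be
    -- too, and the generating relation would make 1 even.
    caseI-either : ∀ {a b} → Distinct a b → Generate a b (+ h) → n ∣ a + b + + h → Normalisable a b
    caseI-either {a} {b} dis gen@(α , β , γ , bézout) n∣p = by-parity (mod-2 a) (mod-2 b)
      where
      lemma : ∀ a b h α β γ → (α - γ) * a + (β - γ) * b + γ * (a + b + h) ≡ α * a + β * b + γ * h
      lemma = solve-∀
      by-parity : + 2 ∣ a ⊎ + 2 ∣ a - 1ℤ → + 2 ∣ b ⊎ + 2 ∣ b - 1ℤ → Normalisable a b
      by-parity (inj₂ a-odd) _ = inj₁ (caseI dis n∣p gen a-odd)
      by-parity (inj₁ _) (inj₂ b-odd) = inj₂ (caseI (distinct-swap dis)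
        (subst (λ u → n ∣ u + + h) (ℤ.+-comm a b) n∣p) (generate-swap gen) b-odd)
      by-parity (inj₁ 2∣a) (inj₁ 2∣b) = contradiction
        (∣-combine₃ 2∣a 2∣b (∣-trans 2∣n n∣p) (α - γ) (β - γ) γ (trans (lemma a b (+ h) α β γ) bézout)) 2∤1

    -- The product `w` of the two odd multipliers kills `p` and `q`, hence `2 a` and `2 b`, modulo
    -- `n`. So `h` divides `w a` and `w b`, and by the generating relation `w` itself. Thus `h` is
    -- odd, and since `p` is even exactly one of `a`, `b` is odd.
    caseII-either : ∀ {a b} → Distinct a b → Generate a b (+ h) → OddOrder n (a + b + + h) → OddOrder n (a - b + + h) →
                    n ∣ (a + b + + h) * (a - b + + h) → Normalisable a b
    caseII-either {a} {b} dis gen@(α , β , γ , bézout) op@(k , n∣kp) oq@(l , n∣lq) n∣pq =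
      by-parity (mod-2 a) (mod-2 b) (h-odd (mod-2 (+ h)))
      where
      p = a + b + + h
      q = a - b + + h
      w = (1ℤ + (+ k + + k)) * (1ℤ + (+ l + + l))
      2∣p : + 2 ∣ p
      2∣p = odd-order⇒even (+ h) op
      h∣w : + h ∣ w
      h∣w = ∣-combine₃ h∣wa h∣wb (∣-refl {+ h}) α β (γ * w) (trans (lemma a b (+ h) α β γ w)
        (trans (cong (_*_ w) bézout) (ℤ.*-identityʳ w)))
        where
        lemma : ∀ a b h α β γ w → α * (w * a) + β * (w * b) + γ * w * h ≡ w * (α * a + β * b + γ * h)
        lemma = solve-∀
        lemma₁ : ∀ a b h k l → (1ℤ + (l + l)) * ((1ℤ + (k + k)) * (a + b + h)) + (1ℤ + (k + k)) * ((1ℤ + (l + l)) * (a - b + h)) + - ((1ℤ + (k + k)) * (1ℤ + (l + l))) * (h + h) ≡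
                   (1ℤ + (k + k)) * (1ℤ + (l + l)) * a + (1ℤ + (k + k)) * (1ℤ + (l + l)) * a
        lemma₁ = solve-∀
        lemma₂ : ∀ a b h k l → (1ℤ + (l + l)) * ((1ℤ + (k + k)) * (a + b + h)) + - (1ℤ + (k + k)) * ((1ℤ + (l + l)) * (a - b + h)) ≡
                   (1ℤ + (k + k)) * (1ℤ + (l + l)) * b + (1ℤ + (k + k)) * (1ℤ + (l + l)) * b
        lemma₂ = solve-∀
        h∣wa : + h ∣ w * a
        h∣wa = ∣-double (∣-combine₃ n∣kp n∣lq (∣-refl {n}) (1ℤ + (+ l + + l)) (1ℤ + (+ k + + k)) (- w) (lemma₁ a b (+ h) (+ k) (+ l)))
        h∣wb : + h ∣ w * b
        h∣wb = ∣-double (∣-combine₂ n∣kp n∣lq (1ℤ + (+ l + + l)) (- (1ℤ + (+ k + + k))) (lemma₂ a b (+ h) (+ k) (+ l)))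
      h-odd : + 2 ∣ + h ⊎ + 2 ∣ + h - 1ℤ → + 2 ∣ + h - 1ℤ
      h-odd (inj₂ odd)  = odd
      h-odd (inj₁ even) = contradiction (∣-combine₂ (∣-trans even h∣w) (∣-refl {+ 2}) 1ℤ (- (+ k + + l + + 2 * + k * + l)) (lemma (+ k) (+ l))) 2∤1
        where
        lemma : ∀ k l → 1ℤ * ((1ℤ + (k + k)) * (1ℤ + (l + l))) + - (k + l + + 2 * k * l) * + 2 ≡ 1ℤ
        lemma = solve-∀
      by-parity : + 2 ∣ a ⊎ + 2 ∣ a - 1ℤ → + 2 ∣ b ⊎ + 2 ∣ b - 1ℤ → + 2 ∣ + h - 1ℤ → Normalisable a b
      by-parity (inj₂ a-odd) (inj₁ b-even) h-odd = inj₁ (caseII dis gen h-odd n∣pq a-odd b-even)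
      by-parity (inj₁ a-even) (inj₂ b-odd) h-odd = inj₂ (caseII (distinct-swap dis) (generate-swap gen) h-odd
        -- Exchanging `a` and `b` keeps `p` and replaces `q` by `2 h − q`.
        (∣-combine₂ n∣pq (∣-refl {n}) -1ℤ p (lemma a b (+ h))) b-odd a-even)
        where
        lemma : ∀ a b h → -1ℤ * ((a + b + h) * (a - b + h)) + (a + b + h) * (h + h) ≡ (b + a + h) * (b - a + h)
        lemma = solve-∀
      by-parity (inj₁ 2∣a) (inj₁ 2∣b) h-odd = contradiction
        (∣-combine₄ 2∣p 2∣a 2∣b h-odd 1ℤ -1ℤ -1ℤ -1ℤ (lemma a b (+ h))) 2∤1
        where
        lemma : ∀ a b h → 1ℤ * (a + b + h) + -1ℤ * a + -1ℤ * b + -1ℤ * (h - 1ℤ) ≡ 1ℤ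
        lemma = solve-∀
      by-parity (inj₂ a-odd) (inj₂ b-odd) h-odd = contradiction
        (∣m∣n⇒∣m+n (∣-combine₄ 2∣p a-odd b-odd h-odd 1ℤ -1ℤ -1ℤ -1ℤ (lemma a b (+ h))) (divides { + 2} -1ℤ refl)) 2∤1
        where
        lemma : ∀ a b h → 1ℤ * (a + b + h) + -1ℤ * (a - 1ℤ) + -1ℤ * (b - 1ℤ) + -1ℤ * (h - 1ℤ) ≡ + 3
        lemma = solve-∀

    module _ (f : Seq) (r : ℤ) (f-period : Period f n) (f-injective : ∀ x y → f x ≡ f y → n ∣ x - y) where

      open Necessity h f r f-period f-injective

      Magical : ℤ → ℤ → Set
      Magical a b = ∀ x → f x + (f (x + a) + f (x - a)) + (f (x + b) + f (x - b)) + f (x + + h) ≡ r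

      magical-neg : ∀ {a b} → Magical a b → Magical a (- b)
      magical-neg {a} {b} magic x = trans
        (cong (λ u → f x + (f (x + a) + f (x - a)) + u + f (x + + h))
          (trans (ℤ.+-comm (f (x - b)) (f (x - - b))) (cong (λ u → f (x + u) + f (x - b)) (ℤ.neg-involutive b)))) (magic x)

      one-odd⇒normalisable : ∀ {a b} → Distinct a b → Generate a b (+ h) → Magical a b →
        ∃[ z ] n ∣ z * (a - b + + h) - + h → Period d (a + b + + h) → Normalisable a b
      one-odd⇒normalisable {a} {b} dis gen@(α , β , γ , bézout) magic (z , n∣) pd =
        by-cases (Magic.one-odd a b magic p-odd pd α β γ bézout)
        where
        p = a + b + + h
        p-odd : OddOrder n p
        p-odd = odd-order-not-even pd
        2∣p : + 2 ∣ p
        2∣p = odd-order⇒even (+ h) p-odd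
        -- `q = p − 2 b` is even, and so is its multiple that agrees with `h` modulo `n`.
        2∣h : + 2 ∣ + h
        2∣h = ∣-combine₃ 2∣p (∣-refl {+ 2}) (∣-trans 2∣n n∣) z (- z * b) -1ℤ (lemma a b (+ h) z)
          where
          lemma : ∀ a b h z → z * (a + b + h) + - z * b * + 2 + -1ℤ * (z * (a - b + h) - h) ≡ h
          lemma = solve-∀
        by-cases : (n ∣ p) ⊎ ((n ∣ + 3 * p) × (¬ + 3 ∣ p) × (¬ + 3 ∣ a) × (¬ + 3 ∣ b)) → Normalisable a b
        by-cases (inj₁ n∣p) = caseI-either dis gen n∣p
        by-cases (inj₂ (n∣3p , 3∤p , 3∤a , 3∤b)) with n ∣? p
        ... | yes n∣p = caseI-either dis gen n∣p
        ... | no  n∤p = inj₁ (caseIII-IV dis gen 2∣h 2∣p n∤p n∣3p 3∤p 3∤a 3∤b)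

      -- Replacing `b` by `−b` exchanges `p` and `q`. So when some multiple of one of them is `h`,
      -- it can be arranged that the other is the period of `d` that `one-odd⇒normalisable` expects.
      normalisable : ∀ {a b} → Distinct a b → Generate a b (+ h) → Magical a b → Normalisable a b
      normalisable {a} {b} dis gen magic = by-order (odd-order h p) (odd-order h q)
        where
        p = a + b + + h
        q = a - b + + h
        p≡ : p ≡ a - - b + + h
        p≡ = cong (λ u → a + u + + h) (sym (ℤ.neg-involutive b))
        by-order : OddOrder n p ⊎ ∃[ z ] n ∣ z * p - + h → OddOrder n q ⊎ ∃[ z ] n ∣ z * q - + h → Normalisable a b
        by-order (inj₁ p-odd) (inj₁ q-odd) = caseII-either dis gen p-odd q-odd (Magic.both-odd a b magic p-odd q-odd)
        by-order (inj₂ p-even@(z , n∣)) _ = normalisable-neg (one-odd⇒normalisable (distinct-neg dis) (generate-neg gen) (magical-neg magic)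
          (z , subst (λ u → n ∣ z * u - + h) p≡ n∣) (Magic.h-multiple⇒period a b magic p-even))
        by-order _ (inj₂ q-even) = one-odd⇒normalisable dis gen magic q-even
          (subst (Period d) (sym p≡) (Magic.h-multiple⇒period a (- b) (magical-neg magic) q-even))

  -- Explicit labellings

  module _ {n : ℕ} .{{_ : ℕ.NonZero n}} where

    []-≈ : ∀ x y → + n ∣ x - y → [_] {n} x ≡ [ y ]
    []-≈ x y (divides q eq) = []-cong x y q (by-adding eq (lemma x y (q * + n)))
      where
      lemma : ∀ x y m → x + m ≡ y + m + (x - y)
      lemma = solve-∀

    toℕ[]-≈ : ∀ x → + n ∣ + toℕ ([_] {n} x) - x
    toℕ[]-≈ x = divides (- (x /ℕ n)) (trans (cong (_- x) (toℕ-[] x)) (lemma x (x /ℕ n) (+ n)))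
      where
      lemma : ∀ x q n → x - q * n - x ≡ - q * n
      lemma = solve-∀

    []-≈⁻¹ : ∀ x y → [_] {n} x ≡ [ y ] → + n ∣ x - y
    []-≈⁻¹ x y eq = ∣-combine₂ (toℕ[]-≈ x) (toℕ[]-≈ y) -1ℤ 1ℤ
      (trans (cong (λ z → -1ℤ * (+ toℕ z - x) + 1ℤ * (+ toℕ ([_] {n} y) - y)) eq) (lemma x y (+ toℕ ([_] {n} y))))
      where
      lemma : ∀ x y t → -1ℤ * (t - x) + 1ℤ * (t - y) ≡ x - y
      lemma = solve-∀

    %ℕ-cong : ∀ x y → + n ∣ x - y → x %ℕ n ≡ y %ℕ n
    %ℕ-cong x y n∣ = trans (sym (toℕ-fromℕ< (n%ℕd<d x n))) (trans (cong toℕ ([]-≈ x y n∣)) (toℕ-fromℕ< (n%ℕd<d y n)))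

    %ℕ-injective : ∀ {x y} → x %ℕ n ≡ y %ℕ n → + n ∣ x - y
    %ℕ-injective {x} {y} eq = divides (x /ℕ n - y /ℕ n)
      (trans (cong₂ _-_ (trans (a≡a%ℕn+[a/ℕn]*n x n) (cong (λ r → + r + x /ℕ n * + n) eq)) (a≡a%ℕn+[a/ℕn]*n y n))
             (lemma (+ (y %ℕ n)) (x /ℕ n) (y /ℕ n) (+ n)))
      where
      lemma : ∀ r u v n → r + u * n - (r + v * n) ≡ (u - v) * n
      lemma = solve-∀

  -- Values run through `0, …, n − 1`, one less than the labels. Constancy of the star sum is stated
  -- with `excess` on the left to avoid truncated subtraction.
  record Labelling (n h c : ℕ) : Set where
    field
      value     : ℤ → ℕ
      bounded   : ∀ x → value x ℕ.< n
      respects  : ∀ x y → + n ∣ x - y → value x ≡ value y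
      injective : ∀ x y → value x ≡ value y → + n ∣ x - y
    starSum : ℤ → ℕ
    starSum x = value x ℕ.+ (value (x + 1ℤ) ℕ.+ value (x - 1ℤ)) ℕ.+ (value (x + + c) ℕ.+ value (x - + c)) ℕ.+ value (x + + h)
    field
      total     : ℕ
      excess    : ℕ
      magic     : ∀ x → starSum x ℕ.+ excess ≡ total

  -- For odd `b` the value is replaced by its complement with respect to `2 H − 1`, so with `v < H`
  -- the parity of `b` selects the lower or the upper half.
  reflect : ℕ → ℤ → ℕ → ℕ
  reflect H b v with b %ℕ 2
  ... | zero  = v
  ... | suc _ = H ℕ.+ H ℕ.∸ suc v

  reflect-even : ∀ H b v → + 2 ∣ b → reflect H b v ≡ v
  reflect-even H b v 2∣b with b %ℕ 2 | %ℕ-cong {2} b 0ℤ (subst (+ 2 ∣_) (sym (ℤ.+-identityʳ b)) 2∣b)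
  ... | _ | refl = refl

  reflect-odd : ∀ H b v → v ℕ.< H → + 2 ∣ b - 1ℤ → suc (reflect H b v ℕ.+ v) ≡ H ℕ.+ H
  reflect-odd H b v v<H 2∣ with b %ℕ 2 | %ℕ-cong {2} b 1ℤ 2∣
  ... | _ | refl = trans (sym (ℕ.+-suc _ v)) (ℕ.m∸n+n≡m (ℕ.≤-trans v<H (ℕ.m≤m+n H H)))

  reflect-bounded : ∀ H b v → v ℕ.< H → reflect H b v ℕ.< H ℕ.+ H
  reflect-bounded H b v v<H with mod-2 b
  ... | inj₁ even = subst (ℕ._< H ℕ.+ H) (sym (reflect-even H b v even)) (ℕ.≤-trans v<H (ℕ.m≤m+n H H))
  ... | inj₂ odd  = ℕ.≤-trans (ℕ.s≤s (ℕ.m≤m+n _ v)) (ℕ.≤-reflexive (reflect-odd H b v v<H odd))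

  reflect-cong : ∀ H b b′ v v′ → + 2 ∣ b - b′ → v ≡ v′ → reflect H b v ≡ reflect H b′ v′
  reflect-cong H b b′ v v′ 2∣ refl with b %ℕ 2 | b′ %ℕ 2 | %ℕ-cong {2} b b′ 2∣
  ... | zero  | _ | refl = refl
  ... | suc _ | _ | refl = refl

  reflect-suc : ∀ H b b′ v → v ℕ.< H → + 2 ∣ b - b′ - 1ℤ → suc (reflect H b v ℕ.+ reflect H b′ v) ≡ H ℕ.+ H
  reflect-suc H b b′ v v<H 2∣ with mod-2 b′
  ... | inj₁ even = trans (cong (λ w → suc (reflect H b v ℕ.+ w)) (reflect-even H b′ v even))
    (reflect-odd H b v v<H (∣-combine₂ 2∣ even 1ℤ 1ℤ (lemma b b′)))
    where
    lemma : ∀ b b′ → 1ℤ * (b - b′ - 1ℤ) + 1ℤ * b′ ≡ b - 1ℤ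
    lemma = solve-∀
  ... | inj₂ odd = trans (cong suc (trans (cong (ℕ._+ reflect H b′ v) (reflect-even H b v
      (∣-combine₃ 2∣ odd (∣-refl {+ 2}) 1ℤ 1ℤ 1ℤ (lemma b b′)))) (ℕ.+-comm v _))) (reflect-odd H b′ v v<H odd)
    where
    lemma : ∀ b b′ → 1ℤ * (b - b′ - 1ℤ) + 1ℤ * (b′ - 1ℤ) + 1ℤ * + 2 ≡ b
    lemma = solve-∀

  reflect-injective : ∀ H b b′ v v′ → v ℕ.< H → v′ ℕ.< H → reflect H b v ≡ reflect H b′ v′ → (+ 2 ∣ b - b′) × v ≡ v′
  reflect-injective H b b′ v v′ v<H v′<H eq = by-parity (mod-2 b) (mod-2 b′)
    where
    too-big : ∀ {v v′} → v ℕ.< H → v′ ℕ.< H → suc (v ℕ.+ v′) ≢ H ℕ.+ H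
    too-big {v} {v′} v<H v′<H eq = ℕ.<-irrefl eq (ℕ.≤-trans (ℕ.≤-reflexive (cong suc (sym (ℕ.+-suc v v′)))) (ℕ.+-mono-≤ v<H v′<H))
    lemma : ∀ b b′ → 1ℤ * (b - 1ℤ) + -1ℤ * (b′ - 1ℤ) ≡ b - b′
    lemma = solve-∀
    by-parity : + 2 ∣ b ⊎ + 2 ∣ b - 1ℤ → + 2 ∣ b′ ⊎ + 2 ∣ b′ - 1ℤ → (+ 2 ∣ b - b′) × v ≡ v′
    by-parity (inj₁ b-even) (inj₁ b′-even) = ∣m∣n⇒∣m-n b-even b′-even ,
      trans (sym (reflect-even H b v b-even)) (trans eq (reflect-even H b′ v′ b′-even))
    by-parity (inj₂ b-odd) (inj₂ b′-odd) = ∣-combine₂ b-odd b′-odd 1ℤ -1ℤ (lemma b b′) ,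
      ℕ.+-cancelˡ-≡ (reflect H b v) v v′ (ℕ.suc-injective (trans (reflect-odd H b v v<H b-odd)
        (trans (sym (reflect-odd H b′ v′ v′<H b′-odd)) (cong (λ w → suc (w ℕ.+ v′)) (sym eq)))))
    by-parity (inj₁ b-even) (inj₂ b′-odd) = contradiction
      (trans (cong (λ w → suc (w ℕ.+ v′)) (trans (sym (reflect-even H b v b-even)) eq)) (reflect-odd H b′ v′ v′<H b′-odd)) (too-big v<H v′<H)
    by-parity (inj₂ b-odd) (inj₁ b′-even) = contradiction
      (trans (cong (λ w → suc (w ℕ.+ v)) (trans (sym (reflect-even H b′ v′ b′-even)) (sym eq))) (reflect-odd H b v v<H b-odd)) (too-big v′<H v<H)

  module _ (H : ℕ) .{{_ : ℕ.NonZero H}} where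

    -- Climbs from `0` to `H − 1` over one half of the integers modulo `2 H` and descends nowhere
    -- below `H` on the other, from `2 H − 1` to `H`; thus values at distance `H` add up to
    -- `2 H − 1`.
    zigzag : ℤ → ℕ
    zigzag x = reflect H (x /ℕ H) (x %ℕ H)

    quotient-step : ∀ x y k → x %ℕ H ≡ y %ℕ H → x - y ≡ k * + H → x /ℕ H - y /ℕ H ≡ k
    quotient-step x y k r≡ eq = ℤ.*-cancelʳ-≡ (x /ℕ H - y /ℕ H) k (+ H) {{H≢0}} (trans (sym
      (trans (cong₂ _-_ (trans (a≡a%ℕn+[a/ℕn]*n x H) (cong (λ r → + r + x /ℕ H * + H) r≡)) (a≡a%ℕn+[a/ℕn]*n y H))
             (lemma (+ (y %ℕ H)) (x /ℕ H) (y /ℕ H) (+ H)))) eq)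
      where
      H≢0 : NonZero (+ H)
      H≢0 = ≢-nonZero λ eq → ℕ.≢-nonZero⁻¹ H (ℤ.+-injective eq)
      lemma : ∀ r u v n → r + u * n - (r + v * n) ≡ (u - v) * n
      lemma = solve-∀

    zigzag-bounded : ∀ x → zigzag x ℕ.< H ℕ.+ H
    zigzag-bounded x = reflect-bounded H (x /ℕ H) (x %ℕ H) (n%ℕd<d x H)

    zigzag-respects : ∀ x y → + H + + H ∣ x - y → zigzag x ≡ zigzag y
    zigzag-respects x y (divides q eq) = reflect-cong H (x /ℕ H) (y /ℕ H) (x %ℕ H) (y %ℕ H)
      (divides q (quotient-step x y (q * + 2) r≡ eq′)) r≡
      where
      lemma : ∀ q h → q * (h + h) ≡ q * + 2 * h
      lemma = solve-∀
      eq′ : x - y ≡ q * + 2 * + H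
      eq′ = trans eq (lemma q (+ H))
      r≡ : x %ℕ H ≡ y %ℕ H
      r≡ = %ℕ-cong x y (divides (q * + 2) eq′)

    zigzag-injective : ∀ x y → zigzag x ≡ zigzag y → + H + + H ∣ x - y
    zigzag-injective x y eq = combine (reflect-injective H (x /ℕ H) (y /ℕ H) (x %ℕ H) (y %ℕ H) (n%ℕd<d x H) (n%ℕd<d y H) eq)
      where
      lemma : ∀ q h → q * + 2 * h ≡ q * (h + h)
      lemma = solve-∀
      combine : (+ 2 ∣ x /ℕ H - y /ℕ H) × x %ℕ H ≡ y %ℕ H → + H + + H ∣ x - y
      combine (divides q q≡ , r≡) with %ℕ-injective {H} {x} {y} r≡
      ... | divides k eq = divides q (trans eq (trans (cong (_* + H) (trans (sym (quotient-step x y k r≡ eq)) q≡)) (lemma q (+ H))))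

    zigzag-antipodal : ∀ x y → + H + + H ∣ x - y - + H → suc (zigzag x ℕ.+ zigzag y) ≡ H ℕ.+ H
    zigzag-antipodal x y (divides q eq) = trans (cong (λ v → suc (reflect H (x /ℕ H) v ℕ.+ zigzag y)) r≡)
      (reflect-suc H (x /ℕ H) (y /ℕ H) (y %ℕ H) (n%ℕd<d y H)
        (divides q (trans (cong (_- 1ℤ) (quotient-step x y (q * + 2 + 1ℤ) r≡ eq′)) (lemma₂ q))))
      where
      lemma₁ : ∀ x y q h → x - y + q * (h + h) ≡ (q * + 2 + 1ℤ) * h + (x - y - h)
      lemma₁ = solve-∀
      lemma₂ : ∀ q → q * + 2 + 1ℤ - 1ℤ ≡ q * + 2
      lemma₂ = solve-∀
      eq′ : x - y ≡ (q * + 2 + 1ℤ) * + H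
      eq′ = by-adding eq (lemma₁ x y q (+ H))
      r≡ : x %ℕ H ≡ y %ℕ H
      r≡ = %ℕ-cong x y (divides (q * + 2 + 1ℤ) eq′)

  by-addingℕ : ∀ {u v A B : ℕ} → A ≡ B → u ℕ.+ B ≡ v ℕ.+ A → u ≡ v
  by-addingℕ {u} {v} {A} refl eq = ℕ.+-cancelʳ-≡ A u v eq

  -- As `c = h − 1`, the closed neighbourhood of `x` splits into the antipodal pairs `x, x + h`,
  -- then `x − 1, x + c`, then `x + 1, x − c`. Each pair has sum `2 h − 1`.
  caseI-labelling : ∀ h .{{_ : ℕ.NonZero h}} c → + c ≡ + h - 1ℤ → Labelling (h ℕ.+ h) h c
  caseI-labelling h c c≡ = record
    { value     = zigzag h
    ; bounded   = zigzag-bounded h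
    ; respects  = zigzag-respects h
    ; injective = zigzag-injective h
    ; total     = 3 ℕ.* (h ℕ.+ h)
    ; excess    = 3
    ; magic     = λ x → by-addingℕ
        (cong₂ ℕ._+_ (cong₂ ℕ._+_ (antipodal x) (centre x)) (antipodal′ x))
        (lemma (e x) (e (x + 1ℤ)) (e (x - 1ℤ)) (e (x + + c)) (e (x - + c)) (e (x + + h)) (h ℕ.+ h))
    }
    where
    e = zigzag h
    lemma₁ : ∀ x h c → x + c - (x - 1ℤ) - h ≡ c - (h - 1ℤ)
    lemma₁ = solve-∀
    lemma₂ : ∀ x h → x + h - x - h ≡ 0ℤ * (h + h)
    lemma₂ = solve-∀
    lemma₃ : ∀ x h → x + 1ℤ - (x - (h - 1ℤ)) - h ≡ 0ℤ * (h + h)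
    lemma₃ = solve-∀
    antipodal : ∀ x → suc (e (x + + c) ℕ.+ e (x - 1ℤ)) ≡ h ℕ.+ h
    antipodal x = zigzag-antipodal h (x + + c) (x - 1ℤ) (divides 0ℤ (trans (lemma₁ x (+ h) (+ c)) (ℤ.i≡j⇒i-j≡0 c≡)))
    antipodal′ : ∀ x → suc (e (x + 1ℤ) ℕ.+ e (x - + c)) ≡ h ℕ.+ h
    antipodal′ x = zigzag-antipodal h (x + 1ℤ) (x - + c) (divides 0ℤ (trans (cong (λ u → x + 1ℤ - (x - u) - + h) c≡) (lemma₃ x (+ h))))
    centre : ∀ x → suc (e (x + + h) ℕ.+ e x) ≡ h ℕ.+ h
    centre x = zigzag-antipodal h (x + + h) x (divides 0ℤ (lemma₂ x (+ h)))
    lemma : ∀ a b c d e f s → a ℕ.+ (b ℕ.+ c) ℕ.+ (d ℕ.+ e) ℕ.+ f ℕ.+ 3 ℕ.+ (s ℕ.+ s ℕ.+ s) ≡ 3 ℕ.* s ℕ.+ (suc (d ℕ.+ c) ℕ.+ suc (f ℕ.+ a) ℕ.+ suc (b ℕ.+ e))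
    lemma = ℕSolver.solve-∀

  -- Chinese remaindering and the labelling for case (ii)

  coprime-∣-* : ∀ {a b z} → Bézout a b → a ∣ z → b ∣ z → a * b ∣ z
  coprime-∣-* {a} {b} {z} (s , t , eq) (divides x z≡xa) (divides y z≡yb) = divides (s * y + t * x)
    (trans (sym (ℤ.*-identityˡ z)) (trans (cong (_* z) (sym eq)) (trans (ℤ.*-distribʳ-+ z (s * a) (t * b))
      (trans (cong₂ (λ u v → s * a * u + t * b * v) z≡yb z≡xa) (lemma a b s t x y)))))
    where
    lemma : ∀ a b s t x y → s * a * (y * b) + t * b * (x * a) ≡ (s * y + t * x) * (a * b)
    lemma = solve-∀

  -- Take `u = gcd x h`. The cofactor `v = h / u` is coprime to `x / u`, so it must divide `y`.
  split-divisor : ∀ x y h .{{_ : ℕ.NonZero h}} → h ℕ.∣ x ℕ.* y → ∃[ u ] ∃[ v ] h ≡ u ℕ.* v × (u ℕ.∣ x) × (v ℕ.∣ y)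
  split-divisor x y h h∣xy = u , v , h≡uv , ℕ.gcd[m,n]∣m x h ,
    Coprime.coprime-divisor (Coprime.sym (Coprime.coprime-/gcd x h))
      (ℕ.*-cancelˡ-∣ u (subst₂ ℕ._∣_ h≡uv xy≡ h∣xy))
    where
    u = ℕ.gcd x h
    instance
      u≢0 : ℕ.NonZero u
      u≢0 = ℕ.≢-nonZero (ℕ.gcd[m,n]≢0 x h (inj₂ (ℕ.≢-nonZero⁻¹ h)))
    v = h ℕ./ u
    h≡uv : h ≡ u ℕ.* v
    h≡uv = sym (ℕ.m*[n/m]≡n (ℕ.gcd[m,n]∣n x h))
    xy≡ : x ℕ.* y ≡ u ℕ.* (x ℕ./ u ℕ.* y)
    xy≡ = trans (cong (ℕ._* y) (sym (ℕ.m*[n/m]≡n (ℕ.gcd[m,n]∣m x h)))) (ℕ.*-assoc u (x ℕ./ u) y)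

  digits-bounded : ∀ {i j u v} → i ℕ.< u → j ℕ.< v → i ℕ.+ j ℕ.* u ℕ.< u ℕ.* v
  digits-bounded {i} {j} {u} {v} i<u j<v = ℕ.≤-trans (ℕ.+-monoˡ-< (j ℕ.* u) i<u)
    (ℕ.≤-trans (ℕ.*-monoˡ-≤ u j<v) (ℕ.≤-reflexive (ℕ.*-comm v u)))

  digits-injective : ∀ {i i′ j j′ u} .{{_ : ℕ.NonZero u}} → i ℕ.< u → i′ ℕ.< u → i ℕ.+ j ℕ.* u ≡ i′ ℕ.+ j′ ℕ.* u → i ≡ i′ × j ≡ j′
  digits-injective {i} {i′} {j} {j′} {u} i<u i′<u eq = i≡ ,
    ℕ.*-cancelʳ-≡ j j′ u (ℕ.+-cancelˡ-≡ i _ _ (trans eq (cong (ℕ._+ j′ ℕ.* u) (sym i≡))))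
    where
    remainder : ∀ {i} j → i ℕ.< u → (i ℕ.+ j ℕ.* u) ℕ.% u ≡ i
    remainder {i} j i<u = trans (ℕ.[m+kn]%n≡m%n i j u) (ℕ.m<n⇒m%n≡m i<u)
    i≡ : i ≡ i′
    i≡ = trans (sym (remainder j i<u)) (trans (cong (ℕ._% u) eq) (remainder j′ i′<u))

  module _ (u v c : ℕ) .{{_ : ℕ.NonZero u}} .{{_ : ℕ.NonZero v}} where

    -- By the Chinese remainder theorem x is determined modulo 2uv by its parity and
    -- its residues modulo u and v; translation by c fixes the parity and acts as −1
    -- modulo u and as 1 modulo v.
    caseII-labelling : + 2 ∣ + (u ℕ.* v) - 1ℤ → + 2 ∣ + c → + u ∣ + c + 1ℤ → + v ∣ + c - 1ℤ →
                       Labelling (u ℕ.* v ℕ.+ u ℕ.* v) (u ℕ.* v) c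
    caseII-labelling h-odd c-even u∣ v∣ = record
      { value     = value
      ; bounded   = λ x → reflect-bounded h x (ν x) (ν<h x)
      ; respects  = λ x y n∣ → reflect-cong h x y (ν x) (ν y) (∣-trans 2∣n n∣)
          (ν-cong x y x y (∣-trans u∣n n∣) (∣-trans v∣n n∣))
      ; injective = λ x y eq → injective x y (reflect-injective h x y (ν x) (ν y) (ν<h x) (ν<h y) eq)
      ; total     = 3 ℕ.* (h ℕ.+ h)
      ; excess    = 3
      ; magic     = λ x → magic x (mod-2 x)
      }
      where
      h = u ℕ.* v
      n = + (h ℕ.+ h)
      +h : + h ≡ + u * + v
      +h = ℤ.pos-* u v
      h∣n : + h ∣ n
      h∣n = ∣m∣n⇒∣m+n (∣-refl {+ h}) (∣-refl {+ h})
      u∣h : + u ∣ + h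
      u∣h = subst (+ u ∣_) (sym +h) (∣m⇒∣m*n (+ v) ∣-refl)
      v∣h : + v ∣ + h
      v∣h = subst (+ v ∣_) (sym +h) (∣n⇒∣m*n (+ u) ∣-refl)
      u∣n = ∣-trans u∣h h∣n
      v∣n = ∣-trans v∣h h∣n
      2∣n : + 2 ∣ n
      2∣n = divides (+ h) (lemma (+ h))
        where
        lemma : ∀ h → h + h ≡ h * + 2
        lemma = solve-∀

      ν : ℤ → ℕ
      ν x = x %ℕ u ℕ.+ x %ℕ v ℕ.* u
      ν<h : ∀ x → ν x ℕ.< h
      ν<h x = digits-bounded (n%ℕd<d x u) (n%ℕd<d x v)
      ν-cong : ∀ x y z w → + u ∣ x - y → + v ∣ z - w → x %ℕ u ℕ.+ z %ℕ v ℕ.* u ≡ y %ℕ u ℕ.+ w %ℕ v ℕ.* u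
      ν-cong x y z w u∣ v∣ = cong₂ (λ i j → i ℕ.+ j ℕ.* u) (%ℕ-cong x y u∣) (%ℕ-cong z w v∣)
      value : ℤ → ℕ
      value x = reflect h x (ν x)

      -- `c + 1 = x u` and `c − 1 = y v` differ by 2, and `u v = 2 z + 1`; hence
      -- `1 = u v − z (x u − y v)`.
      u-v : Bézout (+ u) (+ v)
      u-v = from-quotients u∣ v∣ h-odd
        where
        from-quotients : + u ∣ + c + 1ℤ → + v ∣ + c - 1ℤ → + 2 ∣ + h - 1ℤ → Bézout (+ u) (+ v)
        from-quotients (divides x eq₁) (divides y eq₂) (divides z eq₃) = + v - z * x , z * y , by-adding
          (cong₂ _+_ (trans (cong (_- 1ℤ) (sym +h)) eq₃) (sym (cong₂ (λ s t → z * t - z * s) eq₁ eq₂)))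
          (lemma (+ u) (+ v) (+ c) x y z)
          where
          lemma : ∀ u v c x y z → (v - z * x) * u + z * y * v + (z * + 2 + (z * (c - 1ℤ) - z * (c + 1ℤ))) ≡ 1ℤ + (u * v - 1ℤ + (z * (y * v) - z * (x * u)))
          lemma = solve-∀

      injective : ∀ x y → (+ 2 ∣ x - y) × ν x ≡ ν y → n ∣ x - y
      injective x y (2∣ , ν≡) = subst (_∣ x - y) (trans (cong (_* + 2) (sym +h)) (lemma (+ h)))
        (coprime-∣-* {+ u * + v} (bézout-2 (subst (λ w → + 2 ∣ w - 1ℤ) +h h-odd))
          (coprime-∣-* u-v (%ℕ-injective {u} {x} {y} (proj₁ digits)) (%ℕ-injective {v} {x} {y} (proj₂ digits))) 2∣)
        where
        digits = digits-injective {j = x %ℕ v} {j′ = y %ℕ v} (n%ℕd<d x u) (n%ℕd<d y u) ν≡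
        lemma : ∀ h → h * + 2 ≡ h + h
        lemma = solve-∀

      ν-h : ∀ x → ν (x + + h) ≡ ν x
      ν-h x = ν-cong (x + + h) x (x + + h) x (subst (+ u ∣_) (sym (lemma x (+ h))) u∣h) (subst (+ v ∣_) (sym (lemma x (+ h))) v∣h)
        where
        lemma : ∀ x h → x + h - x ≡ h
        lemma = solve-∀

      -- `x + c` has the `u`-digit of `x − 1` and the `v`-digit of `x + 1`; for `x − c` the roles
      -- are reversed. The two pairs therefore carry the same digits in total.
      ν-c : ∀ x → ν (x + + c) ℕ.+ ν (x - + c) ≡ ν (x + 1ℤ) ℕ.+ ν (x - 1ℤ)
      ν-c x = trans (cong₂ ℕ._+_
          (ν-cong (x + + c) (x - 1ℤ) (x + + c) (x + 1ℤ) (subst (+ u ∣_) (lemma₁ x (+ c)) u∣) (subst (+ v ∣_) (lemma₂ x (+ c)) v∣))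
          (ν-cong (x - + c) (x + 1ℤ) (x - + c) (x - 1ℤ) (subst (+ u ∣_) (lemma₃ x (+ c)) (∣m⇒∣-m u∣)) (subst (+ v ∣_) (lemma₄ x (+ c)) (∣m⇒∣-m v∣))))
        (exchange ((x - 1ℤ) %ℕ u) ((x + 1ℤ) %ℕ v ℕ.* u) ((x + 1ℤ) %ℕ u) ((x - 1ℤ) %ℕ v ℕ.* u))
        where
        lemma₁ : ∀ x c → c + 1ℤ ≡ x + c - (x - 1ℤ)
        lemma₁ = solve-∀
        lemma₂ : ∀ x c → c - 1ℤ ≡ x + c - (x + 1ℤ)
        lemma₂ = solve-∀
        lemma₃ : ∀ x c → - (c + 1ℤ) ≡ x - c - (x + 1ℤ)
        lemma₃ = solve-∀
        lemma₄ : ∀ x c → - (c - 1ℤ) ≡ x - c - (x - 1ℤ)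
        lemma₄ = solve-∀
        exchange : ∀ a b c d → a ℕ.+ b ℕ.+ (c ℕ.+ d) ≡ c ℕ.+ b ℕ.+ (a ℕ.+ d)
        exchange = ℕSolver.solve-∀

      even : ∀ x → + 2 ∣ x → value x ≡ ν x
      even x = reflect-even h x (ν x)
      odd : ∀ x → + 2 ∣ x - 1ℤ → suc (value x ℕ.+ ν x) ≡ h ℕ.+ h
      odd x = reflect-odd h x (ν x) (ν<h x)

      even+ : ∀ x y → + 2 ∣ x → + 2 ∣ y → + 2 ∣ x + y
      even+ x y = ∣m∣n⇒∣m+n
      odd+ : ∀ x y → + 2 ∣ x - 1ℤ → + 2 ∣ y → + 2 ∣ x + y - 1ℤ
      odd+ x y 2∣x 2∣y = ∣-combine₂ 2∣x 2∣y 1ℤ 1ℤ (lemma x y)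
        where
        lemma : ∀ x y → 1ℤ * (x - 1ℤ) + 1ℤ * y ≡ x + y - 1ℤ
        lemma = solve-∀
      even+odd : ∀ x y → + 2 ∣ x → + 2 ∣ y - 1ℤ → + 2 ∣ x + y - 1ℤ
      even+odd x y 2∣x 2∣y = ∣-combine₂ 2∣x 2∣y 1ℤ 1ℤ (lemma x y)
        where
        lemma : ∀ x y → 1ℤ * x + 1ℤ * (y - 1ℤ) ≡ x + y - 1ℤ
        lemma = solve-∀
      odd+odd : ∀ x y → + 2 ∣ x - 1ℤ → + 2 ∣ y - 1ℤ → + 2 ∣ x + y
      odd+odd x y 2∣x 2∣y = ∣-combine₃ 2∣x 2∣y (∣-refl {+ 2}) 1ℤ 1ℤ 1ℤ (lemma x y)
        where
        lemma : ∀ x y → 1ℤ * (x - 1ℤ) + 1ℤ * (y - 1ℤ) + 1ℤ * + 2 ≡ x + y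
        lemma = solve-∀
      1-odd : + 2 ∣ 1ℤ - 1ℤ
      1-odd = divides 0ℤ refl
      -1-odd : + 2 ∣ -1ℤ - 1ℤ
      -1-odd = divides -1ℤ refl
      -c-even : + 2 ∣ - + c
      -c-even = ∣m⇒∣-m c-even

      -- `x` and `x ± c` have one parity, `x + h` and `x ± 1` the other. By `ν-h` and `ν-c` both
      -- triples have the same sum of `ν`, and one of them is complemented, which leaves
      -- `3 (2 h − 1)`.
      magic : ∀ x → + 2 ∣ x ⊎ + 2 ∣ x - 1ℤ →
              value x ℕ.+ (value (x + 1ℤ) ℕ.+ value (x - 1ℤ)) ℕ.+ (value (x + + c) ℕ.+ value (x - + c)) ℕ.+ value (x + + h) ℕ.+ 3 ≡ 3 ℕ.* (h ℕ.+ h)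
      magic x (inj₁ x-even) = by-addingℕ
        (cong₂ ℕ._+_ (cong₂ ℕ._+_ (cong₂ ℕ._+_ (odd (x + 1ℤ) (even+odd x 1ℤ x-even 1-odd)) (odd (x - 1ℤ) (even+odd x -1ℤ x-even -1-odd)))
                                  (trans (cong (λ w → suc (value (x + + h) ℕ.+ w)) (sym (ν-h x))) (odd (x + + h) (even+odd x (+ h) x-even h-odd))))
          (trans (cong₂ ℕ._+_ (even x x-even) (cong₂ ℕ._+_ (even (x + + c) (even+ x (+ c) x-even c-even)) (even (x - + c) (even+ x (- + c) x-even -c-even)))) (cong (ν x ℕ.+_) (ν-c x))))
        (lemma (value x) (value (x + 1ℤ)) (value (x - 1ℤ)) (value (x + + c)) (value (x - + c)) (value (x + + h)) (h ℕ.+ h) (ν x) (ν (x + 1ℤ)) (ν (x - 1ℤ)))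
        where
        lemma : ∀ f f₊ f₋ fc fc₋ fh s v v₊ v₋ → f ℕ.+ (f₊ ℕ.+ f₋) ℕ.+ (fc ℕ.+ fc₋) ℕ.+ fh ℕ.+ 3 ℕ.+ (s ℕ.+ s ℕ.+ s ℕ.+ (v ℕ.+ (v₊ ℕ.+ v₋))) ≡
                3 ℕ.* s ℕ.+ (suc (f₊ ℕ.+ v₊) ℕ.+ suc (f₋ ℕ.+ v₋) ℕ.+ suc (fh ℕ.+ v) ℕ.+ (f ℕ.+ (fc ℕ.+ fc₋)))
        lemma = ℕSolver.solve-∀
      magic x (inj₂ x-odd) = by-addingℕ
        (cong₂ ℕ._+_ (cong₂ ℕ._+_ (odd x x-odd) (cong₂ ℕ._+_ (odd (x + + c) (odd+ x (+ c) x-odd c-even)) (odd (x - + c) (odd+ x (- + c) x-odd -c-even))))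
          (cong₂ ℕ._+_ (trans (even (x + + h) (odd+odd x (+ h) x-odd h-odd)) (ν-h x))
            (trans (cong₂ ℕ._+_ (even (x + 1ℤ) (odd+odd x 1ℤ x-odd 1-odd)) (even (x - 1ℤ) (odd+odd x -1ℤ x-odd -1-odd))) (sym (ν-c x)))))
        (lemma (value x) (value (x + 1ℤ)) (value (x - 1ℤ)) (value (x + + c)) (value (x - + c)) (value (x + + h)) (h ℕ.+ h) (ν x) (ν (x + + c)) (ν (x - + c)))
        where
        lemma : ∀ f f₊ f₋ fc fc₋ fh s v vc vc₋ → f ℕ.+ (f₊ ℕ.+ f₋) ℕ.+ (fc ℕ.+ fc₋) ℕ.+ fh ℕ.+ 3 ℕ.+ (s ℕ.+ (s ℕ.+ s) ℕ.+ (v ℕ.+ (vc ℕ.+ vc₋))) ≡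
                3 ℕ.* s ℕ.+ (suc (f ℕ.+ v) ℕ.+ (suc (fc ℕ.+ vc) ℕ.+ suc (fc₋ ℕ.+ vc₋)) ℕ.+ (fh ℕ.+ (f₊ ℕ.+ f₋)))
        lemma = ℕSolver.solve-∀

  -- The labelling for cases (iii) and (iv)

  %ℕ3-sum : ∀ x → x %ℕ 3 ℕ.+ ((x + 1ℤ) %ℕ 3 ℕ.+ (x - 1ℤ) %ℕ 3) ≡ 3
  %ℕ3-sum x = by-remainder (mod-3 x)
    where
    lemma : ∀ x y z → x + y - (z + y) ≡ x - z
    lemma = solve-∀
    residues : ∀ z → + 3 ∣ x - z → ∀ y → (x + y) %ℕ 3 ≡ (z + y) %ℕ 3
    residues z 3∣ y = %ℕ-cong (x + y) (z + y) (subst (+ 3 ∣_) (sym (lemma x y z)) 3∣)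
    sum≡ : ∀ z → + 3 ∣ x - z → x %ℕ 3 ℕ.+ ((x + 1ℤ) %ℕ 3 ℕ.+ (x - 1ℤ) %ℕ 3) ≡ z %ℕ 3 ℕ.+ ((z + 1ℤ) %ℕ 3 ℕ.+ (z - 1ℤ) %ℕ 3)
    sum≡ z 3∣ = cong₂ ℕ._+_ (%ℕ-cong x z 3∣) (cong₂ ℕ._+_ (residues z 3∣ 1ℤ) (residues z 3∣ -1ℤ))
    by-remainder : + 3 ∣ x ⊎ + 3 ∣ x - 1ℤ ⊎ + 3 ∣ x + 1ℤ → x %ℕ 3 ℕ.+ ((x + 1ℤ) %ℕ 3 ℕ.+ (x - 1ℤ) %ℕ 3) ≡ 3
    by-remainder (inj₁ 3∣) = sum≡ 0ℤ (subst (+ 3 ∣_) (sym (ℤ.+-identityʳ x)) 3∣)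
    by-remainder (inj₂ (inj₁ 3∣)) = sum≡ 1ℤ 3∣
    by-remainder (inj₂ (inj₂ 3∣)) = sum≡ -1ℤ 3∣

  sign-pair : ∀ (φ : ℤ → ℕ) {ε} → ε ≡ 1ℤ ⊎ ε ≡ -1ℤ → ∀ x → φ (x + ε) ℕ.+ φ (x - ε) ≡ φ (x + 1ℤ) ℕ.+ φ (x - 1ℤ)
  sign-pair φ (inj₁ refl) x = refl
  sign-pair φ (inj₂ refl) x = ℕ.+-comm (φ (x - 1ℤ)) (φ (x + 1ℤ))

  module _ (σ c : ℕ) .{{_ : ℕ.NonZero σ}} where

    -- ℤ/6σ ≅ ℤ/3 × ℤ/2σ; translations by h = 3σ and by c + ε = σ are antipodal on the second factor.
    caseIII-IV-labelling : ∀ {ε} → ε ≡ 1ℤ ⊎ ε ≡ -1ℤ → + c ≡ + σ - ε → + 3 ∣ + 2 * + σ - ε →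
                           Labelling (3 ℕ.* σ ℕ.+ 3 ℕ.* σ) (3 ℕ.* σ) c
    caseIII-IV-labelling {ε} ε-sign c≡ 3∣2σ-ε = record
      { value     = value
      ; bounded   = λ x → subst (value x ℕ.<_) (size σ) (digits-bounded (n%ℕd<d x 3) (zigzag-bounded σ x))
      ; respects  = λ x y n∣ → cong₂ (λ i j → i ℕ.+ j ℕ.* 3) (%ℕ-cong x y (∣-trans 3∣n n∣)) (zigzag-respects σ x y (∣-trans 2σ∣n n∣))
      ; injective = injective
      ; total     = 18 ℕ.* σ ℕ.+ 6
      ; excess    = 9
      ; magic     = magic
      }
      where
      h = 3 ℕ.* σ
      n = + (h ℕ.+ h)
      e = zigzag σ
      +h : + h ≡ + 3 * + σ
      +h = ℤ.pos-* 3 σ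
      n≡ : n ≡ + 3 * (+ σ + + σ)
      n≡ = trans (cong₂ _+_ +h +h) (sym (ℤ.*-distribˡ-+ (+ 3) (+ σ) (+ σ)))
      3∣n : + 3 ∣ n
      3∣n = subst (+ 3 ∣_) (sym n≡) (∣m⇒∣m*n (+ σ + + σ) ∣-refl)
      2σ∣n : + σ + + σ ∣ n
      2σ∣n = subst (+ σ + + σ ∣_) (sym n≡) (∣n⇒∣m*n (+ 3) ∣-refl)
      size : ∀ σ → 3 ℕ.* (σ ℕ.+ σ) ≡ 3 ℕ.* σ ℕ.+ 3 ℕ.* σ
      size = ℕSolver.solve-∀

      3∤ε : ¬ + 3 ∣ ε
      3∤ε = by-sign ε-sign
        where
        by-sign : ∀ {ε} → ε ≡ 1ℤ ⊎ ε ≡ -1ℤ → ¬ + 3 ∣ ε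
        by-sign (inj₁ refl) 3∣ = 3∤1 3∣
        by-sign (inj₂ refl) 3∣ = 3∤1 (∣m⇒∣-m 3∣)

      value : ℤ → ℕ
      value x = x %ℕ 3 ℕ.+ e x ℕ.* 3

      injective : ∀ x y → value x ≡ value y → n ∣ x - y
      injective x y eq = subst (_∣ x - y) (trans (ℤ.*-comm (+ σ + + σ) (+ 3)) (sym n≡))
        (coprime-∣-* (bézout-3 3∤2σ) (zigzag-injective σ x y (proj₂ digits)) (%ℕ-injective {3} {x} {y} (proj₁ digits)))
        where
        digits = digits-injective {j = e x} {j′ = e y} (n%ℕd<d x 3) (n%ℕd<d y 3) eq
        lemma : ∀ σ ε → 1ℤ * (σ + σ) + -1ℤ * (+ 2 * σ - ε) ≡ ε
        lemma = solve-∀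
        3∤2σ : ¬ + 3 ∣ + σ + + σ
        3∤2σ 3∣ = 3∤ε (∣-combine₂ 3∣ 3∣2σ-ε 1ℤ -1ℤ (lemma (+ σ) ε))

      residues : ∀ x → (x + + c) %ℕ 3 ℕ.+ (x - + c) %ℕ 3 ≡ (x + 1ℤ) %ℕ 3 ℕ.+ (x - 1ℤ) %ℕ 3
      residues x = trans (cong₂ ℕ._+_
          (%ℕ-cong (x + + c) (x + ε) (∣-combine₃ 3∣2σ-ε (∣-refl {+ 3}) (∣-refl {+ 3}) -1ℤ (+ σ) (- ε)
            (trans (lemma₁ x (+ σ) ε) (cong (λ u → x + u - (x + ε)) (sym c≡)))))
          (%ℕ-cong (x - + c) (x - ε) (∣-combine₃ 3∣2σ-ε (∣-refl {+ 3}) (∣-refl {+ 3}) 1ℤ (- + σ) ε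
            (trans (lemma₂ x (+ σ) ε) (cong (λ u → x - u - (x - ε)) (sym c≡))))))
        (sign-pair (_%ℕ 3) ε-sign x)
        where
        lemma₁ : ∀ x σ ε → -1ℤ * (+ 2 * σ - ε) + σ * + 3 + - ε * + 3 ≡ x + (σ - ε) - (x + ε)
        lemma₁ = solve-∀
        lemma₂ : ∀ x σ ε → 1ℤ * (+ 2 * σ - ε) + - σ * + 3 + ε * + 3 ≡ x - (σ - ε) - (x - ε)
        lemma₂ = solve-∀

      -- Modulo 3, `h` acts as 0 and `±c` as `±1` in some order, so the low digits form two complete
      -- residue systems, with sum 6. The high digits form three antipodal pairs, each with sum
      -- `2 σ − 1`. Altogether `6 + 9 (2 σ − 1) = 18 σ − 3`.
      magic : ∀ x → value x ℕ.+ (value (x + 1ℤ) ℕ.+ value (x - 1ℤ)) ℕ.+ (value (x + + c) ℕ.+ value (x - + c)) ℕ.+ value (x + + h) ℕ.+ 9 ≡ 18 ℕ.* σ ℕ.+ 6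
      magic x = by-addingℕ
        (cong₂ ℕ._+_ (cong₂ ℕ._+_ (cong₂ ℕ._+_ (residues x) centre) (cong₂ ℕ._+_ (%ℕ3-sum x) (%ℕ3-sum x)))
          (cong (ℕ._* 3) (cong₂ ℕ._+_ (cong₂ ℕ._+_ antipodal₁ antipodal₂) (cong₂ ℕ._+_ antipodal₀ (sym (sign-pair e ε-sign x))))))
        (lemma (x %ℕ 3) ((x + 1ℤ) %ℕ 3) ((x - 1ℤ) %ℕ 3) ((x + + c) %ℕ 3) ((x - + c) %ℕ 3) ((x + + h) %ℕ 3)
               (e x) (e (x + 1ℤ)) (e (x - 1ℤ)) (e (x + + c)) (e (x - + c)) (e (x + + h)) (e (x + ε)) (e (x - ε)) σ)
        where
        lemma₀ : ∀ x σ → x + + 3 * σ - x - σ ≡ 1ℤ * (σ + σ)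
        lemma₀ = solve-∀
        lemma₁ : ∀ x σ ε → x + (σ - ε) - (x - ε) - σ ≡ 0ℤ * (σ + σ)
        lemma₁ = solve-∀
        lemma₂ : ∀ x σ ε → x + ε - (x - (σ - ε)) - σ ≡ 0ℤ * (σ + σ)
        lemma₂ = solve-∀
        lemma₃ : ∀ x h → h ≡ x + h - x
        lemma₃ = solve-∀
        centre : (x + + h) %ℕ 3 ≡ x %ℕ 3
        centre = %ℕ-cong (x + + h) x (subst (+ 3 ∣_) (trans (sym +h) (lemma₃ x (+ h))) (∣m⇒∣m*n (+ σ) ∣-refl))
        antipodal₀ : suc (e (x + + h) ℕ.+ e x) ≡ σ ℕ.+ σ
        antipodal₀ = zigzag-antipodal σ (x + + h) x (divides 1ℤ (trans (cong (λ u → x + u - x - + σ) +h) (lemma₀ x (+ σ))))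
        antipodal₁ : suc (e (x + + c) ℕ.+ e (x - ε)) ≡ σ ℕ.+ σ
        antipodal₁ = zigzag-antipodal σ (x + + c) (x - ε) (divides 0ℤ (trans (cong (λ u → x + u - (x - ε) - + σ) c≡) (lemma₁ x (+ σ) ε)))
        antipodal₂ : suc (e (x + ε) ℕ.+ e (x - + c)) ≡ σ ℕ.+ σ
        antipodal₂ = zigzag-antipodal σ (x + ε) (x - + c) (divides 0ℤ (trans (cong (λ u → x + ε - (x - u) - + σ) c≡) (lemma₂ x (+ σ) ε)))
        lemma : ∀ r r₊ r₋ rc rc₋ rh z z₊ z₋ zc zc₋ zh zε zε₋ σ →
          r ℕ.+ z ℕ.* 3 ℕ.+ (r₊ ℕ.+ z₊ ℕ.* 3 ℕ.+ (r₋ ℕ.+ z₋ ℕ.* 3)) ℕ.+ (rc ℕ.+ zc ℕ.* 3 ℕ.+ (rc₋ ℕ.+ zc₋ ℕ.* 3)) ℕ.+ (rh ℕ.+ zh ℕ.* 3) ℕ.+ 9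
            ℕ.+ (r₊ ℕ.+ r₋ ℕ.+ r ℕ.+ (3 ℕ.+ 3) ℕ.+ (σ ℕ.+ σ ℕ.+ (σ ℕ.+ σ) ℕ.+ (σ ℕ.+ σ ℕ.+ (zε ℕ.+ zε₋))) ℕ.* 3)
          ≡ 18 ℕ.* σ ℕ.+ 6
            ℕ.+ (rc ℕ.+ rc₋ ℕ.+ rh ℕ.+ (r ℕ.+ (r₊ ℕ.+ r₋) ℕ.+ (r ℕ.+ (r₊ ℕ.+ r₋))) ℕ.+ (suc (zc ℕ.+ zε₋) ℕ.+ suc (zε ℕ.+ zc₋) ℕ.+ (suc (zh ℕ.+ z) ℕ.+ (z₊ ℕ.+ z₋))) ℕ.* 3)
        lemma = ℕSolver.solve-∀

  -- From the four cases to a labelling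

  double-injectiveℕ : ∀ {m k} → m ℕ.+ m ≡ k ℕ.+ k → m ≡ k
  double-injectiveℕ eq = ℤ.+-injective (double-injective (cong +_ eq))

  +pred : ∀ m .{{_ : ℕ.NonZero m}} → + (m ℕ.∸ 1) ≡ + m - 1ℤ
  +pred (suc m) = lemma (+ m)
    where
    lemma : ∀ m → m ≡ 1ℤ + m - 1ℤ
    lemma = solve-∀

  module _ (h c : ℕ) .{{_ : ℕ.NonZero h}} (1<c : 1 ℕ.< c) where

    open NormalForm h

    -- `h` divides `(c + 1)(c − 1)`; splitting it along this product gives one modulus on which `c`
    -- is `−1` and one on which `c` is `1`.
    caseII⇒labelling : CaseII (h ℕ.+ h) c → Labelling (h ℕ.+ h) h c
    caseII⇒labelling (n%4≡2 , 2∣c , j , eq) = from-split (split-divisor (suc c) (c ℕ.∸ 1) h h∣)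
      where
      instance
        c≢0 : ℕ.NonZero c
        c≢0 = ℕ.>-nonZero (ℕ.<-trans ℕ.z<s 1<c)
      c²≡ : ∀ c .{{_ : ℕ.NonZero c}} → c ℕ.^ 2 ℕ.∸ 1 ≡ suc c ℕ.* (c ℕ.∸ 1)
      c²≡ (suc m) = lemma m
        where
        lemma : ∀ m → m ℕ.* 1 ℕ.+ m ℕ.* (suc m ℕ.* 1) ≡ suc (suc m) ℕ.* m
        lemma = ℕSolver.solve-∀
      lemma₁ : ∀ j h → (1 ℕ.+ 2 ℕ.* j) ℕ.* (h ℕ.+ h) ≡ (1 ℕ.+ 2 ℕ.* j) ℕ.* h ℕ.+ (1 ℕ.+ 2 ℕ.* j) ℕ.* h
      lemma₁ = ℕSolver.solve-∀
      lemma₂ : ∀ x → x ℕ.+ x ≡ 2 ℕ.* x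
      lemma₂ = ℕSolver.solve-∀
      h∣ : h ℕ.∣ suc c ℕ.* (c ℕ.∸ 1)
      h∣ = ℕ.divides (1 ℕ.+ 2 ℕ.* j) (trans (sym (c²≡ c)) (double-injectiveℕ (trans (lemma₂ (c ℕ.^ 2 ℕ.∸ 1)) (trans eq (lemma₁ j h)))))
      h-odd : ∀ h → (h ℕ.+ h) ℕ.% 4 ≡ 2 → + 2 ∣ + h - 1ℤ
      h-odd h n% with parityℕ h
      ... | k , inj₂ refl = divides (+ k) (lemma (+ k))
        where
        lemma : ∀ k → 1ℤ + (k + k) - 1ℤ ≡ k * + 2
        lemma = solve-∀
      ... | k , inj₁ refl = contradiction (trans (sym (trans (cong (ℕ._% 4) (lemma k)) (ℕ.m*n%n≡0 k 4))) n%) λ ()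
        where
        lemma : ∀ k → k ℕ.+ k ℕ.+ (k ℕ.+ k) ≡ k ℕ.* 4
        lemma = ℕSolver.solve-∀
      from-split : ∃[ u ] ∃[ v ] h ≡ u ℕ.* v × (u ℕ.∣ suc c) × (v ℕ.∣ c ℕ.∸ 1) → Labelling (h ℕ.+ h) h c
      from-split (u , v , h≡uv , u∣ , v∣) = subst (λ h → Labelling (h ℕ.+ h) h c) (sym h≡uv)
        (caseII-labelling u v c {{ℕ.m*n≢0⇒m≢0 u}} {{ℕ.m*n≢0⇒n≢0 u}}
          (subst (λ h → + 2 ∣ + h - 1ℤ) h≡uv (h-odd h n%4≡2)) (∣ᵤ⇒∣ 2∣c)
          (subst (+ u ∣_) (ℤ.+-comm 1ℤ (+ c)) (∣ᵤ⇒∣ u∣)) (subst (+ v ∣_) (+pred c) (∣ᵤ⇒∣ v∣)))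
        where
        instance
          uv≢0 : ℕ.NonZero (u ℕ.* v)
          uv≢0 = subst ℕ.NonZero h≡uv (ℕ.≢-nonZero (ℕ.≢-nonZero⁻¹ h))

    caseIII-IV⇒labelling : ∀ σ .{{_ : ℕ.NonZero σ}} {ε} → ε ≡ 1ℤ ⊎ ε ≡ -1ℤ → ∀ t k → 2 ℕ.≤ t → + c ≡ + σ - ε →
      + σ ≡ (+ 2) ^ (t ℕ.∸ 1) * (+ 6 * + k + ε * -1ℤ ^ t) → + (h ℕ.+ h) ≡ + 3 * (+ 2) ^ t * (+ 6 * + k + ε * -1ℤ ^ t) →
      Labelling (h ℕ.+ h) h c
    caseIII-IV⇒labelling σ {ε} ε-sign t@(suc e) k _ c≡ σ≡ n≡ = subst (λ h → Labelling (h ℕ.+ h) h c) (sym h≡)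
      (caseIII-IV-labelling σ c ε-sign c≡ 3∣)
      where
      a = + 6 * + k + ε * -1ℤ ^ t
      ω = -1ℤ ^ t
      lemma₁ : ∀ x a → + 3 * (+ 2 * x) * a ≡ + 3 * (x * a) + + 3 * (x * a)
      lemma₁ = solve-∀
      h≡ : h ≡ 3 ℕ.* σ
      h≡ = double-injectiveℕ (ℤ.+-injective (trans n≡ (trans (lemma₁ ((+ 2) ^ e) a)
        (cong (λ u → u + u) (trans (cong (_*_ (+ 3)) (sym σ≡)) (sym (ℤ.pos-* 3 σ)))))))
      ω² : ω ≡ 1ℤ ⊎ ω ≡ -1ℤ → ω * ω ≡ 1ℤ
      ω² (inj₁ w) = cong₂ _*_ w w
      ω² (inj₂ w) = cong₂ _*_ w w
      -- Modulo 3, `2 σ = 2^t a ≡ ω a ≡ ε ω² = ε`, because `2 ≡ −1`.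
      3∣ : + 3 ∣ + 2 * + σ - ε
      3∣ = ∣-combine₂ (2^-mod-3 t) (∣-refl {+ 3}) a (+ 2 * + k * ω)
        (trans (by-adding (sym (cong (ε *_) (ω² (-1^ t)))) (lemma ((+ 2) ^ e) ω (+ k) ε)) (cong (λ u → + 2 * u - ε) (sym σ≡)))
        where
        lemma : ∀ x ω k ε → (+ 6 * k + ε * ω) * (+ 2 * x - ω) + + 2 * k * ω * + 3 + ε * (ω * ω) ≡
                + 2 * (x * (+ 6 * k + ε * ω)) - ε + ε * 1ℤ
        lemma = solve-∀

    cases⇒labelling : Cases c → Labelling (h ℕ.+ h) h c
    cases⇒labelling (inj₁ c≡) = caseI-labelling h c (trans (cong +_ (trans c≡ (cong (ℕ._∸ 1) n/2≡h))) (+pred h))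
    cases⇒labelling (inj₂ (inj₁ caseII)) = caseII⇒labelling caseII
    cases⇒labelling (inj₂ (inj₂ (inj₁ (t , k , 2≤t , (n≡ , c≡) , _)))) =
      caseIII-IV⇒labelling (suc c) (inj₁ refl) t k 2≤t (lemma₁ (+ c))
        (trans (trans (ℤ.+-comm 1ℤ (+ c)) (cong (λ u → u + 1ℤ) c≡)) (trans (lemma₂ _) (cong (λ u → (+ 2) ^ (t ℕ.∸ 1) * (+ 6 * + k + u)) (sym (ℤ.*-identityˡ (-1ℤ ^ t))))))
        (trans n≡ (cong (λ u → + 3 * (+ 2) ^ t * (+ 6 * + k + u)) (sym (ℤ.*-identityˡ (-1ℤ ^ t)))))
      where
      lemma₁ : ∀ c → c ≡ 1ℤ + c - 1ℤ
      lemma₁ = solve-∀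
      lemma₂ : ∀ x → x - 1ℤ + 1ℤ ≡ x
      lemma₂ = solve-∀
    cases⇒labelling (inj₂ (inj₂ (inj₂ (t , k , 2≤t , (n≡ , c≡) , _)))) =
      caseIII-IV⇒labelling (c ℕ.∸ 1) (inj₂ refl) t k 2≤t (trans (lemma₁ (+ c)) (cong (λ u → u + 1ℤ) (sym (+pred c))))
        (trans (trans (+pred c) (cong (_- 1ℤ) c≡)) (trans (lemma₂ _) (cong (λ u → (+ 2) ^ (t ℕ.∸ 1) * (+ 6 * + k + u)) (sym (ℤ.-1*i≡-i (-1ℤ ^ t))))))
        (trans n≡ (cong (λ u → + 3 * (+ 2) ^ t * (+ 6 * + k + u)) (sym (ℤ.-1*i≡-i (-1ℤ ^ t)))))
      where
      instance
        c≢0 : ℕ.NonZero c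
        c≢0 = ℕ.>-nonZero (ℕ.<-trans ℕ.z<s 1<c)
        c-1≢0 : ℕ.NonZero (c ℕ.∸ 1)
        c-1≢0 = ℕ.>-nonZero (ℕ.m<n⇒0<n∸m 1<c)
      lemma₁ : ∀ c → c ≡ c - 1ℤ + 1ℤ
      lemma₁ = solve-∀
      lemma₂ : ∀ x → x + 1ℤ - 1ℤ ≡ x
      lemma₂ = solve-∀

  -- Graphs

  ∑-at : ∀ {n} (w : Fin n → ℕ) x → ∑[ y < n ] (if does (y ≟ᶠ x) then w y else 0) ≡ w x
  ∑-at {suc n} w fzero    = trans (cong (w fzero ℕ.+_) (sum-replicate-zero n)) (ℕ.+-identityʳ (w fzero))
  ∑-at {suc n} w (fsuc x) = ∑-at (w ∘ fsuc) x

  module _ {n : ℕ} where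

    open DecMembership (_≟ᶠ_ {n}) using (_∈?_)

    ∑-list : (w : Fin n → ℕ) {P : Pred (Fin n) _} (P? : Decidable P) (xs : List (Fin n)) → Unique xs → (∀ x → P x ⇔ x ∈ xs) →
             ∑[ x < n ] (if does (P? x) then w x else 0) ≡ sum (map w xs)
    ∑-list w P? [] [] P⇔ = trans (sum-cong-≗ none) (sum-replicate-zero n)
      where
      none : ∀ x → (if does (P? x) then w x else 0) ≡ 0
      none x with P? x
      ... | yes px = contradiction (Equivalence.to (P⇔ x) px) λ ()
      ... | no  _  = refl
    ∑-list w P? (y ∷ ys) (y∉ys ∷ unique) P⇔ = begin
      ∑[ x < n ] (if does (P? x) then w x else 0)
        ≡⟨ sum-cong-≗ split ⟩
      ∑[ x < n ] ((if does (x ≟ᶠ y) then w x else 0) ℕ.+ (if does (x ∈? ys) then w x else 0))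
        ≡⟨ ∑-distrib-+ (λ x → if does (x ≟ᶠ y) then w x else 0) (λ x → if does (x ∈? ys) then w x else 0) ⟩
      ∑[ x < n ] (if does (x ≟ᶠ y) then w x else 0) ℕ.+ ∑[ x < n ] (if does (x ∈? ys) then w x else 0)
        ≡⟨ cong₂ ℕ._+_ (∑-at w y) (∑-list w (_∈? ys) ys unique (λ x → mk⇔ id id)) ⟩
      sum (map w (y ∷ ys)) ∎
      where
      open ≡-Reasoning
      split : ∀ x → (if does (P? x) then w x else 0) ≡ (if does (x ≟ᶠ y) then w x else 0) ℕ.+ (if does (x ∈? ys) then w x else 0)
      split x with P? x | x ≟ᶠ y | x ∈? ys
      ... | _      | yes refl | yes x∈ = contradiction x∈ (All¬⇒¬Any y∉ys)
      ... | yes _  | yes refl | no _   = sym (ℕ.+-identityʳ (w x))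
      ... | no ¬px | yes refl | no _   = contradiction (Equivalence.from (P⇔ x) (here refl)) ¬px
      ... | yes _  | no _     | yes _  = refl
      ... | yes px | no x≢y   | no x∉  with Equivalence.to (P⇔ x) px
      ...   | here x≡y  = contradiction x≡y x≢y
      ...   | there x∈  = contradiction x∈ x∉
      split x | no ¬px | no _ | yes x∈ = contradiction (Equivalence.from (P⇔ x) (there x∈)) ¬px
      split x | no _   | no _ | no _   = refl

    Unique-resp-↭ : ∀ {xs ys : List (Fin n)} → xs ↭ ys → Unique xs → Unique ys
    Unique-resp-↭ xs↭ys = Permutationₛ.Unique-resp-↭ (setoid (Fin n)) (↭⇒↭ₛ xs↭ys)

    module _ (ι : Fin n → Fin n) (involutive : ∀ x → ι (ι x) ≡ x) where

      -- An element moved by `ι` is removed together with its image, which may sit anywhere in the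
      -- tail; hence the recursion on a bound `k` for the length.
      pairing : ∀ k xs → length xs ℕ.≤ k → Unique xs → (∀ {x} → x ∈ xs → ι x ∈ xs) →
                ∃[ ys ] ∃[ zs ] xs ↭ ys ++ map ι ys ++ zs × All (λ z → ι z ≡ z) zs
      pairing _ [] _ _ _ = [] , [] , ↭-refl , []
      pairing (suc k) (x ∷ xs) (ℕ.s≤s ≤k) (x∉xs ∷ unique) closed with ι x ≟ᶠ x
      ... | yes fixed = extend (pairing k xs ≤k unique closed′)
        where
        closed′ : ∀ {y} → y ∈ xs → ι y ∈ xs
        closed′ {y} y∈ with closed (there y∈)
        ... | there ιy∈ = ιy∈
        ... | here ιy≡x = contradiction (subst (_∈ xs) (trans (sym (involutive y)) (trans (cong ι ιy≡x) fixed)) y∈) (All¬⇒¬Any x∉xs)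
        extend : ∃[ ys ] ∃[ zs ] xs ↭ ys ++ map ι ys ++ zs × All (λ z → ι z ≡ z) zs →
                 ∃[ ys ] ∃[ zs ] x ∷ xs ↭ ys ++ map ι ys ++ zs × All (λ z → ι z ≡ z) zs
        extend (ys , zs , xs↭ , fixeds) = ys , x ∷ zs ,
          ↭-trans (prep x xs↭) (↭-sym (↭-trans (++⁺ˡ ys (shift x (map ι ys) zs)) (shift x ys (map ι ys ++ zs)))) ,
          fixed ∷ fixeds
      ... | no moved with closed (here refl)
      ...   | here ιx≡x = contradiction ιx≡x moved
      ...   | there ιx∈ with ∈-∃++ ιx∈
      ...     | as , bs , refl = extend (pairing k (as ++ bs) (ℕ.≤-trans (ℕ.n≤1+n _) (subst (ℕ._≤ k) (↭-length xs↭) ≤k)) (AllPairs.tail unique′) closed′)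
        where
        xs↭ : as ++ ι x ∷ bs ↭ ι x ∷ as ++ bs
        xs↭ = shift (ι x) as bs
        unique′ : Unique (ι x ∷ as ++ bs)
        unique′ = Unique-resp-↭ xs↭ unique
        closed′ : ∀ {y} → y ∈ as ++ bs → ι y ∈ as ++ bs
        closed′ {y} y∈ with closed (there (∈-resp-↭ (↭-sym xs↭) (there y∈)))
        ... | here ιy≡x = contradiction (subst (_∈ as ++ bs) (trans (sym (involutive y)) (cong ι ιy≡x)) y∈) (All¬⇒¬Any (AllPairs.head unique′))
        ... | there ιy∈ with ∈-resp-↭ xs↭ ιy∈
        ...   | there ιy∈′ = ιy∈′
        ...   | here ιy≡ιx = contradiction
          (∈-resp-↭ (↭-sym xs↭) (there (subst (_∈ as ++ bs) (trans (sym (involutive y)) (trans (cong ι ιy≡ιx) (involutive x))) y∈))) (All¬⇒¬Any x∉xs)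
        extend : ∃[ ys ] ∃[ zs ] as ++ bs ↭ ys ++ map ι ys ++ zs × All (λ z → ι z ≡ z) zs →
                 ∃[ ys ] ∃[ zs ] x ∷ as ++ ι x ∷ bs ↭ ys ++ map ι ys ++ zs × All (λ z → ι z ≡ z) zs
        extend (ys , zs , ↭ys , fixeds) = x ∷ ys , zs ,
          prep x (↭-trans xs↭ (↭-trans (prep (ι x) ↭ys) (↭-sym (shift (ι x) ys (map ι ys ++ zs))))) , fixeds

  -- Subsets as lists, and permutations from injections

  elements : ∀ {n} → Subset n → List (Fin n)
  elements []            = []
  elements (inside  ∷ p) = fzero ∷ map fsuc (elements p)
  elements (outside ∷ p) = map fsuc (elements p)

  length-elements : ∀ {n} (p : Subset n) → length (elements p) ≡ card p
  length-elements []            = refl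
  length-elements (inside  ∷ p) = cong suc (trans (List.length-map fsuc (elements p)) (length-elements p))
  length-elements (outside ∷ p) = trans (List.length-map fsuc (elements p)) (length-elements p)

  ∈-elements⁺ : ∀ {n} (p : Subset n) {x} → x ∈ˢ p → x ∈ elements p
  ∈-elements⁺ (inside  ∷ p) here       = here refl
  ∈-elements⁺ (inside  ∷ p) (there x∈) = there (∈-map⁺ fsuc (∈-elements⁺ p x∈))
  ∈-elements⁺ (outside ∷ p) (there x∈) = ∈-map⁺ fsuc (∈-elements⁺ p x∈)

  ∈-elements⁻ : ∀ {n} (p : Subset n) {x} → x ∈ elements p → x ∈ˢ p
  ∈-elements⁻ (inside  ∷ p) (here refl) = here
  ∈-elements⁻ (inside  ∷ p) (there x∈) with ∈-map⁻ fsuc x∈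
  ... | _ , y∈ , refl = there (∈-elements⁻ p y∈)
  ∈-elements⁻ (outside ∷ p) x∈ with ∈-map⁻ fsuc x∈
  ... | _ , y∈ , refl = there (∈-elements⁻ p y∈)

  elements-unique : ∀ {n} (p : Subset n) → Unique (elements p)
  elements-unique []            = []
  elements-unique (inside  ∷ p) = ¬Any⇒All¬ _ (λ 0∈ → zero∉ (∈-map⁻ fsuc 0∈)) ∷ Unique.map⁺ fsuc-injective (elements-unique p)
    where
    zero∉ : ¬ (∃[ y ] y ∈ elements p × fzero ≡ fsuc y)
    zero∉ (_ , _ , ())
  elements-unique (outside ∷ p) = Unique.map⁺ fsuc-injective (elements-unique p)

  -- By the pigeonhole principle: a missed value could be punched out, leaving an injection into a
  -- smaller set.
  injective⇒permutation : ∀ {n} (f : Fin n → Fin n) → (∀ {x y} → f x ≡ f y → x ≡ y) → Permutation′ n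
  injective⇒permutation {n} f injective = permutation f (proj₁ ∘ surjective)
    (λ y → proj₂ (surjective y)) (λ x → injective (proj₂ (surjective (f x))))
    where
    surjective : ∀ y → ∃[ x ] f x ≡ y
    surjective y with any? (λ x → f x ≟ᶠ y)
    ... | yes hit  = hit
    ... | no  miss = impossible f injective y (λ x y≡fx → miss (x , sym y≡fx))
      where
      impossible : ∀ {n} (f : Fin n → Fin n) → (∀ {x y} → f x ≡ f y → x ≡ y) → ∀ y → (∀ x → y ≢ f x) → ∃[ x ] f x ≡ y
      impossible {suc n} f injective y avoids = contradiction
        (injective⇒≤ {f = λ x → punchOut (avoids x)} (λ {x} {x′} eq → injective (punchOut-injective (avoids x) (avoids x′) eq))) ℕ.1+n≰n

  -- Graphs in cyclic coordinates

  module _ {m : ℕ} (Γ : Graph m) (n : ℕ) .{{_ : ℕ.NonZero n}} where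

    open Graph Γ

    Difference : List ℤ → Fin n → Fin n → Set
    Difference L g g′ = Any (λ l → + n ∣ + toℕ g′ - (+ toℕ g + l)) L

    -- A Cayley isomorphism in which the connection set is a list of integers modulo `n`. Rescaling
    -- and arithmetic on the set can thus be done in the integers.
    record Coordinates (L : List ℤ) : Set where
      field
        vertices : Fin m ↔ Fin n
      index : Fin m → Fin n
      index = Inverse.to vertices
      vertex : Fin n → Fin m
      vertex = Inverse.from vertices
      field
        edges : ∀ u v → Adj u v ⇔ Difference L (index u) (index v)

      index-vertex : ∀ g → index (vertex g) ≡ g
      index-vertex = Inverse.strictlyInverseˡ vertices

      vertex-index : ∀ u → vertex (index u) ≡ u
      vertex-index = Inverse.strictlyInverseʳ vertices

      translate : Fin m → ℤ → Fin m
      translate u l = vertex [ + toℕ (index u) + l ]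

      neighbourhood-sum : (w : Fin m → ℕ) → Unique (map ([_] {n}) (0ℤ ∷ L)) → ∀ u →
        ∑[ x < m ] (if does (N[ u ]? x) then w x else 0) ≡ sum (map w (map (translate u) (0ℤ ∷ L)))
      neighbourhood-sum w unique u = ∑-list w N[ u ]? (map (translate u) (0ℤ ∷ L)) distinct (λ x → mk⇔ listed unlisted)
        where
        vertex-injective : ∀ {g g′} → vertex g ≡ vertex g′ → g ≡ g′
        vertex-injective {g} {g′} eq = trans (sym (index-vertex g)) (trans (cong index eq) (index-vertex g′))
        shift-injective : ∀ {g g′} → [ + toℕ (index u) + + toℕ g ] ≡ [ + toℕ (index u) + + toℕ g′ ] → g ≡ g′
        shift-injective {g} {g′} eq = trans (sym ([toℕ] g)) (trans
          ([]-≈ {n} (+ toℕ g) (+ toℕ g′) (subst (+ n ∣_) (lemma (+ toℕ (index u)) (+ toℕ g) (+ toℕ g′)) ([]-≈⁻¹ {n} (+ toℕ (index u) + + toℕ g) (+ toℕ (index u) + + toℕ g′) eq))) ([toℕ] g′))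
          where
          lemma : ∀ u g g′ → u + g - (u + g′) ≡ g - g′
          lemma = solve-∀
        translate≡ : ∀ l → vertex [ + toℕ (index u) + + toℕ ([_] {n} l) ] ≡ translate u l
        translate≡ l = cong vertex ([]-≈ {n} (+ toℕ (index u) + + toℕ ([_] {n} l)) (+ toℕ (index u) + l) (subst (+ n ∣_) (lemma (+ toℕ (index u)) (+ toℕ ([_] {n} l)) l) (toℕ[]-≈ {n} l)))
          where
          lemma : ∀ u t l → t - l ≡ u + t - (u + l)
          lemma = solve-∀
        distinct : Unique (map (translate u) (0ℤ ∷ L))
        distinct = subst Unique (trans (sym (List.map-∘ (0ℤ ∷ L))) (List.map-cong translate≡ (0ℤ ∷ L)))
          (Unique.map⁺ (shift-injective ∘ vertex-injective) unique)
        translate-0 : translate u 0ℤ ≡ u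
        translate-0 = trans (cong vertex (trans (cong [_] (ℤ.+-identityʳ (+ toℕ (index u)))) ([toℕ] (index u)))) (vertex-index u)
        listed : ∀ {x} → N[ u ] x → x ∈ map (translate u) (0ℤ ∷ L)
        listed (inj₁ refl) = here (sym translate-0)
        listed {x} (inj₂ adj) = there (Any.map⁺ (Any.map (λ {l} → reach l) (Equivalence.to (edges u x) adj)))
          where
          reach : ∀ l → + n ∣ + toℕ (index x) - (+ toℕ (index u) + l) → x ≡ translate u l
          reach l n∣ = trans (sym (vertex-index x)) (cong vertex (trans (sym ([toℕ] (index x))) ([]-≈ {n} (+ toℕ (index x)) (+ toℕ (index u) + l) n∣)))
        unlisted : ∀ {x} → x ∈ map (translate u) (0ℤ ∷ L) → N[ u ] x
        unlisted (here refl) = inj₁ translate-0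
        unlisted {x} (there x∈) = inj₂ (Equivalence.from (edges u x) (Any.map (λ {l} → reach l) (Any.map⁻ x∈)))
          where
          reach : ∀ l → x ≡ translate u l → + n ∣ + toℕ (index x) - (+ toℕ (index u) + l)
          reach l refl = subst (λ g → + n ∣ + toℕ g - (+ toℕ (index u) + l)) (sym (index-vertex _)) (toℕ[]-≈ {n} (+ toℕ (index u) + l))

    module _ (C : ConnectionSet ℤ[ n ]) (L : List ℤ) (set⇔ : ∀ s → s ∈ˢ ConnectionSet.set C ⇔ s ∈ map [_] L) where

      Cay-difference : ∀ g g′ → Graph.Adj (Cay ℤ[ n ] C) g g′ ⇔ Difference L g g′
      Cay-difference g g′ = mk⇔ to from
        where
        to : Graph.Adj (Cay ℤ[ n ] C) g g′ → Difference L g g′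
        to (s , s∈ , refl) = Any.map (λ {l} → step l) (Any.map⁻ (Equivalence.to (set⇔ s) s∈))
          where
          lemma : ∀ u g t l → u - (g + t) + (t - l) ≡ u - (g + l)
          lemma = solve-∀
          step : ∀ l → s ≡ [ l ] → + n ∣ + toℕ (g ⊕ s) - (+ toℕ g + l)
          step l refl = subst (+ n ∣_) (lemma (+ toℕ (g ⊕ [ l ])) (+ toℕ g) (+ toℕ ([_] {n} l)) l)
            (∣m∣n⇒∣m+n (toℕ[]-≈ {n} (+ toℕ g + + toℕ ([_] {n} l))) (toℕ[]-≈ {n} l))
        from : Difference L g g′ → Graph.Adj (Cay ℤ[ n ] C) g g′
        from diff with find diff
        ... | l , l∈ , n∣ = [ l ] , Equivalence.from (set⇔ [ l ]) (∈-map⁺ [_] l∈) ,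
          trans (sym ([toℕ] g′)) (trans ([]-≈ {n} (+ toℕ g′) (+ toℕ g + l) n∣) (trans (sym ([]-⊕ (+ toℕ g) l)) (cong (_⊕ [ l ]) ([toℕ] g))))

      ≅⇒coordinates : Γ ≅ Cay ℤ[ n ] C → Coordinates L
      ≅⇒coordinates iso = record
        { vertices = _≅_.vertices iso
        ; edges    = λ u v → mk⇔
            (λ adj → Equivalence.to (Cay-difference _ _) (Equivalence.to (_≅_.edges iso u v) adj))
            (λ diff → Equivalence.from (_≅_.edges iso u v) (Equivalence.from (Cay-difference _ _) diff))
        }

      coordinates⇒≅ : Coordinates L → Γ ≅ Cay ℤ[ n ] C
      coordinates⇒≅ coords = record
        { vertices = vertices
        ; edges    = λ u v → mk⇔
            (λ adj → Equivalence.from (Cay-difference _ _) (Equivalence.to (edges u v) adj))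
            (λ diff → Equivalence.from (edges u v) (Equivalence.to (Cay-difference _ _) diff))
        }
        where open Coordinates coords

    -- Multiplication by a unit is an automorphism of the integers modulo `n`, so it carries one
    -- Cayley description to another; the two lists need only correspond modulo `n`.
    rescale : ∀ {L L′} u u′ → + n ∣ u * u′ - 1ℤ →
              (∀ {l} → l ∈ L → Any (λ l′ → + n ∣ u * l - l′) L′) → (∀ {l′} → l′ ∈ L′ → Any (λ l → + n ∣ u′ * l′ - l) L) →
              Coordinates L → Coordinates L′
    rescale {L} {L′} u u′ uu′ forth back coords = record
      { vertices = mk↔ₛ′ (scale u ∘ index) (vertex ∘ scale u′)
          (λ g → trans (cong (scale u) (index-vertex (scale u′ g))) (scale-inverse u u′ uu′ g))
          (λ v → trans (cong vertex (scale-inverse u′ u (subst (λ z → + n ∣ z - 1ℤ) (ℤ.*-comm u u′) uu′) (index v))) (vertex-index v))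
      ; edges = λ v w → mk⇔
          (λ adj → to v w (Equivalence.to (edges v w) adj))
          (λ diff → Equivalence.from (edges v w) (from v w diff))
      }
      where
      open Coordinates coords
      scale : ℤ → Fin n → Fin n
      scale u g = [ u * + toℕ g ]
      scale-inverse : ∀ u u′ → + n ∣ u * u′ - 1ℤ → ∀ g → scale u (scale u′ g) ≡ g
      scale-inverse u u′ uu′ g = trans ([]-≈ {n} (u * + toℕ (scale u′ g)) (+ toℕ g) (∣-combine₂ (toℕ[]-≈ {n} (u′ * + toℕ g)) uu′ u (+ toℕ g)
        (lemma u u′ (+ toℕ g) (+ toℕ (scale u′ g))))) ([toℕ] g)
        where
        lemma : ∀ u u′ g t → u * (t - u′ * g) + g * (u * u′ - 1ℤ) ≡ u * t - g
        lemma = solve-∀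
      to : ∀ v w → Difference L (index v) (index w) → Difference L′ (scale u (index v)) (scale u (index w))
      to v w diff with find diff
      ... | l , l∈ , n∣ = Any.map step (forth l∈)
        where
        lemma : ∀ s t u g g′ l l′ → 1ℤ * (t - u * g′) + -1ℤ * (s - u * g) + u * (g′ - (g + l)) + 1ℤ * (u * l - l′) ≡ t - (s + l′)
        lemma = solve-∀
        step : ∀ {l′} → + n ∣ u * l - l′ → + n ∣ + toℕ (scale u (index w)) - (+ toℕ (scale u (index v)) + l′)
        step {l′} ul = ∣-combine₄ (toℕ[]-≈ {n} (u * + toℕ (index w))) (toℕ[]-≈ {n} (u * + toℕ (index v))) n∣ ul 1ℤ -1ℤ u 1ℤ
          (lemma (+ toℕ (scale u (index v))) (+ toℕ (scale u (index w))) u (+ toℕ (index v)) (+ toℕ (index w)) l l′)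
      from : ∀ v w → Difference L′ (scale u (index v)) (scale u (index w)) → Difference L (index v) (index w)
      from v w diff with find diff
      ... | l′ , l′∈ , n∣ = Any.map step (back l′∈)
        where
        lemma : ∀ s t u u′ g g′ l l′ → u′ * (u * g′ - (u * g + l′)) + (g - g′) * (u * u′ - 1ℤ) + 1ℤ * (u′ * l′ - l) ≡ g′ - (g + l)
        lemma = solve-∀
        lemma₂ : ∀ s t u g g′ l′ → -1ℤ * (t - u * g′) + 1ℤ * (s - u * g) + 1ℤ * (t - (s + l′)) ≡ u * g′ - (u * g + l′)
        lemma₂ = solve-∀
        step : ∀ {l} → + n ∣ u′ * l′ - l → + n ∣ + toℕ (index w) - (+ toℕ (index v) + l)
        step {l} ul = ∣-combine₃ (∣-combine₃ (toℕ[]-≈ {n} (u * + toℕ (index w))) (toℕ[]-≈ {n} (u * + toℕ (index v))) n∣ -1ℤ 1ℤ 1ℤ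
            (lemma₂ (+ toℕ (scale u (index v))) (+ toℕ (scale u (index w))) u (+ toℕ (index v)) (+ toℕ (index w)) l′)) uu′ ul
          u′ (+ toℕ (index v) - + toℕ (index w)) 1ℤ
          (lemma 0ℤ 0ℤ u u′ (+ toℕ (index v)) (+ toℕ (index w)) l l′)

  -- The order is the one in which `pairing` delivers a connection set: representatives, their
  -- inverses, then the self-inverse element.
  offsets : ℤ → ℤ → ℤ → List ℤ
  offsets a b h = a ∷ b ∷ - a ∷ - b ∷ h ∷ []

  labelling⇒magic : ∀ {m} (Γ : Graph m) n .{{_ : ℕ.NonZero n}} {h c} → Labelling n h c →
                    Coordinates Γ n (offsets 1ℤ (+ c) (+ h)) → Unique (map ([_] {n}) (0ℤ ∷ offsets 1ℤ (+ c) (+ h))) →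
                    ClosedDistanceMagic Γ
  labelling⇒magic {m} Γ n {h} {c} labelling coords unique = go (↔⇒≡ (Coordinates.vertices coords)) Γ coords
    where
    open Labelling labelling
    -- Generalised over `m` so that matching on `m ≡ n` puts vertices and values into the same
    -- finite set, as a permutation requires.
    go : ∀ {m} → m ≡ n → (Γ : Graph m) → Coordinates Γ n (offsets 1ℤ (+ c) (+ h)) → ClosedDistanceMagic Γ
    -- A label is a value plus one, and a closed neighbourhood has six vertices: hence the `6`,
    -- which also makes the magic constant positive.
    go refl Γ coords = ℓ , 6 ℕ.+ (total ℕ.∸ excess) , ℕ.z<s , λ u → trans
        (neighbourhood-sum (label ℓ) unique u)
        (trans (cong₂ ℕ._+_ (trans (label≡ u 0ℤ) (cong (suc ∘ value) (ℤ.+-identityʳ (x u)))) (cong₂ ℕ._+_ (label≡ u 1ℤ) (cong₂ ℕ._+_ (label≡ u (+ c))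
          (cong₂ ℕ._+_ (label≡ u -1ℤ) (cong₂ ℕ._+_ (label≡ u (- + c)) (cong (ℕ._+ 0) (label≡ u (+ h))))))))
        (trans (lemma (value (x u)) (value (x u + 1ℤ)) (value (x u + + c)) (value (x u - 1ℤ)) (value (x u - + c)) (value (x u + + h)))
               (cong (6 ℕ.+_) (trans (sym (ℕ.m+n∸n≡m (starSum (x u)) excess)) (cong (ℕ._∸ excess) (magic (x u)))))))
      where
      open Coordinates coords
      f : Fin n → Fin n
      f v = fromℕ< (bounded (+ toℕ (index v)))
      toℕ-f : ∀ v → toℕ (f v) ≡ value (+ toℕ (index v))
      toℕ-f v = toℕ-fromℕ< (bounded (+ toℕ (index v)))
      f-injective : ∀ {v w} → f v ≡ f w → v ≡ w
      f-injective {v} {w} eq = trans (sym (vertex-index v)) (trans (cong vertex (trans (sym ([toℕ] (index v))) (trans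
        ([]-≈ {n} (+ toℕ (index v)) (+ toℕ (index w)) (injective (+ toℕ (index v)) (+ toℕ (index w)) (trans (sym (toℕ-f v)) (trans (cong toℕ eq) (toℕ-f w)))))
        ([toℕ] (index w))))) (vertex-index w))
      ℓ : Permutation′ n
      ℓ = injective⇒permutation f f-injective
      x : Fin n → ℤ
      x u = + toℕ (index u)
      label≡ : ∀ u l → label ℓ (translate u l) ≡ suc (value (x u + l))
      label≡ u l = cong suc (trans (toℕ-f (translate u l)) (respects _ _
        (subst (λ g → + n ∣ + toℕ g - (x u + l)) (sym (index-vertex _)) (toℕ[]-≈ {n} (x u + l)))))
      lemma : ∀ v₀ v₁ vc v₋₁ v₋c vh → suc v₀ ℕ.+ (suc v₁ ℕ.+ (suc vc ℕ.+ (suc v₋₁ ℕ.+ (suc v₋c ℕ.+ (suc vh ℕ.+ 0))))) ≡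
              6 ℕ.+ (v₀ ℕ.+ (v₁ ℕ.+ v₋₁) ℕ.+ (vc ℕ.+ v₋c) ℕ.+ vh)
      lemma = ℕSolver.solve-∀

  -- Connection sets of valency five

  ⊖-involutive : ∀ {n} .{{_ : ℕ.NonZero n}} (x : Fin n) → ⊖ (⊖ x) ≡ x
  ⊖-involutive x = trans ([]-⊖ (- + toℕ x)) (trans (cong [_] (ℤ.neg-involutive (+ toℕ x))) ([toℕ] x))

  -- `n` divides `2 x`, and `0 < 2 x < 2 n` leaves a single multiple.
  ⊖-fixed : ∀ {n} .{{_ : ℕ.NonZero n}} (x : Fin n) → ⊖ x ≡ x → [ 0ℤ ] ≢ x → n ≡ toℕ x ℕ.+ toℕ x
  ⊖-fixed {n} x ⊖x≡x x≢0 = unique-multiple (∣⇒∣ᵤ n∣2x)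
    where
    lemma : ∀ t → -1ℤ * (- t - t) ≡ t + t
    lemma = solve-∀
    n∣2x : + n ∣ + (toℕ x ℕ.+ toℕ x)
    n∣2x = subst (+ n ∣_) (lemma (+ toℕ x)) (∣n⇒∣m*n -1ℤ ([]-≈⁻¹ {n} (- + toℕ x) (+ toℕ x) (trans ⊖x≡x (sym ([toℕ] x)))))
    x+x<2n : toℕ x ℕ.+ toℕ x ℕ.< 2 ℕ.* n
    x+x<2n = subst (toℕ x ℕ.+ toℕ x ℕ.<_) (cong (n ℕ.+_) (sym (ℕ.+-identityʳ n))) (ℕ.+-mono-< (toℕ<n x) (toℕ<n x))
    unique-multiple : n ℕ.∣ toℕ x ℕ.+ toℕ x → n ≡ toℕ x ℕ.+ toℕ x
    unique-multiple (ℕ.divides 0 eq) = contradiction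
      (trans (cong (λ k → [ + k ]) (sym (ℕ.m+n≡0⇒m≡0 (toℕ x) eq))) ([toℕ] x)) x≢0
    unique-multiple (ℕ.divides 1 eq) = sym (trans eq (ℕ.+-identityʳ n))
    unique-multiple (ℕ.divides (suc (suc k)) eq) = contradiction
      (ℕ.≤-trans (ℕ.*-monoˡ-≤ n (ℕ.s≤s (ℕ.s≤s (ℕ.z≤n {k})))) (ℕ.≤-reflexive (sym eq))) (ℕ.<⇒≱ x+x<2n)

  involution-unique : ∀ {n} .{{_ : ℕ.NonZero n}} {x y : Fin n} → ⊖ x ≡ x → ⊖ y ≡ y → [ 0ℤ ] ≢ x → [ 0ℤ ] ≢ y → x ≡ y
  involution-unique {x = x} {y} ⊖x ⊖y x≢0 y≢0 = toℕ-injective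
    (double-injectiveℕ (trans (sym (⊖-fixed x ⊖x x≢0)) (⊖-fixed y ⊖y y≢0)))

  module _ {n : ℕ} .{{_ : ℕ.NonZero n}} (C : ConnectionSet ℤ[ n ]) where

    open ConnectionSet C

    Orbits : Set
    Orbits = ∃[ a ] ∃[ b ] ∃[ h ] (n ≡ toℕ h ℕ.+ toℕ h) × Unique ([ 0ℤ ] ∷ a ∷ b ∷ ⊖ a ∷ ⊖ b ∷ h ∷ []) ×
                (∀ s → s ∈ˢ set ⇔ s ∈ (a ∷ b ∷ ⊖ a ∷ ⊖ b ∷ h ∷ []))

    -- At most one nonzero element is its own inverse, so five elements can only be two inverse
    -- pairs and one such element.
    valency-5 : card set ≡ 5 → Orbits
    valency-5 ∣S∣≡5 = from-pairing (pairing ⊖_ ⊖-involutive _ xs ℕ.≤-refl (elements-unique set)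
        (∈-elements⁺ set ∘ inverseClosed ∘ ∈-elements⁻ set))
      where
      xs = elements set
      nonzero : ∀ {s} → s ∈ xs → [ 0ℤ ] ≢ s
      nonzero s∈ refl = ε∉set (∈-elements⁻ set s∈)
      from-pairing : ∃[ ys ] ∃[ zs ] xs ↭ ys ++ map ⊖_ ys ++ zs × All (λ z → ⊖ z ≡ z) zs → Orbits
      from-pairing (ys , zs , xs↭ , fixed) = by-shape ys zs xs↭ fixed
        (trans (sym (↭-length xs↭)) (trans (length-elements set) ∣S∣≡5))
        where
        two-involutions : ∀ {y z zs} vs → xs ↭ vs ++ y ∷ z ∷ zs → All (λ z → ⊖ z ≡ z) (y ∷ z ∷ zs) → Orbits
        two-involutions {y} {z} {zs} vs xs↭ (⊖y ∷ ⊖z ∷ _) = contradiction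
          (involution-unique ⊖y ⊖z (nonzero (∈-resp-↭ (↭-sym xs↭) (∈-++⁺ʳ vs (here refl)))) (nonzero (∈-resp-↭ (↭-sym xs↭) (∈-++⁺ʳ vs (there (here refl))))))
          (y≢z vs (Unique-resp-↭ xs↭ (elements-unique set)))
          where
          y≢z : ∀ vs → Unique (vs ++ y ∷ z ∷ zs) → y ≢ z
          y≢z []       ((y≢z ∷ _) ∷ _) = y≢z
          y≢z (v ∷ vs) (_ ∷ unique)    = y≢z vs unique
        by-shape : ∀ ys zs → xs ↭ ys ++ map ⊖_ ys ++ zs → All (λ z → ⊖ z ≡ z) zs → length (ys ++ map ⊖_ ys ++ zs) ≡ 5 → Orbits
        by-shape [] (y ∷ z ∷ zs) xs↭ fixed _ = two-involutions [] xs↭ fixed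
        by-shape (a ∷ []) (y ∷ z ∷ zs) xs↭ fixed _ = two-involutions (a ∷ ⊖ a ∷ []) xs↭ fixed
        by-shape (a ∷ b ∷ []) (h ∷ []) xs↭ (⊖h ∷ []) _ = a , b , h , ⊖-fixed h ⊖h (nonzero (∈-resp-↭ (↭-sym xs↭) (there (there (there (there (here refl))))))) ,
          (All.tabulate (λ s∈ → nonzero (∈-resp-↭ (↭-sym xs↭) s∈)) ∷ Unique-resp-↭ xs↭ (elements-unique set)) ,
          (λ s → mk⇔ (∈-resp-↭ xs↭ ∘ ∈-elements⁺ set) (∈-elements⁻ set ∘ ∈-resp-↭ (↭-sym xs↭)))
        by-shape (a ∷ b ∷ c ∷ ys) zs _ _ eq = contradiction
          (trans (sym (List.length-++ (a ∷ b ∷ c ∷ ys))) eq)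
          (too-long (length ys) (trans (List.length-++ (map ⊖_ (a ∷ b ∷ c ∷ ys))) (cong (ℕ._+ length zs) (List.length-map ⊖_ (a ∷ b ∷ c ∷ ys)))))
          where
          too-long : ∀ y {r z} → r ≡ 3 ℕ.+ y ℕ.+ z → 3 ℕ.+ y ℕ.+ r ≢ 5
          too-long y {z = z} refl eq = contradiction (trans (sym (lemma y z)) eq) λ ()
            where
            lemma : ∀ y z → 3 ℕ.+ y ℕ.+ (3 ℕ.+ y ℕ.+ z) ≡ 6 ℕ.+ (y ℕ.+ y ℕ.+ z)
            lemma = ℕSolver.solve-∀

  swap-coordinates : ∀ {m} {Γ : Graph m} {n} .{{_ : ℕ.NonZero n}} {a b h} → Coordinates Γ n (offsets a b h) → Coordinates Γ n (offsets b a h)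
  swap-coordinates {Γ = Γ} {n} coords = record
    { vertices = vertices
    ; edges    = λ u v → mk⇔ (swap ∘ Equivalence.to (edges u v)) (Equivalence.from (edges u v) ∘ swap)
    }
    where
    open Coordinates coords
    swap : ∀ {a b h g g′} → Difference Γ n (offsets a b h) g g′ → Difference Γ n (offsets b a h) g g′
    swap (here p)                         = there (here p)
    swap (there (here p))                 = here p
    swap (there (there (here p)))         = there (there (there (here p)))
    swap (there (there (there (here p)))) = there (there (here p))
    swap (there (there (there (there p)))) = there (there (there (there p)))

  -- Reduction to the connection set ±1, ±c, n/2

  module _ (h : ℕ) .{{_ : ℕ.NonZero h}} .{{_ : ℕ.NonZero (h ℕ.+ h)}} where

    private n = h ℕ.+ h

    open NormalForm h using (Normal; Cases; Distinct; n/2≡h; inverse-odd)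

    2∣h+h : 2 ℕ.∣ h ℕ.+ h
    2∣h+h = ℕ.divides h (lemma h)
      where
      lemma : ∀ h → h ℕ.+ h ≡ h ℕ.* 2
      lemma = ℕSolver.solve-∀

    module _ {c : ℕ} (1<c : 1 ℕ.< c) (c<h : c ℕ.< h) where

      -- Reversing the last three entries sorts the least residues: `0 < 1 < c < h < n − c < n − 1`.
      standard-unique : Unique (map ([_] {n}) (0ℤ ∷ offsets 1ℤ (+ c) (+ h)))
      standard-unique = Unique-resp-↭ (prep _ (prep _ (prep _ (↭-sym (↭-reverse ([_] {n} (+ h) ∷ [ - + c ] ∷ [ -1ℤ ] ∷ []))))))
        (Unique.map⁻ {f = toℕ} (subst Unique (sym residues) (AllPairs.map ℕ.<⇒≢ sorted)))
        where
        c≤n : c ℕ.≤ n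
        c≤n = ℕ.≤-trans (ℕ.<⇒≤ c<h) (ℕ.m≤m+n h h)
        1<h = ℕ.<-trans 1<c c<h
        1≤h = ℕ.<⇒≤ 1<h
        h<n : h ℕ.< n
        h<n = ℕ.m<m+n h 1≤h
        h<n∸c : h ℕ.< n ℕ.∸ c
        h<n∸c = ℕ.m+n≤o⇒m≤o∸n (suc h) (ℕ.≤-trans (ℕ.≤-reflexive (sym (ℕ.+-suc h c))) (ℕ.+-monoʳ-≤ h c<h))
        n∸c<n∸1 : n ℕ.∸ c ℕ.< n ℕ.∸ 1
        n∸c<n∸1 = ℕ.∸-monoʳ-< 1<c c≤n
        n∸1<n : n ℕ.∸ 1 ℕ.< n
        n∸1<n = ℕ.∸-monoʳ-< (ℕ.s≤s ℕ.z≤n) (ℕ.≤-trans 1≤h (ℕ.<⇒≤ h<n))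
        small : ∀ {k} → k ℕ.< n → toℕ ([_] {n} (+ k)) ≡ k
        small k<n = trans (toℕ-fromℕ< (n%ℕd<d (+ _) n)) (ℕ.m<n⇒m%n≡m k<n)
        complement : ∀ k → k ℕ.≤ n → [_] {n} (- + k) ≡ [ + (n ℕ.∸ k) ]
        complement k k≤n = []-≈ {n} (- + k) (+ (n ℕ.∸ k)) (divides -1ℤ
          (trans (cong (_-_ (- + k)) (trans (sym (ℤ.⊖-≥ k≤n)) (sym (ℤ.[+m]-[+n]≡m⊖n n k)))) (lemma (+ k) (+ n))))
          where
          lemma : ∀ k n → - k - (n - k) ≡ -1ℤ * n
          lemma = solve-∀
        residues : map toℕ (map ([_] {n}) (0ℤ ∷ 1ℤ ∷ + c ∷ + h ∷ - + c ∷ -1ℤ ∷ [])) ≡ 0 ∷ 1 ∷ c ∷ h ∷ n ℕ.∸ c ∷ n ℕ.∸ 1 ∷ []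
        residues = cong₂ _∷_ (small (ℕ.≤-trans (ℕ.s≤s ℕ.z≤n) h<n)) (cong₂ _∷_ (small (ℕ.<-trans 1<h h<n))
          (cong₂ _∷_ (small (ℕ.<-trans c<h h<n)) (cong₂ _∷_ (small h<n)
          (cong₂ _∷_ (trans (cong toℕ (complement c c≤n)) (small (ℕ.<-trans n∸c<n∸1 n∸1<n)))
          (cong₂ _∷_ (trans (cong toℕ (complement 1 (ℕ.≤-trans 1≤h (ℕ.<⇒≤ h<n)))) (small n∸1<n)) refl)))))
        sorted : AllPairs ℕ._<_ (0 ∷ 1 ∷ c ∷ h ∷ n ℕ.∸ c ∷ n ℕ.∸ 1 ∷ [])
        sorted = Linked⇒AllPairs ℕ.<-trans
          (ℕ.z<s ∷ 1<c ∷ c<h ∷ h<n∸c ∷ n∸c<n∸1 ∷ [-])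

    standard-set⇔ : ∀ c s → s ∈ˢ ±1,±c,n/2-set n c ⇔ s ∈ map [_] (offsets 1ℤ (+ c) (+ h))
    standard-set⇔ c s = mk⇔ to from
      where
      [n/2]≡[h] : [_] {n} (+ (n ℕ./ 2)) ≡ [ + h ]
      [n/2]≡[h] = cong (λ k → [ + k ]) n/2≡h
      to : s ∈ˢ ±1,±c,n/2-set n c → s ∈ map [_] (offsets 1ℤ (+ c) (+ h))
      to s∈ with x∈p∪q⁻ _ _ s∈
      ... | inj₁ e = here (x∈⁅y⁆⇒x≡y _ e)
      ... | inj₂ s∈ with x∈p∪q⁻ _ _ s∈
      ... | inj₁ e = there (there (here (x∈⁅y⁆⇒x≡y _ e)))
      ... | inj₂ s∈ with x∈p∪q⁻ _ _ s∈
      ... | inj₁ e = there (here (x∈⁅y⁆⇒x≡y _ e))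
      ... | inj₂ s∈ with x∈p∪q⁻ _ _ s∈
      ... | inj₁ e = there (there (there (here (x∈⁅y⁆⇒x≡y _ e))))
      ... | inj₂ e = there (there (there (there (here (trans (x∈⁅y⁆⇒x≡y _ e) [n/2]≡[h])))))
      from : s ∈ map [_] (offsets 1ℤ (+ c) (+ h)) → s ∈ˢ ±1,±c,n/2-set n c
      from (here refl)                                 = x∈p∪q⁺ (inj₁ (x∈⁅x⁆ _))
      from (there (here refl))                         = x∈p∪q⁺ (inj₂ (x∈p∪q⁺ (inj₂ (x∈p∪q⁺ (inj₁ (x∈⁅x⁆ _))))))
      from (there (there (here refl)))                 = x∈p∪q⁺ (inj₂ (x∈p∪q⁺ (inj₁ (x∈⁅x⁆ _))))
      from (there (there (there (here refl))))         = x∈p∪q⁺ (inj₂ (x∈p∪q⁺ (inj₂ (x∈p∪q⁺ (inj₂ (x∈p∪q⁺ (inj₁ (x∈⁅x⁆ _))))))))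
      from (there (there (there (there (here eq)))))   = subst (_∈ˢ ±1,±c,n/2-set n c) (trans [n/2]≡[h] (sym eq))
        (x∈p∪q⁺ (inj₂ (x∈p∪q⁺ (inj₂ (x∈p∪q⁺ (inj₂ (x∈p∪q⁺ (inj₂ (x∈⁅x⁆ _)))))))))

    module _ {m : ℕ} (Γ : Graph m) where

      Standard : Set
      Standard = ∃[ c ] Σ[ 1<c ∈ 1 ℕ.< c ] Σ[ c<h ∈ c ℕ.< h ] Coordinates Γ n (offsets 1ℤ (+ c) (+ h)) × Cases c

      -- The coordinates are rescaled by `u`; since `u a ≡ 1`, rescaling by `a` is the way back, and
      -- it sends `±1, ±c, h` to `±a, ±b, h`.
      normal⇒standard : ∀ {a b} → Coordinates Γ n (offsets a b (+ h)) → Normal a b → Standard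
      normal⇒standard {a} {b} coords (u , c , ua , ub , 1<c , c<h , cases) = c , 1<c , c<h , coords′ , cases
        where
        h-fixed : ∀ {u a} → + n ∣ u * a - 1ℤ → + n ∣ u * + h - + h
        h-fixed {u} {a} ua = from-quotient (inverse-odd {u} {a} ua)
          where
          lemma₁ : ∀ u h → u * h - h ≡ (u - 1ℤ) * h
          lemma₁ = solve-∀
          lemma₂ : ∀ k h → k * + 2 * h ≡ k * (h + h)
          lemma₂ = solve-∀
          from-quotient : + 2 ∣ u - 1ℤ → + n ∣ u * + h - + h
          from-quotient (divides k eq) = divides k (trans (lemma₁ u (+ h)) (trans (cong (_* + h) eq) (lemma₂ k (+ h))))
        negated : ∀ x y z → + n ∣ x * y - z → + n ∣ x * - y - - z
        negated x y z n∣ = subst (+ n ∣_) (lemma x y z) (∣m⇒∣-m n∣)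
          where
          lemma : ∀ x y z → - (x * y - z) ≡ x * - y - - z
          lemma = solve-∀
        negated⁻ : ∀ x y z → + n ∣ x * y - - z → + n ∣ x * - y - z
        negated⁻ x y z n∣ = subst (+ n ∣_) (lemma x y z) (∣m⇒∣-m n∣)
          where
          lemma : ∀ x y z → - (x * y - - z) ≡ x * - y - z
          lemma = solve-∀
        a·1 : + n ∣ a * 1ℤ - a
        a·1 = subst (+ n ∣_) (lemma a) (divides {+ n} 0ℤ refl)
          where
          lemma : ∀ a → 0ℤ ≡ a * 1ℤ - a
          lemma = solve-∀
        ac-from : ∀ {d} → + n ∣ u * b - d → + n ∣ a * d - b
        ac-from {d} ub = ∣-combine₂ ub ua (- a) b (lemma a b u d)
          where
          lemma : ∀ a b u d → - a * (u * b - d) + b * (u * a - 1ℤ) ≡ a * d - b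
          lemma = solve-∀
        ub-signed : + n ∣ u * b - + c ⊎ + n ∣ u * b - - + c
        ub-signed = by-sign ub
          where
          by-sign : + n ∣ u * b - + c ⊎ + n ∣ u * b + + c → + n ∣ u * b - + c ⊎ + n ∣ u * b - - + c
          by-sign (inj₁ n∣) = inj₁ n∣
          by-sign (inj₂ n∣) = inj₂ (subst (λ d → + n ∣ u * b + d) (sym (ℤ.neg-involutive (+ c))) n∣)
        forth : + n ∣ u * b - + c ⊎ + n ∣ u * b - - + c → ∀ {l} → l ∈ offsets a b (+ h) → Any (λ l′ → + n ∣ u * l - l′) (offsets 1ℤ (+ c) (+ h))
        forth _          (here refl)                         = here ua
        forth (inj₁ ub)  (there (here refl))                 = there (here ub)
        forth (inj₂ ub)  (there (here refl))                 = there (there (there (here ub)))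
        forth _          (there (there (here refl)))         = there (there (here (negated u a 1ℤ ua)))
        forth (inj₁ ub)  (there (there (there (here refl)))) = there (there (there (here (negated u b (+ c) ub))))
        forth (inj₂ ub)  (there (there (there (here refl)))) = there (here (negated⁻ u b (+ c) ub))
        forth _          (there (there (there (there (here refl))))) = there (there (there (there (here (h-fixed {u} {a} ua)))))
        back : + n ∣ u * b - + c ⊎ + n ∣ u * b - - + c → ∀ {l} → l ∈ offsets 1ℤ (+ c) (+ h) → Any (λ l′ → + n ∣ a * l - l′) (offsets a b (+ h))
        back _          (here refl)                         = here a·1
        back (inj₁ ub)  (there (here refl))                 = there (here (ac-from ub))
        back (inj₂ ub)  (there (here refl))                 = there (there (there (here
          (subst (λ d → + n ∣ a * d - - b) (ℤ.neg-involutive (+ c)) (negated a (- + c) b (ac-from ub))))))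
        back _          (there (there (here refl)))         = there (there (here (negated a 1ℤ a a·1)))
        back (inj₁ ub)  (there (there (there (here refl)))) = there (there (there (here (negated a (+ c) b (ac-from ub)))))
        back (inj₂ ub)  (there (there (there (here refl)))) = there (here (ac-from ub))
        back _          (there (there (there (there (here refl))))) = there (there (there (there (here
          (h-fixed {a} {u} (subst (λ z → + n ∣ z - 1ℤ) (ℤ.*-comm u a) ua))))))
        coords′ : Coordinates Γ n (offsets 1ℤ (+ c) (+ h))
        coords′ = rescale Γ n u a ua (forth ub-signed) (back ub-signed) coords

      module _ {a b : ℤ} (coords : Coordinates Γ n (offsets a b (+ h))) where

        open Coordinates coords

        -- A path from coordinate 0 to coordinate 1 writes 1 as a combination of `a`, `b`, `h`
        -- modulo `n`; the leftover multiple of `n = 2 h` is absorbed into the coefficient of `h`.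
        connected⇒generate : Connected Γ → Generate a b (+ h)
        connected⇒generate connected = conclude (reach (connected (vertex [ 0ℤ ]) (vertex [ 1ℤ ])))
          where
          Combination : ℤ → Set
          Combination z = ∃[ α ] ∃[ β ] ∃[ γ ] + n ∣ z - (α * a + β * b + γ * + h)
          add : ∀ {x y z l} → + n ∣ y - (x + l) → (∃[ α ] ∃[ β ] ∃[ γ ] l ≡ α * a + β * b + γ * + h) → Combination (z - y) → Combination (z - x)
          add {x} {y} {z} {l} n∣ (α , β , γ , refl) (α′ , β′ , γ′ , n∣′) = α + α′ , β + β′ , γ + γ′ ,
            ∣-combine₂ n∣ n∣′ 1ℤ 1ℤ (lemma x y z a b (+ h) α β γ α′ β′ γ′)
            where
            lemma : ∀ x y z a b h α β γ α′ β′ γ′ → 1ℤ * (y - (x + (α * a + β * b + γ * h))) + 1ℤ * (z - y - (α′ * a + β′ * b + γ′ * h)) ≡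
                    z - x - ((α + α′) * a + (β + β′) * b + (γ + γ′) * h)
            lemma = solve-∀
          coefficients : ∀ {l} → l ∈ offsets a b (+ h) → ∃[ α ] ∃[ β ] ∃[ γ ] l ≡ α * a + β * b + γ * + h
          coefficients (here refl) = 1ℤ , 0ℤ , 0ℤ , lemma a b (+ h)
            where
            lemma : ∀ a b h → a ≡ 1ℤ * a + 0ℤ * b + 0ℤ * h
            lemma = solve-∀
          coefficients (there (here refl)) = 0ℤ , 1ℤ , 0ℤ , lemma a b (+ h)
            where
            lemma : ∀ a b h → b ≡ 0ℤ * a + 1ℤ * b + 0ℤ * h
            lemma = solve-∀
          coefficients (there (there (here refl))) = -1ℤ , 0ℤ , 0ℤ , lemma a b (+ h)
            where
            lemma : ∀ a b h → - a ≡ -1ℤ * a + 0ℤ * b + 0ℤ * h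
            lemma = solve-∀
          coefficients (there (there (there (here refl)))) = 0ℤ , -1ℤ , 0ℤ , lemma a b (+ h)
            where
            lemma : ∀ a b h → - b ≡ 0ℤ * a + -1ℤ * b + 0ℤ * h
            lemma = solve-∀
          coefficients (there (there (there (there (here refl))))) = 0ℤ , 0ℤ , 1ℤ , lemma a b (+ h)
            where
            lemma : ∀ a b h → h ≡ 0ℤ * a + 0ℤ * b + 1ℤ * h
            lemma = solve-∀
          reach : ∀ {u v} → Star (Graph.Adj Γ) u v → Combination (+ toℕ (index v) - + toℕ (index u))
          reach {u} Star.ε = 0ℤ , 0ℤ , 0ℤ , divides 0ℤ (lemma (+ toℕ (index u)) a b (+ h))
            where
            lemma : ∀ x a b h → x - x - (0ℤ * a + 0ℤ * b + 0ℤ * h) ≡ 0ℤ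
            lemma = solve-∀
          reach {u} {v} (_◅_ {j = w} adj path) with find (Equivalence.to (edges u w) adj)
          ... | l , l∈ , n∣ = add {x = + toℕ (index u)} {y = + toℕ (index w)} {z = + toℕ (index v)} n∣ (coefficients l∈) (reach path)
          conclude : Combination (+ toℕ (index (vertex [ 1ℤ ])) - + toℕ (index (vertex [ 0ℤ ]))) → Generate a b (+ h)
          conclude (α , β , γ , n∣) = from-quotient (∣-combine₃ n∣ (toℕ[]-≈ {n} 1ℤ) (toℕ[]-≈ {n} 0ℤ) 1ℤ -1ℤ 1ℤ
            (trans (cong₂ (λ g g′ → 1ℤ * (+ toℕ g - + toℕ g′ - (α * a + β * b + γ * + h)) + -1ℤ * (+ toℕ ([_] {n} 1ℤ) - 1ℤ) + 1ℤ * (+ toℕ ([_] {n} 0ℤ) - 0ℤ))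
                          (index-vertex [ 1ℤ ]) (index-vertex [ 0ℤ ]))
                   (lemma (+ toℕ ([_] {n} 1ℤ)) (+ toℕ ([_] {n} 0ℤ)) (α * a + β * b + γ * + h))))
            where
            lemma : ∀ x y z → 1ℤ * (x - y - z) + -1ℤ * (x - 1ℤ) + 1ℤ * (y - 0ℤ) ≡ 1ℤ - z
            lemma = solve-∀
            from-quotient : + n ∣ 1ℤ - (α * a + β * b + γ * + h) → Generate a b (+ h)
            from-quotient (divides k eq) = α , β , γ + + 2 * k , by-adding (sym eq) (lemma₂ a b (+ h) α β γ k)
              where
              lemma₂ : ∀ a b h α β γ k → α * a + β * b + (γ + + 2 * k) * h + (1ℤ - (α * a + β * b + γ * h)) ≡ 1ℤ + k * (h + h)
              lemma₂ = solve-∀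

        unique⇒distinct : Unique (map ([_] {n}) (0ℤ ∷ offsets a b (+ h))) → Distinct a b
        unique⇒distinct ((0≢a ∷ 0≢b ∷ _) ∷ (a≢b ∷ _ ∷ a≢-b ∷ _) ∷ _) = record
          { a≢0  = λ n∣ → 0≢a (sym ([]-≈ {n} a 0ℤ (subst (+ n ∣_) (sym (ℤ.+-identityʳ a)) n∣)))
          ; b≢0  = λ n∣ → 0≢b (sym ([]-≈ {n} b 0ℤ (subst (+ n ∣_) (sym (ℤ.+-identityʳ b)) n∣)))
          ; a≢b  = λ n∣ → a≢b ([]-≈ {n} a b n∣)
          ; a≢-b = λ n∣ → a≢-b ([]-≈ {n} a (- b) (subst (λ z → + n ∣ a + z) (sym (ℤ.neg-involutive b)) n∣))
          }

        magic⇒standard : Unique (map ([_] {n}) (0ℤ ∷ offsets a b (+ h))) → Connected Γ → ClosedDistanceMagic Γ → Standard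
        magic⇒standard unique connected (ℓ , r , _ , magic) = by-order
          (normalisable h f (+ r) f-period f-injective (unique⇒distinct unique) (connected⇒generate connected) f-magic)
          where
          f : ℤ → ℤ
          f x = + label ℓ (vertex [ x ])
          f-period : Period f (+ n)
          f-period = periodic λ x → cong (λ g → + label ℓ (vertex g)) ([]-≈ {n} (x + + n) x (divides 1ℤ (lemma x (+ n))))
            where
            lemma : ∀ x n → x + n - x ≡ 1ℤ * n
            lemma = solve-∀
          ℓ-injective : ∀ {v w} → ℓ ⟨$⟩ʳ v ≡ ℓ ⟨$⟩ʳ w → v ≡ w
          ℓ-injective {v} {w} eq = trans (sym (Inverse.strictlyInverseʳ ℓ v)) (trans (cong (Inverse.from ℓ) eq) (Inverse.strictlyInverseʳ ℓ w))
          f-injective : ∀ x y → f x ≡ f y → + n ∣ x - y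
          f-injective x y eq = []-≈⁻¹ {n} x y (trans (sym (index-vertex [ x ])) (trans
            (cong index (ℓ-injective (toℕ-injective (ℕ.suc-injective (ℤ.+-injective eq))))) (index-vertex [ y ])))
          f-magic : ∀ x → f x + (f (x + a) + f (x - a)) + (f (x + b) + f (x - b)) + f (x + + h) ≡ + r
          f-magic x = begin
            f x + (f (x + a) + f (x - a)) + (f (x + b) + f (x - b)) + f (x + + h)
              ≡⟨ lemma (f x) (f (x + a)) (f (x - a)) (f (x + b)) (f (x - b)) (f (x + + h)) ⟩
            f x + (f (x + a) + (f (x + b) + (f (x - a) + (f (x - b) + (f (x + + h) + 0ℤ)))))
              ≡⟨ cong₂ _+_ (trans (cong f (sym (ℤ.+-identityʳ x))) (f≡ 0ℤ)) (cong₂ _+_ (f≡ a) (cong₂ _+_ (f≡ b) (cong₂ _+_ (f≡ (- a)) (cong₂ _+_ (f≡ (- b)) (cong (λ z → z + 0ℤ) (f≡ (+ h))))))) ⟩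
            + sum (map (label ℓ) (map (translate u) (0ℤ ∷ offsets a b (+ h))))
              ≡⟨ cong +_ (trans (sym (neighbourhood-sum (label ℓ) unique u)) (magic u)) ⟩
            + r ∎
            where
            open ≡-Reasoning
            u = vertex [ x ]
            lemma : ∀ f₀ f₁ f₂ f₃ f₄ f₅ → f₀ + (f₁ + f₂) + (f₃ + f₄) + f₅ ≡ f₀ + (f₁ + (f₃ + (f₂ + (f₄ + (f₅ + 0ℤ)))))
            lemma = solve-∀
            lemma₂ : ∀ t x l → -1ℤ * (t - x) ≡ x + l - (t + l)
            lemma₂ = solve-∀
            f≡ : ∀ l → f (x + l) ≡ + label ℓ (translate u l)
            f≡ l = cong (λ g → + label ℓ (vertex g)) ([]-≈ {n} (x + l) (+ toℕ (index u) + l)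
              (subst (+ n ∣_) (trans (lemma₂ (+ toℕ ([_] {n} x)) x l) (cong (λ g → x + l - (+ toℕ g + l)) (sym (index-vertex [ x ]))))
                (∣n⇒∣m*n -1ℤ (toℕ[]-≈ {n} x))))
          by-order : Normal a b ⊎ Normal b a → Standard
          by-order (inj₁ normal) = normal⇒standard coords normal
          by-order (inj₂ normal) = normal⇒standard (swap-coordinates coords) normal

  -- Assembly of the two directions

  StandardForm : ∀ {m} → Graph m → Set
  StandardForm Γ =
    ∃[ n ] ∃[ c ] Σ[ n≢0 ∈ ℕ.NonZero n ] Σ[ 2∣n ∈ 2 ℕ.∣ n ] Σ[ 1<c ∈ 1 ℕ.< c ] Σ[ c<n/2 ∈ c ℕ.< n ℕ./ 2 ]
      (Γ ≅ Cay (ℤ[ n ] {{n≢0}}) (±1,±c,n/2 n c {{n≢0}} 2∣n 1<c c<n/2)) ×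
      (CaseI n c ⊎ CaseII n c ⊎ CaseIII n c ⊎ CaseIV n c)

  standardForm⇒magic : ∀ {m} (Γ : Graph m) → StandardForm Γ → ClosedDistanceMagic Γ
  standardForm⇒magic Γ (n , c , n≢0 , 2∣n , 1<c , c<n/2 , iso , cases) =
    with-half n (n ℕ./ 2) {{n≢0}} {{ℕ.>-nonZero (ℕ.≤-trans (ℕ.s≤s ℕ.z≤n) c<n/2)}} halves refl 2∣n 1<c c<n/2 iso cases
    where
    halves : n ≡ n ℕ./ 2 ℕ.+ n ℕ./ 2
    halves = trans (sym (ℕ.m*[n/m]≡n 2∣n)) (cong (n ℕ./ 2 ℕ.+_) (ℕ.+-identityʳ (n ℕ./ 2)))
    -- Stated for variable `n` and `h` so that `n ≡ h + h` can be matched; the half `n / 2` itself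
    -- is not a variable.
    with-half : ∀ n h .{{_ : ℕ.NonZero n}} .{{_ : ℕ.NonZero h}} → n ≡ h ℕ.+ h → h ≡ n ℕ./ 2 → (2∣n : 2 ℕ.∣ n) (1<c : 1 ℕ.< c) (c<n/2 : c ℕ.< n ℕ./ 2) →
                Γ ≅ Cay ℤ[ n ] (±1,±c,n/2 n c 2∣n 1<c c<n/2) → CaseI n c ⊎ CaseII n c ⊎ CaseIII n c ⊎ CaseIV n c → ClosedDistanceMagic Γ
    with-half n h refl h≡ 2∣n 1<c c<n/2 iso cases = labelling⇒magic Γ n (cases⇒labelling h c 1<c cases)
      (≅⇒coordinates Γ n (±1,±c,n/2 n c 2∣n 1<c c<n/2) (offsets 1ℤ (+ c) (+ h)) (standard-set⇔ h c) iso)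
      (standard-unique h 1<c (subst (c ℕ.<_) (sym h≡) c<n/2))

  magic⇒standardForm : ∀ {m} (Γ : Graph m) n h .{{_ : ℕ.NonZero n}} → n ≡ h ℕ.+ h → ∀ {a b} → Coordinates Γ n (offsets a b (+ h)) →
                       Unique (map ([_] {n}) (0ℤ ∷ offsets a b (+ h))) → Connected Γ → ClosedDistanceMagic Γ → StandardForm Γ
  magic⇒standardForm Γ _ h@(suc _) refl coords unique connected magic = from-standard (magic⇒standard h Γ coords unique connected magic)
    where
    n = h ℕ.+ h
    from-standard : Standard h Γ → StandardForm Γ
    from-standard (c , 1<c , c<h , coords′ , cases) = n , c , _ , 2∣h+h h , 1<c , c<n/2 ,
      coordinates⇒≅ Γ n (±1,±c,n/2 n c (2∣h+h h) 1<c c<n/2) (offsets 1ℤ (+ c) (+ h)) (standard-set⇔ h c) coords′ , cases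
      where
      c<n/2 : c ℕ.< n ℕ./ 2
      c<n/2 = subst (c ℕ.<_) (sym (NormalForm.n/2≡h h)) c<h

  circulant-magic⇒standardForm : ∀ {m} (Γ : Graph m) → IsCirculant Γ 5 → Connected Γ → ClosedDistanceMagic Γ → StandardForm Γ
  circulant-magic⇒standardForm Γ circulant connected magic = from-orbits (valency-5 connectionSet ∣S∣≡valency)
    where
    open IsCirculant circulant
    S = ConnectionSet.set connectionSet
    from-orbits : Orbits connectionSet → StandardForm Γ
    from-orbits (a , b , h , n≡ , unique , set⇔) = magic⇒standardForm Γ n (toℕ h) n≡
      (≅⇒coordinates Γ n connectionSet L (λ s → subst (λ xs → s ∈ˢ S ⇔ s ∈ xs) (sym residues) (set⇔ s)) isomorphism)
      (subst (λ xs → Unique ([ 0ℤ ] ∷ xs)) (sym residues) unique) connected magic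
      where
      L = offsets (+ toℕ a) (+ toℕ b) (+ toℕ h)
      residues : map ([_] {n}) L ≡ a ∷ b ∷ ⊖ a ∷ ⊖ b ∷ h ∷ []
      residues = cong₂ _∷_ ([toℕ] a) (cong₂ _∷_ ([toℕ] b) (cong (λ x → ⊖ a ∷ ⊖ b ∷ x ∷ []) ([toℕ] h)))

open Classification using (circulant-magic⇒standardForm; standardForm⇒magic)
open import Data.Nat.Base using (ℕ; _<_; _/_; NonZero)
open import Data.Nat.Divisibility using (_∣_)
open import Data.Product.Base using (Σ-syntax; ∃-syntax; _×_)
open import Data.Sum.Base using (_⊎_)
open import Function.Bundles using (_⇔_; mk⇔)

theorem1p2 : ∀ {m : ℕ} (Γ : Graph m) → IsCirculant Γ 5 → Connected Γ →
    ClosedDistanceMagic Γ ⇔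
    (∃[ n ] ∃[ c ] Σ[ n≢0 ∈ NonZero n ] Σ[ 2∣n ∈ 2 ∣ n ] Σ[ 1<c ∈ 1 < c ] Σ[ c<n/2 ∈ c < n / 2 ]
    (Γ ≅ Cay (ℤ[ n ] {{n≢0}}) (±1,±c,n/2 n c {{n≢0}} 2∣n 1<c c<n/2)) ×
    (CaseI n c ⊎ CaseII n c ⊎ CaseIII n c ⊎ CaseIV n c))
theorem1p2 Γ circulant connected = mk⇔ (circulant-magic⇒standardForm Γ circulant connected) (standardForm⇒magic Γ)
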